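{- There is a randomized algorithm that, given $\varepsilon\in(0,1)$ and no knowledge of $n$, either returns a $(1\pm\varepsilon)$-approximation $\widehat{n}$ to $n$, or returns a $(1\pm\varepsilon)$-approximation $\widehat{\rho}$ to $n/d$. It uses $\mathbf{RandVert}$, $\mathbf{RandNbr}$, $\mathbf{Degree}$ and either the $\mathbf{Pair}$ or the $\mathbf{Additive}$ oracle. With the $\mathbf{Pair}$ oracle it makes $O(\varepsilon^{ -2}(n/d))$ queries. With the $\mathbf{Additive}$ oracle it makes $O(\varepsilon^{ -2}\sqrt{n/d})$ queries.
   Context: $G=(V,E)$ is an unknown simple undirected graph with $n=|V|$ vertices and $m=|E|$ edges, no isolated vertices, and average degree $d=2m/n$. The oracles are: - $\mathbf{RandVert}()$ returns a uniformly random vertex. - $\mathbf{RandNbr}(x)$ returns a uniformly random neighbor of $x$. - $\mathbf{Degree}(x)$ returns $\deg(x)$. - $\mathbf{Pair}(x,y)$ returns whether $\{x,y\}\in E$, at cost $1$. - $\mathbf{Additive}(S)$, for $S\subseteq V$, returns the number of edges with both endpoints in $S$, at cost $|S|$. The other oracles have unit cost. Vertex identifiers reveal nothing about $n$. A $(1\pm\varepsilon)$-approximation to a quantity $Q$ is a value in $[(1-\varepsilon)Q,(1+\varepsilon)Q]$. The guarantee holds with constant probability bounded away from $1/2$, and the query bounds are on expected queries. -}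

module Defs where

open import Data.Bool using (Bool; true; false; if_then_else_; _∧_)
open import Data.Nat as ℕ using (ℕ; zero; suc)
open import Data.Fin as Fin using (Fin)
open import Data.List using (List; length)
open import Data.Bool.ListAction using (any)
open import Data.Empty using (⊥)
open import Data.Unit using (⊤)
open import Data.Sum using (_⊎_; inj₁; inj₂)
open import Data.Product using (∃)
open import Data.Integer using (+_)
open import Data.Rational using (ℚ; 0ℚ; 1ℚ; ½; _+_; _*_; _-_; _/_; _≤ᵇ_)
open import Relation.Binary.PropositionalEquality using (_≡_)
open import Relation.Binary.Definitions using (DecidableEquality)
open import Relation.Nullary.Decidable using (⌊_⌋)

record Graph : Set where
  field
    n     : ℕ
    adj   : Fin n → Fin n → Bool
    sym   : ∀ x y → adj x y ≡ adj y x
    irr   : ∀ x → adj x x ≡ false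
    noIso : ∀ x → ∃ λ y → adj x y ≡ true
    nonempty : 0 ℕ.< n

sumFin : (k : ℕ) → (Fin k → ℚ) → ℚ
sumFin zero    f = 0ℚ
sumFin (suc k) f = f Fin.zero + sumFin k (λ i → f (Fin.suc i))

sumℕFin : (k : ℕ) → (Fin k → ℕ) → ℕ
sumℕFin zero    f = 0
sumℕFin (suc k) f = f Fin.zero ℕ.+ sumℕFin k (λ i → f (Fin.suc i))

countFin : (k : ℕ) → (Fin k → Bool) → ℕ
countFin k p = sumℕFin k (λ i → if p i then 1 else 0)

fromℕ : ℕ → ℚ
fromℕ k = (+ k) / 1

-- q / k as a rational (0 if k = 0; only ever used with k ≥ 1)
divℕ : ℚ → ℕ → ℚ
divℕ q zero    = 0ℚ
divℕ q (suc k) = q * ((+ 1) / suc k)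

module _ (G : Graph) where
  open Graph G

  deg : Fin n → ℕ
  deg x = countFin n (adj x)

  twoM : ℕ
  twoM = sumℕFin n deg

  -- n / d = n / (2m/n) = n² / (2m)
  nOverD : ℚ
  nOverD = divℕ (fromℕ (n ℕ.* n)) twoM

  inS : List (Fin n) → Fin n → Bool
  inS S x = any (λ y → ⌊ y Fin.≟ x ⌋) S

  -- Additive(S): number of edges with both endpoints in S
  -- (ordered adjacent pairs inside S, halved)
  edgesIn : List (Fin n) → ℕ
  edgesIn S = ℕ.⌊ sumℕFin n (λ x → countFin n (λ y → inS S x ∧ inS S y ∧ adj x y)) /2⌋

-- Randomized oracle algorithms, as (possibly non-terminating) state
-- machines over an abstract vertex type V.  Being polymorphic in V, an
-- algorithm cannot extract information (such as n) from identifiers;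
-- it may only compare them for equality.
-- Output: inj₁ n̂ (estimate of n) or inj₂ ρ̂ (estimate of n/d).

data Action (V S : Set) : Set where
  coin     : (Bool → S) → Action V S
  randVert : (V → S) → Action V S
  randNbr  : V → (V → S) → Action V S
  degree   : V → (ℕ → S) → Action V S
  pair     : V → V → (Bool → S) → Action V S
  additive : List V → (ℕ → S) → Action V S
  done     : ℚ ⊎ ℚ → Action V S

record Machine (V : Set) : Set₁ where
  field
    State : Set
    init  : State
    step  : State → Action V State

Algorithm : Set₁
Algorithm = (V : Set) → DecidableEquality V → ℚ → Machine V

UsesNoAdditive : {V S : Set} → Action V S → Set
UsesNoAdditive (additive _ _) = ⊥
UsesNoAdditive _              = ⊤

UsesNoPair : {V S : Set} → Action V S → Set
UsesNoPair (pair _ _ _) = ⊥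
UsesNoPair _            = ⊤

PairOnly : Algorithm → Set₁
PairOnly A = ∀ V eq ε → let open Machine (A V eq ε) in ∀ s → UsesNoAdditive (step s)

AdditiveOnly : Algorithm → Set₁
AdditiveOnly A = ∀ V eq ε → let open Machine (A V eq ε) in ∀ s → UsesNoPair (step s)

-- Semantics: running a machine on graph G (vertex type Fin n).
-- Quantities truncated after k steps; the true values are the limits
-- (suprema) as k → ∞.

module Run (G : Graph) (M : Machine (Fin (Graph.n G))) where
  open Graph G
  open Machine M

  avgVert : (Fin n → ℚ) → ℚ
  avgVert f = divℕ (sumFin n f) n

  avgNbr : Fin n → (Fin n → ℚ) → ℚ
  avgNbr x f = divℕ (sumFin n (λ y → if adj x y then f y else 0ℚ)) (deg G x)

  expCost : ℕ → State → ℚ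
  expCost zero    s = 0ℚ
  expCost (suc k) s with step s
  ... | coin f         = ½ * (expCost k (f true) + expCost k (f false))
  ... | randVert f     = 1ℚ + avgVert (λ v → expCost k (f v))
  ... | randNbr x f    = 1ℚ + avgNbr x (λ v → expCost k (f v))
  ... | degree x f     = 1ℚ + expCost k (f (deg G x))
  ... | pair x y f     = 1ℚ + expCost k (f (adj x y))
  ... | additive S f   = fromℕ (length S) + expCost k (f (edgesIn G S))
  ... | done _         = 0ℚ

  probOut : (ℚ ⊎ ℚ → Bool) → ℕ → State → ℚ
  probOut ok zero    s = 0ℚ
  probOut ok (suc k) s with step s
  ... | coin f         = ½ * (probOut ok k (f true) + probOut ok k (f false))
  ... | randVert f     = avgVert (λ v → probOut ok k (f v))
  ... | randNbr x f    = avgNbr x (λ v → probOut ok k (f v))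
  ... | degree x f     = probOut ok k (f (deg G x))
  ... | pair x y f     = probOut ok k (f (adj x y))
  ... | additive S f   = probOut ok k (f (edgesIn G S))
  ... | done o         = if ok o then 1ℚ else 0ℚ

approxᵇ : ℚ → ℚ → ℚ → Bool
approxᵇ ε Q x = ((1ℚ - ε) * Q ≤ᵇ x) ∧ (x ≤ᵇ (1ℚ + ε) * Q)

Correct : ℚ → Graph → ℚ ⊎ ℚ → Bool
Correct ε G (inj₁ n̂) = approxᵇ ε (fromℕ (Graph.n G)) n̂
Correct ε G (inj₂ ρ̂) = approxᵇ ε (nOverD G) ρ̂

-- success probability at least 2/3 (a constant bounded away from 1/2)
Succeeds : Algorithm → ℚ → Graph → Set
Succeeds A ε G = ∃ λ k → (+ 2) / 3 Data.Rational.≤ Run.probOut G M (Correct ε G) k (Machine.init M)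
  where M = A (Fin (Graph.n G)) Fin._≟_ ε

ExpCost : Algorithm → ℚ → Graph → ℕ → ℚ
ExpCost A ε G k = Run.expCost G M k (Machine.init M)
  where M = A (Fin (Graph.n G)) Fin._≟_ ε

{-# OPTIONS --safe #-}
module Submission where

open import Defs
open import Data.Product using (∃; _×_; _,_; proj₁; proj₂)
open import Data.Rational using (ℚ; 0ℚ; 1ℚ; _*_; _≤_; _<_)
open import Algebra.Bundles using (CommutativeRing; RawRing)
open import Algebra.Structures using (IsCommutativeRing)
import Algebra.Solver.Ring as RingSolver
import Algebra.Solver.Ring.AlmostCommutativeRing as ACR
open import Data.Bool using (Bool; true; false; if_then_else_; _∧_; _∨_; not; T)
open import Data.Bool.ListAction using (any)
open import Data.Empty using (⊥-elim)
open import Data.Unit using (⊤; tt)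
open import Data.Fin as Fin using (Fin)
import Data.Fin.Properties as Fin
open import Data.Integer as ℤ using (ℤ; +_; -[1+_])
import Data.Integer.Properties as ℤ
open import Data.List using (List; []; _∷_; length; _++_)
import Data.List.Properties as List
open import Data.Maybe as Maybe using (Maybe)
open import Data.Nat as ℕ using (ℕ; zero; suc)
import Data.Nat.DivMod as ℕ
import Data.Nat.Properties as ℕ
import Data.Rational as ℚ
import Data.Rational.Properties as ℚ
import Data.Rational.Unnormalised as ℚᵘ
import Data.Rational.Unnormalised.Properties as ℚᵘ
open import Data.Rational.Literals using (fromℤ)
open import Data.Sum using (_⊎_; inj₁; inj₂; [_,_]′)
open import Function using (_∘_)
open import Relation.Binary.Definitions using (DecidableEquality)
open import Relation.Binary.PropositionalEquality hiding (J)
open import Relation.Nullary using (Dec; yes; no; contradiction)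
open import Relation.Nullary.Decidable as Dec using (⌊_⌋; dec⇒maybe)

-- With pair queries: a random pair is an edge with probability d/n, so the number N of pairs drawn until T ~ ε⁻²
-- edges have been seen estimates n/d by N/T, by Chebyshev's inequality for the martingale (successes) − (d/n) N.
--
-- With additive queries, phases with k = 1, 2, 4, … are run. A phase takes y of the largest degree among ~ ε⁻² k
-- random neighbours of random vertices, and tests k random vertices for adjacency to y. If one is adjacent, n is
-- estimated by waiting for T neighbours of y among random vertices; this costs ~ ε⁻² n / deg y, but is started with
-- probability at most k deg y / n, hence adds only ~ ε⁻² k to the expected cost. If none is, then deg y ≲ n/k, and
-- the number X of edges between ~ ε⁻² pairs of k-samples, restricted to degrees at most deg y, has variance of the
-- order of its mean; X estimates the density once it is large. For k ≪ √(n/d) this happens with probability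
-- O(k² d/n), which is summable; for k ≳ √(n/d) the edges lost by the restriction are an ε fraction, because an edge
-- either has an endpoint of degree at most √(nd), and is then often met as (vertex, neighbour), or lies inside the few
-- vertices above √(nd); and X is then small only with small probability, so the expected cost stays O(ε⁻² √(n/d)).
--
-- Costs and failure probabilities are bounded by functions of the loop state that do not increase in expectation.

-- Both algorithms read ε only through q = `inverseSquare ε`, an integer with 1 ≤ qε² ≤ 2. Runs are
-- unbounded, so 2/3 is split as 1 - 1/4 - 1/12: at most 1/4 for a wrong answer and 1/12, by
-- Markov's inequality, for running out of steps. For the latter a potential must bound the number
-- of steps as well as the cost. In the additive case failures are counted in units of 1/96, of
-- which 24 may be spent. The obstacle there is that no phase knows whether k has reached √(n/d).
-- Seen from a critical phase J, early acceptance is rare by Markov's inequality, with a bound that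
-- shrinks by 4 for each phase further back; a few phases before J and all later ones are treated by
-- Chebyshev's inequality. `Additive` does not see multiplicities, and checking repeated samples one
-- by one makes the cost of a phase past J grow like k³. Each doubling then multiplies the cost by
-- 8, so the chance of passing on to the next phase must be well below 1/8; it is at most 1/48.
-- Square roots are avoided: a degree cutoff comes as a pair `s`, `τ` with sτ ≥ 1, and the final
-- cost bound is squared.

infixl 6 _⊕_ _⊝_
infixl 7 _⊗_
infix 8 ⊖_

-- The rational operations unfold eagerly to normalised fractions, which makes conversion checking blow up; hence the sealed copies.
opaque
  _⊕_ _⊗_ : ℚ → ℚ → ℚ
  _⊕_ = ℚ._+_
  _⊗_ = ℚ._*_

  ⊖_ : ℚ → ℚ
  ⊖_ = ℚ.-_

  inv : ℕ → ℚ
  inv zero    = 0ℚ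
  inv (suc k) = (+ 1) ℚ./ suc k

_⊝_ : ℚ → ℚ → ℚ
a ⊝ b = a ⊕ ⊖ b

ι : ℕ → ℚ
ι n = fromℤ (+ n)

fromℤ-+ : ∀ i j → fromℤ (i ℤ.+ j) ≡ fromℤ i ℚ.+ fromℤ j
fromℤ-+ i j = ℚ.toℚᵘ-injective (ℚᵘ.≃-trans
  (ℚᵘ.*≡* (cong (ℤ._* (+ 1)) (sym (cong₂ ℤ._+_ (ℤ.*-identityʳ i) (ℤ.*-identityʳ j)))))
  (ℚᵘ.≃-sym (ℚ.toℚᵘ-homo-+ (fromℤ i) (fromℤ j))))

fromℤ-* : ∀ i j → fromℤ (i ℤ.* j) ≡ fromℤ i ℚ.* fromℤ j
fromℤ-* i j = ℚ.toℚᵘ-injective (ℚᵘ.≃-trans (ℚᵘ.*≡* refl) (ℚᵘ.≃-sym (ℚ.toℚᵘ-homo-* (fromℤ i) (fromℤ j))))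

fromℤ-neg : ∀ i → fromℤ (ℤ.- i) ≡ ℚ.- fromℤ i
fromℤ-neg (+ zero)   = refl
fromℤ-neg (+ suc n)  = refl
fromℤ-neg (-[1+ n ]) = refl

fromℕ≡ι : ∀ n → fromℕ n ≡ ι n
fromℕ≡ι n = ℚ.↥p/↧p≡p (ι n)

fromℤ-homo : ℤ → ℚ
fromℤ-homo (+ n)      = ι n
fromℤ-homo (-[1+ n ]) = ⊖ ι (suc n)

opaque
  unfolding _⊕_

  isCommutativeRing : IsCommutativeRing _≡_ _⊕_ _⊗_ ⊖_ 0ℚ 1ℚ
  isCommutativeRing = ℚ.+-*-isCommutativeRing

  ⊕-mono-≤ : ∀ {a b c d} → a ≤ b → c ≤ d → a ⊕ c ≤ b ⊕ d
  ⊕-mono-≤ = ℚ.+-mono-≤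

  0≤⊗ : ∀ {a b} → 0ℚ ≤ a → 0ℚ ≤ b → 0ℚ ≤ a ⊗ b
  0≤⊗ {a} {b} 0≤a 0≤b = ℚ.nonNegative⁻¹ (a ℚ.* b)
    {{ℚ.nonNeg*nonNeg⇒nonNeg a {{ℚ.nonNegative 0≤a}} b {{ℚ.nonNegative 0≤b}}}}

  0≤⊖ : ∀ {a} → a ≤ 0ℚ → 0ℚ ≤ ⊖ a
  0≤⊖ = ℚ.neg-antimono-≤

  fromℤ≡ : ∀ i → fromℤ i ≡ fromℤ-homo i
  fromℤ≡ (+ n)      = refl
  fromℤ≡ (-[1+ n ]) = refl

  fromℤ-homo-+ : ∀ i j → fromℤ-homo (i ℤ.+ j) ≡ fromℤ-homo i ⊕ fromℤ-homo j
  fromℤ-homo-+ i j = trans (sym (fromℤ≡ (i ℤ.+ j))) (trans (fromℤ-+ i j) (cong₂ ℚ._+_ (fromℤ≡ i) (fromℤ≡ j)))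

  fromℤ-homo-* : ∀ i j → fromℤ-homo (i ℤ.* j) ≡ fromℤ-homo i ⊗ fromℤ-homo j
  fromℤ-homo-* i j = trans (sym (fromℤ≡ (i ℤ.* j))) (trans (fromℤ-* i j) (cong₂ ℚ._*_ (fromℤ≡ i) (fromℤ≡ j)))

  fromℤ-homo-neg : ∀ i → fromℤ-homo (ℤ.- i) ≡ ⊖ fromℤ-homo i
  fromℤ-homo-neg i = trans (sym (fromℤ≡ (ℤ.- i))) (trans (fromℤ-neg i) (cong ℚ.-_ (fromℤ≡ i)))

  inv-inverse : ∀ k → inv (suc k) ⊗ ι (suc k) ≡ 1ℚ
  inv-inverse k = trans (cong (ℚ._* ι (suc k)) eq) (ℚ.*-inverseˡ (ι (suc k)))
    where
    eq : (+ 1) ℚ./ suc k ≡ ℚ.1/ ι (suc k)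
    eq = ℚ.↥p/↧p≡p (ℚ.1/ ι (suc k))

  0≤inv : ∀ k → 0ℚ ≤ inv k
  0≤inv zero    = ℚ.≤-refl
  0≤inv (suc k) = subst (0ℚ ≤_) (sym (ℚ.↥p/↧p≡p (ℚ.1/ ι (suc k)))) (ℚ.nonNegative⁻¹ (ℚ.1/ ι (suc k)))

  ⊕≡+ : ∀ a b → a ⊕ b ≡ a ℚ.+ b
  ⊕≡+ a b = refl

  ⊗≡* : ∀ a b → a ⊗ b ≡ a * b
  ⊗≡* a b = refl

  ⊝≡- : ∀ a b → a ⊝ b ≡ a ℚ.- b
  ⊝≡- a b = refl

  divℕ≡⊗inv : ∀ a k → divℕ a k ≡ a ⊗ inv k
  divℕ≡⊗inv a zero    = sym (ℚ.*-zeroʳ a)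
  divℕ≡⊗inv a (suc k) = refl

commutativeRing : CommutativeRing _ _
commutativeRing = record { isCommutativeRing = isCommutativeRing }

open CommutativeRing commutativeRing using ()
  renaming ( +-assoc to ⊕-assoc; +-comm to ⊕-comm; +-identityˡ to ⊕-identityˡ; +-identityʳ to ⊕-identityʳ
           ; *-assoc to ⊗-assoc; *-comm to ⊗-comm; *-identityˡ to ⊗-identityˡ; *-identityʳ to ⊗-identityʳ
           ; zeroˡ to ⊗-zeroˡ; zeroʳ to ⊗-zeroʳ; distribˡ to ⊗-distribˡ )

ℤ-rawRing : RawRing _ _
ℤ-rawRing = CommutativeRing.rawRing ℤ.+-*-commutativeRing

ℚ-almostCommutativeRing : ACR.AlmostCommutativeRing _ _
ℚ-almostCommutativeRing = ACR.fromCommutativeRing commutativeRing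

fromℤ-morphism : ℤ-rawRing ACR.-Raw-AlmostCommutative⟶ ℚ-almostCommutativeRing
fromℤ-morphism = record
  { ⟦_⟧ = fromℤ-homo ; +-homo = fromℤ-homo-+ ; *-homo = fromℤ-homo-* ; -‿homo = fromℤ-homo-neg
  ; 0-homo = refl ; 1-homo = refl }

coefficient-≟ : ∀ i j → Maybe (fromℤ-homo i ≡ fromℤ-homo j)
coefficient-≟ i j = Maybe.map (cong fromℤ-homo) (dec⇒maybe (i ℤ.≟ j))

module Solver = RingSolver ℤ-rawRing ℚ-almostCommutativeRing fromℤ-morphism coefficient-≟

open Solver using (solve; _:=_; _:+_; _:*_; _:-_; :-_; con)

ι-+ : ∀ a b → ι (a ℕ.+ b) ≡ ι a ⊕ ι b
ι-+ a b = fromℤ-homo-+ (+ a) (+ b)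

ι-* : ∀ a b → ι (a ℕ.* b) ≡ ι a ⊗ ι b
ι-* a b = trans (cong fromℤ-homo (ℤ.pos-* a b)) (fromℤ-homo-* (+ a) (+ b))

ι-suc : ∀ a → ι (suc a) ≡ 1ℚ ⊕ ι a
ι-suc = ι-+ 1

ι-mono : ∀ {a b} → a ℕ.≤ b → ι a ≤ ι b
ι-mono {a} {b} a≤b = ℚ.*≤* (ℤ.*-monoʳ-≤-nonNeg (+ 1) (ℤ.+≤+ a≤b))

ι-cancel : ∀ {a b} → ι a ≤ ι b → a ℕ.≤ b
ι-cancel {a} {b} (ℚ.*≤* le) = ℤ.drop‿+≤+ (ℤ.*-cancelʳ-≤-pos (+ a) (+ b) (+ 1) le)

0≤ι : ∀ a → 0ℚ ≤ ι a
0≤ι a = ι-mono {0} {a} ℕ.z≤n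

inv⊗ : ∀ {k} → 0 ℕ.< k → inv k ⊗ ι k ≡ 1ℚ
inv⊗ {suc k} _ = inv-inverse k

-- The pattern of most estimates below: the difference `w` is written as a visibly nonnegative
-- expression in known gaps, and the identity is left to the ring solver.
≤-cert : ∀ {a b} w → 0ℚ ≤ w → b ≡ a ⊕ w → a ≤ b
≤-cert {a} w 0≤w refl = ℚ.≤-trans (ℚ.≤-reflexive (sym (⊕-identityʳ a))) (⊕-mono-≤ (ℚ.≤-refl {a}) 0≤w)

0≤⊕ : ∀ {a b} → 0ℚ ≤ a → 0ℚ ≤ b → 0ℚ ≤ a ⊕ b
0≤⊕ {a} {b} 0≤a 0≤b = ℚ.≤-trans 0≤a (≤-cert b 0≤b refl)

gap : ∀ {a b} → a ≤ b → 0ℚ ≤ b ⊝ a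
gap {a} {b} a≤b = ℚ.≤-trans (ℚ.≤-reflexive (solve 1 (λ a → con (+ 0) := a :- a) refl a)) (⊕-mono-≤ a≤b (ℚ.≤-refl {⊖ a}))

⊗-monoʳ-≤ : ∀ {a b c} → 0ℚ ≤ c → a ≤ b → c ⊗ a ≤ c ⊗ b
⊗-monoʳ-≤ {a} {b} {c} 0≤c a≤b = ≤-cert (c ⊗ (b ⊝ a)) (0≤⊗ 0≤c (gap a≤b))
  (solve 3 (λ a b c → c :* b := c :* a :+ c :* (b :- a)) refl a b c)

⊗-monoˡ-≤ : ∀ {a b c} → 0ℚ ≤ c → a ≤ b → a ⊗ c ≤ b ⊗ c
⊗-monoˡ-≤ {a} {b} {c} 0≤c a≤b = subst₂ _≤_ (⊗-comm c a) (⊗-comm c b) (⊗-monoʳ-≤ 0≤c a≤b)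

⊗-mono-≤ : ∀ {a b c d} → 0ℚ ≤ a → 0ℚ ≤ d → a ≤ b → c ≤ d → a ⊗ c ≤ b ⊗ d
⊗-mono-≤ 0≤a 0≤d a≤b c≤d = ℚ.≤-trans (⊗-monoʳ-≤ 0≤a c≤d) (⊗-monoˡ-≤ 0≤d a≤b)

0≤sq : ∀ a → 0ℚ ≤ a ⊗ a
0≤sq a with ℚ.≤-total 0ℚ a
... | inj₁ 0≤a = 0≤⊗ 0≤a 0≤a
... | inj₂ a≤0 = ℚ.≤-trans (0≤⊗ (0≤⊖ a≤0) (0≤⊖ a≤0)) (ℚ.≤-reflexive (solve 1 (λ a → (:- a) :* (:- a) := a :* a) refl a))

-- Cancellation of the factor `c`. A nonnegative inverse is asked for instead of `0 < c` because the
-- quantities in use come as inverse pairs, such as `ι k` and `inv k`, or `edgeProb` and `ρ`.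
≤-by-inverse : ∀ {a b} c {c⁻¹} → 0ℚ ≤ c⁻¹ → c⁻¹ ⊗ c ≡ 1ℚ → c ⊗ a ≤ c ⊗ b → a ≤ b
≤-by-inverse {a} {b} c {c⁻¹} 0≤c⁻¹ c⁻¹c le = subst₂ _≤_ (cancel a) (cancel b) (⊗-monoʳ-≤ 0≤c⁻¹ le)
  where
  cancel : ∀ x → c⁻¹ ⊗ (c ⊗ x) ≡ x
  cancel x = trans (sym (⊗-assoc c⁻¹ c x)) (trans (cong (_⊗ x) c⁻¹c) (⊗-identityˡ x))

-- Sums and means over finite sets

∑ : ∀ k → (Fin k → ℚ) → ℚ
∑ zero    f = 0ℚ
∑ (suc k) f = f Fin.zero ⊕ ∑ k (f ∘ Fin.suc)

∑-mono : ∀ k {f g : Fin k → ℚ} → (∀ i → f i ≤ g i) → ∑ k f ≤ ∑ k g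
∑-mono zero    f≤g = ℚ.≤-refl
∑-mono (suc k) f≤g = ⊕-mono-≤ (f≤g Fin.zero) (∑-mono k (f≤g ∘ Fin.suc))

∑-cong : ∀ k {f g : Fin k → ℚ} → (∀ i → f i ≡ g i) → ∑ k f ≡ ∑ k g
∑-cong zero    f≡g = refl
∑-cong (suc k) f≡g = cong₂ _⊕_ (f≡g Fin.zero) (∑-cong k (f≡g ∘ Fin.suc))

∑-⊕ : ∀ k (f g : Fin k → ℚ) → ∑ k (λ i → f i ⊕ g i) ≡ ∑ k f ⊕ ∑ k g
∑-⊕ zero    f g = sym (⊕-identityʳ 0ℚ)
∑-⊕ (suc k) f g = trans (cong (f Fin.zero ⊕ g Fin.zero ⊕_) (∑-⊕ k (f ∘ Fin.suc) (g ∘ Fin.suc)))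
  (solve 4 (λ a b c d → a :+ b :+ (c :+ d) := a :+ c :+ (b :+ d)) refl
    (f Fin.zero) (g Fin.zero) (∑ k (f ∘ Fin.suc)) (∑ k (g ∘ Fin.suc)))

∑-⊗ : ∀ k c (f : Fin k → ℚ) → ∑ k (λ i → c ⊗ f i) ≡ c ⊗ ∑ k f
∑-⊗ zero    c f = sym (⊗-zeroʳ c)
∑-⊗ (suc k) c f = trans (cong (c ⊗ f Fin.zero ⊕_) (∑-⊗ k c (f ∘ Fin.suc))) (sym (⊗-distribˡ c _ _))

∑-const : ∀ k c → ∑ k (λ _ → c) ≡ ι k ⊗ c
∑-const zero    c = sym (⊗-zeroˡ c)
∑-const (suc k) c = trans (cong (c ⊕_) (∑-const k c)) (trans
  (solve 2 (λ c k → c :+ k :* c := (con (+ 1) :+ k) :* c) refl c (ι k)) (cong (_⊗ c) (sym (ι-suc k))))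

ι-∑ : ∀ k (f : Fin k → ℕ) → ι (sumℕFin k f) ≡ ∑ k (ι ∘ f)
ι-∑ zero    f = refl
ι-∑ (suc k) f = trans (ι-+ (f Fin.zero) _) (cong (ι (f Fin.zero) ⊕_) (ι-∑ k (f ∘ Fin.suc)))

sumFin≡∑ : ∀ k (f : Fin k → ℚ) → sumFin k f ≡ ∑ k f
sumFin≡∑ zero    f = refl
sumFin≡∑ (suc k) f = trans (sym (⊕≡+ _ _)) (cong (f Fin.zero ⊕_) (sumFin≡∑ k (f ∘ Fin.suc)))

-- An expectation is a monotone, linear, normalised functional rather than a table of weights.
-- Sequencing is then composition, and Markov, Chebyshev and union bounds are all instances of
-- `mono`.
record Mean (A : Set) : Set where
  field
    E     : (A → ℚ) → ℚ
    mono  : ∀ {f g} → (∀ a → f a ≤ g a) → E f ≤ E g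
    add   : ∀ f g → E (λ a → f a ⊕ g a) ≡ E f ⊕ E g
    scale : ∀ c f → E (λ a → c ⊗ f a) ≡ c ⊗ E f
    const : ∀ c → E (λ _ → c) ≡ c

  E-cong : ∀ {f g} → (∀ a → f a ≡ g a) → E f ≡ E g
  E-cong f≡g = ℚ.≤-antisym (mono (ℚ.≤-reflexive ∘ f≡g)) (mono (ℚ.≤-reflexive ∘ sym ∘ f≡g))

  shift : ∀ c f → E (λ a → c ⊕ f a) ≡ c ⊕ E f
  shift c f = trans (add (λ _ → c) f) (cong (_⊕ E f) (const c))

  0≤E : ∀ {f} → (∀ a → 0ℚ ≤ f a) → 0ℚ ≤ E f
  0≤E {f} 0≤f = subst (_≤ E f) (const 0ℚ) (mono 0≤f)

  E≤ : ∀ {f c} → (∀ a → f a ≤ c) → E f ≤ c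
  E≤ {f} {c} f≤c = subst (E f ≤_) (const c) (mono f≤c)

  E-∑ : ∀ k (f : Fin k → A → ℚ) → E (λ a → ∑ k (λ i → f i a)) ≡ ∑ k (λ i → E (f i))
  E-∑ zero    f = const 0ℚ
  E-∑ (suc k) f = trans (add (f Fin.zero) _) (cong (E (f Fin.zero) ⊕_) (E-∑ k (f ∘ Fin.suc)))

open Mean using (E)
open module Mean′ {A : Set} (μ : Mean A) = Mean μ hiding (E)

pure : ∀ {A} → A → Mean A
pure a = record
  { E = λ f → f a ; mono = λ f≤g → f≤g a ; add = λ _ _ → refl ; scale = λ _ _ → refl ; const = λ _ → refl }

bindMean : ∀ {A B} → Mean A → (A → Mean B) → Mean B
bindMean μ ν = record
  { E     = λ f → E μ (λ a → E (ν a) f)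
  ; mono  = λ f≤g → mono μ (λ a → mono (ν a) f≤g)
  ; add   = λ f g → trans (E-cong μ (λ a → add (ν a) f g)) (add μ _ _)
  ; scale = λ c f → trans (E-cong μ (λ a → scale (ν a) c f)) (scale μ c _)
  ; const = λ c → trans (E-cong μ (λ a → const (ν a) c)) (const μ c)
  }

𝟙 : Bool → ℚ
𝟙 b = if b then 1ℚ else 0ℚ

0≤1 : 0ℚ ≤ 1ℚ
0≤1 = 0≤ι 1

0≤𝟙 : ∀ b → 0ℚ ≤ 𝟙 b
0≤𝟙 false = ℚ.≤-refl
0≤𝟙 true  = 0≤1

𝟙≤1 : ∀ b → 𝟙 b ≤ 1ℚ
𝟙≤1 false = 0≤1
𝟙≤1 true  = ℚ.≤-refl

count≡∑𝟙 : ∀ k (p : Fin k → Bool) → ι (countFin k p) ≡ ∑ k (𝟙 ∘ p)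
count≡∑𝟙 k p = trans (ι-∑ k _) (∑-cong k (λ i → ι-if (p i)))
  where
  ι-if : ∀ b → ι (if b then 1 else 0) ≡ 𝟙 b
  ι-if false = refl
  ι-if true  = refl

count-pos : ∀ k (p : Fin k → Bool) i → p i ≡ true → 0 ℕ.< countFin k p
count-pos (suc k) p Fin.zero    eq rewrite eq = ℕ.s≤s ℕ.z≤n
count-pos (suc k) p (Fin.suc i) eq = ℕ.≤-trans (count-pos k (p ∘ Fin.suc) i eq) (ℕ.m≤n+m _ (if p Fin.zero then 1 else 0))

module _ (G : Graph) where
  open Graph G using (n; adj; noIso; nonempty)

  deg-pos : ∀ x → 0 ℕ.< deg G x
  deg-pos x = let (y , xy) = noIso x in count-pos n (adj x) y xy

  weighted : (w : Fin n → ℚ) → (∀ y → 0ℚ ≤ w y) → ∑ n w ≡ 1ℚ → Mean (Fin n)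
  weighted w 0≤w ∑w≡1 = record
    { E     = λ f → ∑ n (λ y → w y ⊗ f y)
    ; mono  = λ f≤g → ∑-mono n (λ y → ⊗-monoʳ-≤ (0≤w y) (f≤g y))
    ; add   = λ f g → trans (∑-cong n (λ y → ⊗-distribˡ (w y) (f y) (g y))) (∑-⊕ n _ _)
    ; scale = λ c f → trans (∑-cong n (λ y → solve 3 (λ w c f → w :* (c :* f) := c :* (w :* f)) refl (w y) c (f y))) (∑-⊗ n c _)
    ; const = λ c → trans (∑-cong n (λ y → ⊗-comm (w y) c)) (trans (∑-⊗ n c w) (trans (cong (c ⊗_) ∑w≡1) (⊗-identityʳ c)))
    }

  vertex : Mean (Fin n)
  vertex = weighted (λ _ → inv n) (λ _ → 0≤inv n) (trans (∑-const n (inv n)) (trans (⊗-comm (ι n) (inv n)) (inv⊗ nonempty)))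

  neighbour : Fin n → Mean (Fin n)
  neighbour x = weighted (λ y → inv (deg G x) ⊗ 𝟙 (adj x y)) (λ y → 0≤⊗ (0≤inv (deg G x)) (0≤𝟙 (adj x y)))
    (trans (∑-⊗ n (inv (deg G x)) _) (trans (cong (inv (deg G x) ⊗_) (sym (count≡∑𝟙 n (adj x)))) (inv⊗ (deg-pos x))))

  E-vertex : ∀ f → E vertex f ≡ inv n ⊗ ∑ n f
  E-vertex f = ∑-⊗ n (inv n) f

  E-neighbour : ∀ x f → E (neighbour x) f ≡ inv (deg G x) ⊗ ∑ n (λ y → 𝟙 (adj x y) ⊗ f y)
  E-neighbour x f = trans (∑-cong n (λ y → ⊗-assoc (inv (deg G x)) (𝟙 (adj x y)) (f y))) (∑-⊗ n (inv (deg G x)) _)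

-- Oracle programs, loops and their potentials

data Oracle : Set where
  pairs additives : Oracle

-- Query trees are well-founded, so only the surrounding `loop` can run forever. The index records
-- the permitted edge oracle, which makes `PairOnly` and `AdditiveOnly` a matter of typing.
data Prog (V A : Set) : Oracle → Set where
  ret      : ∀ {κ} → A → Prog V A κ
  randVert : ∀ {κ} → (V → Prog V A κ) → Prog V A κ
  randNbr  : ∀ {κ} → V → (V → Prog V A κ) → Prog V A κ
  degree   : ∀ {κ} → V → (ℕ → Prog V A κ) → Prog V A κ
  pair     : V → V → (Bool → Prog V A pairs) → Prog V A pairs
  additive : List V → (ℕ → Prog V A additives) → Prog V A additives

infixl 1 _>>=_

_>>=_ : ∀ {V A B κ} → Prog V A κ → (A → Prog V B κ) → Prog V B κ
ret a        >>= f = f a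
randVert k   >>= f = randVert (λ v → k v >>= f)
randNbr x k  >>= f = randNbr x (λ v → k v >>= f)
degree x k   >>= f = degree x (λ d → k d >>= f)
pair x y k   >>= f = pair x y (λ b → k b >>= f)
additive S k >>= f = additive S (λ e → k e >>= f)

Output : Set
Output = ℚ ⊎ ℚ

module _ {V L : Set} {κ : Oracle} (body : L → Prog V (L ⊎ Output) κ) where

  act : Prog V (L ⊎ Output) κ → Action V (Prog V (L ⊎ Output) κ)
  -- A coin is free of cost; with its outcome ignored it serves as the silent step that starts the
  -- next iteration.
  act (ret (inj₁ l)) = coin (λ _ → body l)
  act (ret (inj₂ o)) = done o
  act (randVert k)   = randVert k
  act (randNbr x k)  = randNbr x k
  act (degree x k)   = degree x k
  act (pair x y k)   = pair x y k
  act (additive S k) = additive S k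

  loop : L → Machine V
  loop l = record { State = Prog V (L ⊎ Output) κ ; init = ret (inj₁ l) ; step = act }

act-pairs : ∀ {V L} (body : L → Prog V (L ⊎ Output) pairs) p → UsesNoAdditive (act body p)
act-pairs body (ret (inj₁ l)) = tt
act-pairs body (ret (inj₂ o)) = tt
act-pairs body (randVert k)   = tt
act-pairs body (randNbr x k)  = tt
act-pairs body (degree x k)   = tt
act-pairs body (pair x y k)   = tt

act-additives : ∀ {V L} (body : L → Prog V (L ⊎ Output) additives) p → UsesNoPair (act body p)
act-additives body (ret (inj₁ l)) = tt
act-additives body (ret (inj₂ o)) = tt
act-additives body (randVert k)   = tt
act-additives body (randNbr x k)  = tt
act-additives body (degree x k)   = tt
act-additives body (additive S k) = tt

half-double : ∀ a → ℚ.½ * (a ℚ.+ a) ≡ a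
half-double a = trans (ℚ.*-distribˡ-+ ℚ.½ a a) (trans (sym (ℚ.*-distribʳ-+ a ℚ.½ ℚ.½)) (ℚ.*-identityˡ a))

if-𝟙 : ∀ b q → (if b then q else 0ℚ) ≡ 𝟙 b ⊗ q
if-𝟙 false q = sym (⊗-zeroˡ q)
if-𝟙 true  q = sym (⊗-identityˡ q)

opaque
  unfolding _⊕_

  twelve⊗⅔ : ι 12 ⊗ ((+ 2) ℚ./ 3) ≡ ι 8
  twelve⊗⅔ = refl

archimedean : ∀ p → ∃ λ N → p ≤ ι N
archimedean (ℚ.mkℚ (+ a) d _)    = a , ℚ.*≤* (ℤ.*-monoˡ-≤-nonNeg (+ a) (ℤ.+≤+ (ℕ.s≤s ℕ.z≤n)))
archimedean (ℚ.mkℚ -[1+ a ] d _) = 0 , ℚ.*≤* ℤ.-≤+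

module _ (G : Graph) where
  open Graph G using (n; adj)

  ⟦_⟧ : ∀ {A κ} → Prog (Fin n) A κ → Mean A
  ⟦ ret a ⟧        = pure a
  ⟦ randVert k ⟧   = bindMean (vertex G) (λ v → ⟦ k v ⟧)
  ⟦ randNbr x k ⟧  = bindMean (neighbour G x) (λ v → ⟦ k v ⟧)
  ⟦ degree x k ⟧   = ⟦ k (deg G x) ⟧
  ⟦ pair x y k ⟧   = ⟦ k (adj x y) ⟧
  ⟦ additive S k ⟧ = ⟦ k (edgesIn G S) ⟧

  -- An Additive query is charged one extra unit, so that the number of steps is bounded by the cost even when S is empty.
  cost : ∀ {A κ} → Prog (Fin n) A κ → ℚ
  cost (ret a)        = 0ℚ
  cost (randVert k)   = 1ℚ ⊕ E (vertex G) (λ v → cost (k v))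
  cost (randNbr x k)  = 1ℚ ⊕ E (neighbour G x) (λ v → cost (k v))
  cost (degree x k)   = 1ℚ ⊕ cost (k (deg G x))
  cost (pair x y k)   = 1ℚ ⊕ cost (k (adj x y))
  cost (additive S k) = ι (suc (length S)) ⊕ cost (k (edgesIn G S))

  0≤cost : ∀ {A κ} (p : Prog (Fin n) A κ) → 0ℚ ≤ cost p
  0≤cost (ret a)        = ℚ.≤-refl
  0≤cost (randVert k)   = 0≤⊕ 0≤1 (0≤E (vertex G) (λ v → 0≤cost (k v)))
  0≤cost (randNbr x k)  = 0≤⊕ 0≤1 (0≤E (neighbour G x) (λ v → 0≤cost (k v)))
  0≤cost (degree x k)   = 0≤⊕ 0≤1 (0≤cost (k (deg G x)))
  0≤cost (pair x y k)   = 0≤⊕ 0≤1 (0≤cost (k (adj x y)))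
  0≤cost (additive S k) = 0≤⊕ (0≤ι (suc (length S))) (0≤cost (k (edgesIn G S)))

  E->>= : ∀ {A B κ} (p : Prog (Fin n) A κ) (f : A → Prog (Fin n) B κ) g →
          E ⟦ p >>= f ⟧ g ≡ E ⟦ p ⟧ (λ a → E ⟦ f a ⟧ g)
  E->>= (ret a)        f g = refl
  E->>= (randVert k)   f g = E-cong (vertex G) (λ v → E->>= (k v) f g)
  E->>= (randNbr x k)  f g = E-cong (neighbour G x) (λ v → E->>= (k v) f g)
  E->>= (degree x k)   f g = E->>= (k (deg G x)) f g
  E->>= (pair x y k)   f g = E->>= (k (adj x y)) f g
  E->>= (additive S k) f g = E->>= (k (edgesIn G S)) f g

  private
    cost-step : ∀ {A : Set} (μ : Mean A) c {f g h : A → ℚ} → (∀ a → f a ≡ g a ⊕ h a) → c ⊕ E μ f ≡ (c ⊕ E μ g) ⊕ E μ h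
    cost-step μ c {f} {g} {h} eq = trans (cong (c ⊕_) (trans (E-cong μ eq) (add μ g h))) (sym (⊕-assoc c (E μ g) (E μ h)))

  cost->>= : ∀ {A B κ} (p : Prog (Fin n) A κ) (f : A → Prog (Fin n) B κ) →
             cost (p >>= f) ≡ cost p ⊕ E ⟦ p ⟧ (λ a → cost (f a))
  cost->>= (ret a)        f = sym (⊕-identityˡ _)
  cost->>= (randVert k)   f = cost-step (vertex G) 1ℚ (λ v → cost->>= (k v) f)
  cost->>= (randNbr x k)  f = cost-step (neighbour G x) 1ℚ (λ v → cost->>= (k v) f)
  cost->>= (degree x k)   f = cost-step (pure tt) 1ℚ (λ _ → cost->>= (k (deg G x)) f)
  cost->>= (pair x y k)   f = cost-step (pure tt) 1ℚ (λ _ → cost->>= (k (adj x y)) f)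
  cost->>= (additive S k) f = cost-step (pure tt) (ι (suc (length S))) (λ _ → cost->>= (k (edgesIn G S)) f)

  onLoop : ∀ {L : Set} → (L → ℚ) → (Output → ℚ) → L ⊎ Output → ℚ
  onLoop f g (inj₁ l) = f l
  onLoop f g (inj₂ o) = g o

  failure : (Output → Bool) → Output → ℚ
  failure ok o = if ok o then 0ℚ else 1ℚ

  -- The leading unit in `Φ-step` pays for the free coin that restarts the loop. Hence every step
  -- before the output consumes at least one unit, and `Φ` bounds the expected number of steps as
  -- well as the expected cost.
  module Soundness
    {L : Set} {κ : Oracle} (body : L → Prog (Fin n) (L ⊎ Output) κ) (l₀ : L)
    (Φ : L → ℚ) (0≤Φ : ∀ l → 0ℚ ≤ Φ l)
    (Φ-step : ∀ l → 1ℚ ⊕ (cost (body l) ⊕ E ⟦ body l ⟧ (onLoop Φ (λ _ → 0ℚ))) ≤ Φ l)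
    where

    module R = Run G (loop body l₀)

    avgVert≡E : ∀ f → R.avgVert f ≡ E (vertex G) f
    avgVert≡E f = trans (divℕ≡⊗inv _ n) (trans (⊗-comm _ (inv n)) (trans (cong (inv n ⊗_) (sumFin≡∑ n f)) (sym (E-vertex G f))))

    avgNbr≡E : ∀ x f → R.avgNbr x f ≡ E (neighbour G x) f
    avgNbr≡E x f = trans (divℕ≡⊗inv _ (deg G x)) (trans (⊗-comm _ (inv (deg G x))) (trans
      (cong (inv (deg G x) ⊗_) (trans (sumFin≡∑ n _) (∑-cong n (λ y → if-𝟙 (adj x y) (f y)))))
      (sym (E-neighbour G x f))))

    Φ̂ : L ⊎ Output → ℚ
    Φ̂ = onLoop Φ (λ _ → 0ℚ)

    0≤Φ̂ : ∀ a → 0ℚ ≤ Φ̂ a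
    0≤Φ̂ (inj₁ l) = 0≤Φ l
    0≤Φ̂ (inj₂ o) = ℚ.≤-refl

    potential : Prog (Fin n) (L ⊎ Output) κ → ℚ
    potential p = cost p ⊕ E ⟦ p ⟧ Φ̂

    0≤potential : ∀ p → 0ℚ ≤ potential p
    0≤potential p = 0≤⊕ (0≤cost p) (0≤E ⟦ p ⟧ 0≤Φ̂)

    potential-ret : ∀ l → 1ℚ ⊕ potential (body l) ≤ potential (ret (inj₁ l))
    potential-ret l = ℚ.≤-trans (Φ-step l) (ℚ.≤-reflexive (sym (⊕-identityˡ (Φ l))))

    average : ∀ {A : Set} (μ : Mean A) c (g h : A → ℚ) → c ⊕ E μ (λ a → g a ⊕ h a) ≡ (c ⊕ E μ g) ⊕ E μ h
    average μ c g h = cost-step μ c (λ _ → refl)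

    expCost≤ : ∀ k p → R.expCost k p ≤ potential p
    expCost≤ zero    p = 0≤potential p
    expCost≤ (suc k) (ret (inj₁ l)) = ℚ.≤-trans (ℚ.≤-reflexive (half-double _)) (ℚ.≤-trans (expCost≤ k (body l))
      (ℚ.≤-trans (≤-cert 1ℚ 0≤1 (⊕-comm 1ℚ _)) (potential-ret l)))
    expCost≤ (suc k) (ret (inj₂ o)) = ℚ.≤-reflexive (sym (⊕-identityˡ 0ℚ))
    expCost≤ (suc k) (randVert f) = ℚ.≤-trans (ℚ.≤-reflexive (trans (sym (⊕≡+ 1ℚ _)) (cong (1ℚ ⊕_) (avgVert≡E _))))
      (ℚ.≤-trans (⊕-mono-≤ ℚ.≤-refl (mono (vertex G) (λ v → expCost≤ k (f v)))) (ℚ.≤-reflexive (average (vertex G) 1ℚ _ _)))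
    expCost≤ (suc k) (randNbr x f) = ℚ.≤-trans (ℚ.≤-reflexive (trans (sym (⊕≡+ 1ℚ _)) (cong (1ℚ ⊕_) (avgNbr≡E x _))))
      (ℚ.≤-trans (⊕-mono-≤ ℚ.≤-refl (mono (neighbour G x) (λ v → expCost≤ k (f v)))) (ℚ.≤-reflexive (average (neighbour G x) 1ℚ _ _)))
    expCost≤ (suc k) (degree x f) = ℚ.≤-trans (ℚ.≤-reflexive (sym (⊕≡+ 1ℚ _)))
      (ℚ.≤-trans (⊕-mono-≤ (ℚ.≤-refl {1ℚ}) (expCost≤ k (f (deg G x)))) (ℚ.≤-reflexive (sym (⊕-assoc 1ℚ _ _))))
    expCost≤ (suc k) (pair x y f) = ℚ.≤-trans (ℚ.≤-reflexive (sym (⊕≡+ 1ℚ _)))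
      (ℚ.≤-trans (⊕-mono-≤ (ℚ.≤-refl {1ℚ}) (expCost≤ k (f (adj x y)))) (ℚ.≤-reflexive (sym (⊕-assoc 1ℚ _ _))))
    expCost≤ (suc k) (additive S f) = ℚ.≤-trans (ℚ.≤-reflexive (trans (cong (ℚ._+ R.expCost k (f (edgesIn G S))) (fromℕ≡ι (length S))) (sym (⊕≡+ _ _))))
      (ℚ.≤-trans (⊕-mono-≤ (ι-mono (ℕ.n≤1+n (length S))) (expCost≤ k (f (edgesIn G S)))) (ℚ.≤-reflexive (sym (⊕-assoc _ _ _))))

    -- Needed where the cost bound is squared.
    0≤expCost : ∀ k p → 0ℚ ≤ R.expCost k p
    0≤expCost zero    p = ℚ.≤-refl
    0≤expCost (suc k) (ret (inj₁ l)) = subst (0ℚ ≤_) (sym (half-double _)) (0≤expCost k (body l))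
    0≤expCost (suc k) (ret (inj₂ o)) = ℚ.≤-refl
    0≤expCost (suc k) (randVert f) = subst (0ℚ ≤_) (trans (cong (1ℚ ⊕_) (sym (avgVert≡E _))) (⊕≡+ 1ℚ _))
      (0≤⊕ 0≤1 (0≤E (vertex G) (λ v → 0≤expCost k (f v))))
    0≤expCost (suc k) (randNbr x f) = subst (0ℚ ≤_) (trans (cong (1ℚ ⊕_) (sym (avgNbr≡E x _))) (⊕≡+ 1ℚ _))
      (0≤⊕ 0≤1 (0≤E (neighbour G x) (λ v → 0≤expCost k (f v))))
    0≤expCost (suc k) (degree x f) = subst (0ℚ ≤_) (⊕≡+ 1ℚ _) (0≤⊕ 0≤1 (0≤expCost k (f (deg G x))))
    0≤expCost (suc k) (pair x y f) = subst (0ℚ ≤_) (⊕≡+ 1ℚ _) (0≤⊕ 0≤1 (0≤expCost k (f (adj x y))))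
    0≤expCost (suc k) (additive S f) = subst (0ℚ ≤_) (trans (⊕≡+ _ _) (cong (ℚ._+ R.expCost k (f (edgesIn G S))) (sym (fromℕ≡ι (length S)))))
      (0≤⊕ (0≤ι (length S)) (0≤expCost k (f (edgesIn G S))))

    module Success
      (ok : Output → Bool) (F : L → ℚ) (0≤F : ∀ l → 0ℚ ≤ F l)
      (F-step : ∀ l → E ⟦ body l ⟧ (onLoop F (failure ok)) ≤ F l)
      where

      F̂ : L ⊎ Output → ℚ
      F̂ = onLoop F (failure ok)

      0≤F̂ : ∀ a → 0ℚ ≤ F̂ a
      0≤F̂ (inj₁ l) = 0≤F l
      0≤F̂ (inj₂ o) with ok o
      ... | true  = ℚ.≤-refl
      ... | false = 0≤1

      module _ (K : ℕ) (0<K : 0 ℕ.< K) where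

        -- A bound on the probability of not having succeeded after K steps, `j` of which have been
        -- made: the failure potential, plus Markov's bound for an expected total of
        -- `potential p + j` steps to exceed K.
        deficit : ℕ → Prog (Fin n) (L ⊎ Output) κ → ℚ
        deficit j p = E ⟦ p ⟧ F̂ ⊕ inv K ⊗ (potential p ⊕ ι j)

        deficit-E : ∀ {A : Set} (μ : Mean A) j (f : A → Prog (Fin n) (L ⊎ Output) κ) →
          E μ (λ a → deficit (suc j) (f a)) ≡
          E μ (λ a → E ⟦ f a ⟧ F̂) ⊕ inv K ⊗ ((1ℚ ⊕ E μ (λ a → cost (f a))) ⊕ E μ (λ a → E ⟦ f a ⟧ Φ̂) ⊕ ι j)
        deficit-E μ j f = trans (add μ _ _) (cong (E μ (λ a → E ⟦ f a ⟧ F̂) ⊕_) (trans (scale μ (inv K) _) (cong (inv K ⊗_)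
          (trans (E-cong μ (λ a → trans (cong (potential (f a) ⊕_) (ι-suc j)) (⊕-comm (potential (f a)) _)))
          (trans (shift μ (1ℚ ⊕ ι j) _) (trans (cong (1ℚ ⊕ ι j ⊕_) (add μ _ _))
          (solve 4 (λ o j a b → o :+ j :+ (a :+ b) := o :+ a :+ b :+ j) refl 1ℚ (ι j) _ _)))))))

        deficit-mono : ∀ {p q} j → E ⟦ p ⟧ F̂ ≤ E ⟦ q ⟧ F̂ → 1ℚ ⊕ potential p ≤ potential q → deficit (suc j) p ≤ deficit j q
        deficit-mono {p} {q} j F≤ Φ≤ = ⊕-mono-≤ F≤ (⊗-monoʳ-≤ (0≤inv K) (subst (_≤ potential q ⊕ ι j)
          (sym (trans (cong (potential p ⊕_) (ι-suc j)) (solve 3 (λ o a j → a :+ (o :+ j) := o :+ a :+ j) refl 1ℚ (potential p) (ι j))))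
          (⊕-mono-≤ Φ≤ ℚ.≤-refl)))

        -- Induction on the steps left. With none left, j = K and the Markov term alone is at least
        -- 1; otherwise the unit lost by the potential makes up for the increment of `j`.
        1≤probOut : ∀ k j p → k ℕ.+ j ≡ K → 1ℚ ≤ R.probOut ok k p ⊕ deficit j p
        1≤probOut zero j p refl = ℚ.≤-trans (≤-cert (E ⟦ p ⟧ F̂ ⊕ inv K ⊗ potential p)
            (0≤⊕ (0≤E ⟦ p ⟧ 0≤F̂) (0≤⊗ (0≤inv K) (0≤potential p)))
            (trans (solve 4 (λ f i p j → f :+ i :* (p :+ j) := i :* j :+ (f :+ i :* p)) refl (E ⟦ p ⟧ F̂) (inv K) (potential p) (ι j))
              (cong (_⊕ (E ⟦ p ⟧ F̂ ⊕ inv K ⊗ potential p)) (inv⊗ 0<K))))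
          (ℚ.≤-reflexive (sym (⊕-identityˡ _)))
        1≤probOut (suc k) j p eq = go p
          where
          next : ∀ p → 1ℚ ≤ R.probOut ok k p ⊕ deficit (suc j) p
          next p = 1≤probOut k (suc j) p (trans (ℕ.+-suc k j) eq)
          weaken : ∀ {p} q → E ⟦ p ⟧ F̂ ≤ E ⟦ q ⟧ F̂ → 1ℚ ⊕ potential p ≤ potential q → 1ℚ ≤ R.probOut ok k p ⊕ deficit j q
          weaken {p} q F≤ Φ≤ = ℚ.≤-trans (next p) (⊕-mono-≤ ℚ.≤-refl (deficit-mono {p} {q} j F≤ Φ≤))
          averaged : ∀ {A : Set} (μ : Mean A) (f : A → Prog (Fin n) (L ⊎ Output) κ) →
            1ℚ ≤ E μ (λ a → R.probOut ok k (f a)) ⊕ E μ (λ a → deficit (suc j) (f a))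
          averaged μ f = subst₂ _≤_ (const μ 1ℚ) (add μ _ _) (mono μ (λ a → next (f a)))
          go : ∀ p → 1ℚ ≤ R.probOut ok (suc k) p ⊕ deficit j p
          go (ret (inj₁ l)) = subst (λ z → 1ℚ ≤ z ⊕ deficit j (ret (inj₁ l))) (sym (half-double _))
            (weaken {body l} (ret (inj₁ l)) (F-step l) (potential-ret l))
          go (ret (inj₂ o)) with ok o
          ... | true  = ≤-cert _ (0≤⊕ (ℚ.≤-refl {0ℚ}) rest) refl
            where rest = 0≤⊗ (0≤inv K) (0≤⊕ (0≤⊕ (ℚ.≤-refl {0ℚ}) (ℚ.≤-refl {0ℚ})) (0≤ι j))
          ... | false = ≤-cert _ rest (⊕-identityˡ _)
            where rest = 0≤⊗ (0≤inv K) (0≤⊕ (0≤⊕ (ℚ.≤-refl {0ℚ}) (ℚ.≤-refl {0ℚ})) (0≤ι j))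
          go (randVert f) = subst₂ (λ x y → 1ℚ ≤ x ⊕ y) (sym (avgVert≡E _)) (deficit-E (vertex G) j f) (averaged (vertex G) f)
          go (randNbr x f) = subst₂ (λ x y → 1ℚ ≤ x ⊕ y) (sym (avgNbr≡E x _)) (deficit-E (neighbour G x) j f) (averaged (neighbour G x) f)
          go (degree x f) = weaken {f (deg G x)} (degree x f) ℚ.≤-refl (ℚ.≤-reflexive (sym (⊕-assoc 1ℚ _ _)))
          go (pair x y f) = weaken {f (adj x y)} (pair x y f) ℚ.≤-refl (ℚ.≤-reflexive (sym (⊕-assoc 1ℚ _ _)))
          go (additive S f) = weaken {f (edgesIn G S)} (additive S f) ℚ.≤-refl (ℚ.≤-trans
            (⊕-mono-≤ (ι-mono (ℕ.s≤s (ℕ.z≤n {length S}))) ℚ.≤-refl) (ℚ.≤-reflexive (sym (⊕-assoc _ _ _))))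
      -- Taking K above 12 Φ(l₀) keeps the Markov term below 1/12, and 1 - 1/4 - 1/12 = 2/3.
      succeeds : ι 4 ⊗ F l₀ ≤ 1ℚ → ∃ λ k → (+ 2) ℚ./ 3 ≤ R.probOut ok k (ret (inj₁ l₀))
      succeeds F≤¼ = K , ≤-by-inverse (ι 12) (0≤inv 12) (inv-inverse 11) (subst (_≤ ι 12 ⊗ P) (sym twelve⊗⅔)
        (≤-cert w 0≤w (solve 4 (λ p f i φ → con (+ 12) :* p :=
            con (+ 8) :+ (con (+ 12) :* (p :+ (f :+ i :* (con (+ 0) :+ φ :+ con (+ 0))) :- con (+ 1))
                          :+ con (+ 3) :* (con (+ 1) :- con (+ 4) :* f)
                          :+ (con (+ 1) :- con (+ 12) :* (i :* φ)))) refl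
            P (F l₀) (inv K) (Φ l₀))))
        where
        N = proj₁ (archimedean (Φ l₀))
        K = suc (12 ℕ.* N)
        P = R.probOut ok K (ret (inj₁ l₀))
        w = ι 12 ⊗ (P ⊕ deficit K (ℕ.s≤s ℕ.z≤n) 0 (ret (inj₁ l₀)) ⊝ 1ℚ) ⊕ ι 3 ⊗ (1ℚ ⊝ ι 4 ⊗ F l₀) ⊕ (1ℚ ⊝ ι 12 ⊗ (inv K ⊗ Φ l₀))
        twelve-Φ : ι 12 ⊗ (inv K ⊗ Φ l₀) ≤ 1ℚ
        twelve-Φ = ℚ.≤-trans (≤-cert (inv K ⊗ (ι 12 ⊗ (ι N ⊝ Φ l₀) ⊕ 1ℚ))
          (0≤⊗ (0≤inv K) (0≤⊕ (0≤⊗ (0≤ι 12) (gap (proj₂ (archimedean (Φ l₀))))) 0≤1))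
          (solve 3 (λ i φ n → i :* (con (+ 1) :+ con (+ 12) :* n) := con (+ 12) :* (i :* φ) :+ i :* (con (+ 12) :* (n :- φ) :+ con (+ 1))) refl
            (inv K) (Φ l₀) (ι N)))
          (ℚ.≤-reflexive (trans (cong (inv K ⊗_) (sym (trans (ι-suc (12 ℕ.* N)) (cong (1ℚ ⊕_) (ι-* 12 N))))) (inv-inverse (12 ℕ.* N))))
        0≤w : 0ℚ ≤ w
        0≤w = 0≤⊕ (0≤⊕ (0≤⊗ (0≤ι 12) (gap (1≤probOut K (ℕ.s≤s ℕ.z≤n) K 0 (ret (inj₁ l₀)) (ℕ.+-identityʳ K))))
                        (0≤⊗ (0≤ι 3) (gap F≤¼))) (gap twelve-Φ)

-- Waiting for a fixed number of successes

-- For ε = a/b in lowest terms this is 1 + ⌊b²/a²⌋; the absolute value and the case of numerator 0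
-- only make it total.
inverseSquare : ℚ → ℕ
inverseSquare ε = rounded ℤ.∣ ℚ.↥ ε ∣
  where
  rounded : ℕ → ℕ
  rounded zero    = 1
  rounded (suc a) = suc ((ℚ.↧ₙ ε ℕ.* ℚ.↧ₙ ε) ℕ./ (suc a ℕ.* suc a))

0<inverseSquare : ∀ ε → 0 ℕ.< inverseSquare ε
0<inverseSquare ε with ℤ.∣ ℚ.↥ ε ∣
... | zero  = ℕ.s≤s ℕ.z≤n
... | suc a = ℕ.s≤s ℕ.z≤n

opaque
  unfolding _⊕_

  numerator≡ : ∀ p → p ⊗ ι (ℚ.↧ₙ p) ≡ fromℤ (ℚ.↥ p)
  numerator≡ p@record{} = ℚ.toℚᵘ-injective (ℚᵘ.≃-trans (ℚ.toℚᵘ-homo-* p (ι (ℚ.↧ₙ p)))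
    (ℚᵘ.*≡* (trans (ℤ.*-identityʳ _) (cong (λ d → ℚ.↥ p ℤ.* (+ d)) (sym (ℕ.*-identityʳ (ℚ.↧ₙ p)))))))

module _ {ε : ℚ} (0<ε : 0ℚ < ε) (ε<1 : ε < 1ℚ) where

  private
    positive-numerator : ∀ p → 0ℚ < p → ∃ λ a → ℚ.↥ p ≡ + suc a
    positive-numerator (ℚ.mkℚ (+ suc a) d _) 0<p = a , refl
    positive-numerator (ℚ.mkℚ (+ zero) d _) (ℚ.*<* (ℤ.+<+ ()))
    positive-numerator (ℚ.mkℚ -[1+ a ] d _) (ℚ.*<* ())

    a b : ℕ
    a = suc (proj₁ (positive-numerator ε 0<ε))
    b = ℚ.↧ₙ ε

    numerator : ℚ.↥ ε ≡ + a
    numerator = proj₂ (positive-numerator ε 0<ε)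

    εb≡a : ε ⊗ ι b ≡ ι a
    εb≡a = trans (numerator≡ ε) (cong fromℤ numerator)

    q≡ : inverseSquare ε ≡ suc ((b ℕ.* b) ℕ./ (a ℕ.* a))
    q≡ rewrite numerator = refl

    a≤b : a ℕ.≤ b
    a≤b = ι-cancel (subst₂ _≤_ εb≡a (⊗-identityˡ (ι b)) (⊗-monoˡ-≤ (0≤ι b) (ℚ.<⇒≤ ε<1)))

    b²≤qa² : b ℕ.* b ℕ.≤ inverseSquare ε ℕ.* (a ℕ.* a)
    b²≤qa² rewrite q≡ = ℕ.≤-trans (ℕ.≤-reflexive (ℕ.m≡m%n+[m/n]*n (b ℕ.* b) (a ℕ.* a)))
      (ℕ.+-monoˡ-≤ _ (ℕ.<⇒≤ (ℕ.m%n<n (b ℕ.* b) (a ℕ.* a))))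

    -- Here ε < 1 enters: the rounding up adds a², which is at most b².
    qa²≤2b² : inverseSquare ε ℕ.* (a ℕ.* a) ℕ.≤ 2 ℕ.* (b ℕ.* b)
    qa²≤2b² rewrite q≡ = ℕ.+-mono-≤ (ℕ.*-mono-≤ a≤b a≤b) (ℕ.≤-trans (ℕ.m/n*n≤m (b ℕ.* b) (a ℕ.* a)) (ℕ.m≤m+n _ 0))

    b²⊗qε² : ι (b ℕ.* b) ⊗ (ι (inverseSquare ε) ⊗ (ε ⊗ ε)) ≡ ι (inverseSquare ε ℕ.* (a ℕ.* a))
    b²⊗qε² = begin
      ι (b ℕ.* b) ⊗ (ι q ⊗ (ε ⊗ ε)) ≡⟨ cong (_⊗ (ι q ⊗ (ε ⊗ ε))) (ι-* b b) ⟩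
      ι b ⊗ ι b ⊗ (ι q ⊗ (ε ⊗ ε))   ≡⟨ solve 3 (λ b q e → b :* b :* (q :* (e :* e)) := q :* ((e :* b) :* (e :* b))) refl (ι b) (ι q) ε ⟩
      ι q ⊗ ((ε ⊗ ι b) ⊗ (ε ⊗ ι b)) ≡⟨ cong (λ z → ι q ⊗ (z ⊗ z)) εb≡a ⟩
      ι q ⊗ (ι a ⊗ ι a)             ≡⟨ cong (ι q ⊗_) (ι-* a a) ⟨
      ι q ⊗ ι (a ℕ.* a)             ≡⟨ ι-* q (a ℕ.* a) ⟨
      ι (q ℕ.* (a ℕ.* a))           ∎
      where
      open ≡-Reasoning
      q = inverseSquare ε

    0<b² : 0 ℕ.< b ℕ.* b
    0<b² = ℕ.s≤s ℕ.z≤n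

  1≤qε² : 1ℚ ≤ ι (inverseSquare ε) ⊗ (ε ⊗ ε)
  1≤qε² = ≤-by-inverse (ι (b ℕ.* b)) (0≤inv (b ℕ.* b)) (inv⊗ 0<b²)
    (subst₂ _≤_ (sym (⊗-identityʳ _)) (sym b²⊗qε²) (ι-mono b²≤qa²))

  qε²≤2 : ι (inverseSquare ε) ⊗ (ε ⊗ ε) ≤ ι 2
  qε²≤2 = ≤-by-inverse (ι (b ℕ.* b)) (0≤inv (b ℕ.* b)) (inv⊗ 0<b²)
    (subst₂ _≤_ (sym b²⊗qε²) (trans (ι-* 2 (b ℕ.* b)) (⊗-comm _ _)) (ι-mono qa²≤2b²))

≰ᵇ⇒≥ : ∀ p q → (p ℚ.≤ᵇ q) ≡ false → q ≤ p
≰ᵇ⇒≥ p q eq with ℚ.≤-total p q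
... | inj₁ p≤q = ⊥-elim (subst T eq (ℚ.≤⇒≤ᵇ p≤q))
... | inj₂ q≤p = q≤p

-- The form in which Chebyshev's inequality is used: `z` will be a scaled squared deviation, which
-- is at least 1 whenever the estimate misses on either side.
failure-≤ : ∀ ε Q x {z} → 0ℚ ≤ z → (x ≤ (1ℚ ⊝ ε) ⊗ Q → 1ℚ ≤ z) → ((1ℚ ⊕ ε) ⊗ Q ≤ x → 1ℚ ≤ z) →
            (if approxᵇ ε Q x then 0ℚ else 1ℚ) ≤ z
failure-≤ ε Q x {z} 0≤z below above
  with (1ℚ ℚ.- ε) * Q ℚ.≤ᵇ x in lo | x ℚ.≤ᵇ (1ℚ ℚ.+ ε) * Q in hi
... | true  | true  = 0≤z
... | false | _     = below (subst (x ≤_) (trans (sym (⊗≡* _ Q)) (cong (_⊗ Q) (sym (⊝≡- 1ℚ ε)))) (≰ᵇ⇒≥ _ _ lo))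
... | true  | false = above (subst (_≤ x) (trans (sym (⊗≡* _ Q)) (cong (_⊗ Q) (sym (⊕≡+ 1ℚ ε)))) (≰ᵇ⇒≥ _ _ hi))

-- In the state (N , r), N trials have been made and r successes are still awaited.
attempt : ∀ {V L : Set} {κ} → Prog V Bool κ → (ℕ → ℕ → L) → ℕ → ℕ → Prog V (L ⊎ Output) κ
attempt trial state N r = trial >>= λ b → ret (inj₁ (state (suc N) (if b then r else suc r)))

-- With T = 12q awaited successes the Chebyshev bound q/T² · T is 1/12.
hits : ℚ → ℕ
hits ε = 12 ℕ.* inverseSquare ε

-- ε² hits(ε)² varianceScale(ε) ≥ 1, so this is the factor in Chebyshev's inequality for a deviation of ε hits(ε).
varianceScale : ℚ → ℚ
varianceScale ε = ι (inverseSquare ε) ⊗ (inv (hits ε) ⊗ inv (hits ε))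

deviation : ℚ → ℚ → ℕ → ℕ → ℚ
deviation ε p N r = ι (hits ε) ⊝ ι r ⊝ p ⊗ ι N

-- Up to the scale, this bounds the expected final squared deviation given the present state: `r`
-- more successes take r/p trials on average, each of variance p(1 - p), which adds at most `r` to
-- the square of the present deviation.
awaitFailure : ℚ → ℚ → ℕ → ℕ → ℚ
awaitFailure ε p N r = varianceScale ε ⊗ (deviation ε p N r ⊗ deviation ε p N r ⊕ ι r)

-- `b` covers what follows the last success. Each awaited success takes `p⁻¹` trials on average,
-- each of cost at most `c` plus the unit of the loop.
awaitCost : ℚ → ℚ → ℚ → ℕ → ℚ
awaitCost b c p⁻¹ r = b ⊕ ι r ⊗ ((1ℚ ⊕ c) ⊗ p⁻¹)

-- N/T estimates 1/p, so this estimates s/p: it is n/d for random pairs with s = 1, and n for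
-- neighbours of y with s = deg y.
estimate : ℚ → ℚ → ℕ → ℚ
estimate ε s N = s ⊗ ι N ⊗ inv (hits ε)

0≤varianceScale : ∀ ε → 0ℚ ≤ varianceScale ε
0≤varianceScale ε = 0≤⊗ (0≤ι (inverseSquare ε)) (0≤⊗ (0≤inv (hits ε)) (0≤inv (hits ε)))

0≤awaitFailure : ∀ ε p N r → 0ℚ ≤ awaitFailure ε p N r
0≤awaitFailure ε p N r = 0≤⊗ (0≤varianceScale ε) (0≤⊕ (0≤sq (deviation ε p N r)) (0≤ι r))

0≤awaitCost : ∀ {b} c p⁻¹ r → 0ℚ ≤ b → 0ℚ ≤ c → 0ℚ ≤ p⁻¹ → 0ℚ ≤ awaitCost b c p⁻¹ r
0≤awaitCost c p⁻¹ r 0≤b 0≤c 0≤p⁻¹ = 0≤⊕ 0≤b (0≤⊗ (0≤ι r) (0≤⊗ (0≤⊕ 0≤1 0≤c) 0≤p⁻¹))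

0<hits : ∀ ε → 0 ℕ.< hits ε
0<hits ε = ℕ.≤-trans (0<inverseSquare ε) (ℕ.m≤n*m _ 12)

awaitFailure-start : ∀ ε p → ι 12 ⊗ awaitFailure ε p 0 (hits ε) ≡ 1ℚ
awaitFailure-start ε p = begin
  ι 12 ⊗ awaitFailure ε p 0 (hits ε)
    ≡⟨ solve 4 (λ q i t p → con (+ 12) :* (q :* (i :* i) :* ((t :- t :- p :* con (+ 0)) :* (t :- t :- p :* con (+ 0)) :+ t))
                          := (i :* (con (+ 12) :* q)) :* (i :* t)) refl (ι q) (inv (hits ε)) (ι (hits ε)) p ⟩
  (inv (hits ε) ⊗ (ι 12 ⊗ ι q)) ⊗ (inv (hits ε) ⊗ ι (hits ε))
    ≡⟨ cong₂ _⊗_ (trans (cong (inv (hits ε) ⊗_) (sym (ι-* 12 q))) (inv⊗ (0<hits ε))) (inv⊗ (0<hits ε)) ⟩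
  1ℚ ⊗ 1ℚ
    ≡⟨ ⊗-identityˡ 1ℚ ⟩
  1ℚ ∎
  where
  open ≡-Reasoning
  q = inverseSquare ε

module _ {ε : ℚ} (0<ε : 0ℚ < ε) (ε<1 : ε < 1ℚ) where

  private
    t i q : ℚ
    t = ι (hits ε)
    i = inv (hits ε)
    q = ι (inverseSquare ε)

    it≡1 : i ⊗ t ≡ 1ℚ
    it≡1 = inv⊗ (0<hits ε)

    0≤ε : 0ℚ ≤ ε
    0≤ε = ℚ.<⇒≤ 0<ε

    0≤εt : 0ℚ ≤ ε ⊗ t
    0≤εt = 0≤⊗ 0≤ε (0≤ι (hits ε))

  1≤scaled-square : ∀ d → (ε ⊗ t) ⊗ (ε ⊗ t) ≤ d ⊗ d → 1ℚ ≤ varianceScale ε ⊗ (d ⊗ d)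
  1≤scaled-square d le = ℚ.≤-trans (1≤qε² 0<ε ε<1) (ℚ.≤-trans (ℚ.≤-reflexive eq) (⊗-monoʳ-≤ (0≤varianceScale ε) le))
    where
    eq : q ⊗ (ε ⊗ ε) ≡ varianceScale ε ⊗ ((ε ⊗ t) ⊗ (ε ⊗ t))
    eq = trans (sym (trans (cong₂ _⊗_ it≡1 it≡1) (⊗-identityˡ 1ℚ) |> λ e → trans (cong (_⊗ (q ⊗ (ε ⊗ ε))) e) (⊗-identityˡ _)))
      (solve 4 (λ i t q e → (i :* t) :* (i :* t) :* (q :* (e :* e)) := q :* (i :* i) :* ((e :* t) :* (e :* t))) refl i t q ε)
      where open import Function using (_|>_)

  sq-mono : ∀ {x d} → 0ℚ ≤ x → x ≤ d → x ⊗ x ≤ d ⊗ d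
  sq-mono 0≤x x≤d = ⊗-mono-≤ 0≤x (ℚ.≤-trans 0≤x x≤d) x≤d x≤d

  sq-mono⁻ : ∀ {x d} → 0ℚ ≤ x → d ≤ ⊖ x → x ⊗ x ≤ d ⊗ d
  sq-mono⁻ {x} {d} 0≤x d≤-x = subst (x ⊗ x ≤_) (solve 1 (λ d → (:- d) :* (:- d) := d :* d) refl d)
    (sq-mono 0≤x (≤-cert ((⊖ x) ⊝ d) (gap d≤-x) (solve 2 (λ d x → :- d := x :+ (:- x :- d)) refl d x)))

  -- As s = Qp, the estimate is Q · pN/T. A relative error of ε therefore means that pN differs from
  -- T by at least εT.
  await-done : ∀ {p s Q Q⁻¹ N} → 0ℚ ≤ Q⁻¹ → Q⁻¹ ⊗ Q ≡ 1ℚ → Q ⊗ p ≡ s →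
    (if approxᵇ ε Q (estimate ε s N) then 0ℚ else 1ℚ) ≤ awaitFailure ε p N 0
  await-done {p} {s} {Q} {Q⁻¹} {N} 0≤Q⁻¹ Q⁻¹Q Qp≡s = failure-≤ ε Q (estimate ε s N) (0≤awaitFailure ε p N 0) below above
    where
    d = deviation ε p N 0
    failure≡ : varianceScale ε ⊗ (d ⊗ d) ≡ awaitFailure ε p N 0
    failure≡ = cong (varianceScale ε ⊗_) (sym (⊕-identityʳ (d ⊗ d)))
    ti≡1 : t ⊗ i ≡ 1ℚ
    ti≡1 = trans (⊗-comm t i) it≡1
    estimate≡ : estimate ε s N ≡ Q ⊗ (i ⊗ (p ⊗ ι N))
    estimate≡ = trans (cong (λ s → s ⊗ ι N ⊗ i) (sym Qp≡s))
      (solve 4 (λ Q p N i → Q :* p :* N :* i := Q :* (i :* (p :* N))) refl Q p (ι N) i)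
    below : estimate ε s N ≤ (1ℚ ⊝ ε) ⊗ Q → 1ℚ ≤ awaitFailure ε p N 0
    below le = subst (1ℚ ≤_) failure≡ (1≤scaled-square d (sq-mono 0≤εt
      (≤-cert ((1ℚ ⊝ ε) ⊗ t ⊝ p ⊗ ι N) (gap pN≤) (solve 4 (λ t p N e → t :- con (+ 0) :- p :* N := e :* t :+ ((con (+ 1) :- e) :* t :- p :* N)) refl t p (ι N) ε))))
      where
      pN≤ : p ⊗ ι N ≤ (1ℚ ⊝ ε) ⊗ t
      pN≤ = ≤-by-inverse i (0≤ι (hits ε)) ti≡1 (≤-by-inverse Q 0≤Q⁻¹ Q⁻¹Q (subst₂ _≤_ estimate≡
        (sym (trans (solve 4 (λ Q i t e → Q :* (i :* (e :* t)) := i :* t :* (e :* Q)) refl Q i t (1ℚ ⊝ ε)) (trans (cong (_⊗ ((1ℚ ⊝ ε) ⊗ Q)) it≡1) (⊗-identityˡ _)))) le))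
    above : (1ℚ ⊕ ε) ⊗ Q ≤ estimate ε s N → 1ℚ ≤ awaitFailure ε p N 0
    above le = subst (1ℚ ≤_) failure≡ (1≤scaled-square d (sq-mono⁻ 0≤εt
      (≤-cert (p ⊗ ι N ⊝ (1ℚ ⊕ ε) ⊗ t) (gap ≤pN) (solve 4 (λ t p N e → :- (e :* t) := t :- con (+ 0) :- p :* N :+ (p :* N :- (con (+ 1) :+ e) :* t)) refl t p (ι N) ε))))
      where
      ≤pN : (1ℚ ⊕ ε) ⊗ t ≤ p ⊗ ι N
      ≤pN = ≤-by-inverse i (0≤ι (hits ε)) ti≡1 (≤-by-inverse Q 0≤Q⁻¹ Q⁻¹Q (subst₂ _≤_
        (sym (trans (solve 4 (λ Q i t e → Q :* (i :* (e :* t)) := i :* t :* (e :* Q)) refl Q i t (1ℚ ⊕ ε)) (trans (cong (_⊗ ((1ℚ ⊕ ε) ⊗ Q)) it≡1) (⊗-identityˡ _)))) estimate≡ le))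

module _ (G : Graph) where
  open Graph G using (n)

  Bernoulli : ∀ {κ} → Prog (Fin n) Bool κ → ℚ → Set
  Bernoulli trial p = ∀ (f : Bool → ℚ) → E (⟦_⟧ G trial) f ≡ p ⊗ f true ⊕ (1ℚ ⊝ p) ⊗ f false

  module _ {L : Set} {κ : Oracle} {trial : Prog (Fin n) Bool κ} {p : ℚ} (bernoulli : Bernoulli trial p)
           (state : ℕ → ℕ → L) where

    private
      next : ℕ → ℕ → Bool → Prog (Fin n) (L ⊎ Output) κ
      next N r b = ret (inj₁ (state (suc N) (if b then r else suc r)))

    -- One trial adds p - p² to the mean squared deviation and lowers `r` by p on average, so the
    -- expectation drops by exactly the scaled p².
    await-failure-step : ∀ ε F g → (∀ N r → F (state N r) ≡ awaitFailure ε p N r) → ∀ N r →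
      E (⟦_⟧ G (attempt trial state N r)) (onLoop G F g) ≤ F (state N (suc r))
    await-failure-step ε F g F≡ N r = ≤-cert (varianceScale ε ⊗ (p ⊗ p)) (0≤⊗ (0≤varianceScale ε) (0≤sq p)) (begin
      F (state N (suc r))
        ≡⟨ F≡ N (suc r) ⟩
      awaitFailure ε p N (suc r)
        ≡⟨ cong (λ r → varianceScale ε ⊗ ((t ⊝ r ⊝ p ⊗ ι N) ⊗ (t ⊝ r ⊝ p ⊗ ι N) ⊕ r)) (ι-suc r) ⟩
      varianceScale ε ⊗ ((t ⊝ (1ℚ ⊕ ι r) ⊝ p ⊗ ι N) ⊗ (t ⊝ (1ℚ ⊕ ι r) ⊝ p ⊗ ι N) ⊕ (1ℚ ⊕ ι r))
        ≡⟨ solve 5 (λ w t r p N →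
             w :* ((t :- (con (+ 1) :+ r) :- p :* N) :* (t :- (con (+ 1) :+ r) :- p :* N) :+ (con (+ 1) :+ r))
             := p :* (w :* ((t :- r :- p :* (con (+ 1) :+ N)) :* (t :- r :- p :* (con (+ 1) :+ N)) :+ r))
                :+ (con (+ 1) :- p) :* (w :* ((t :- (con (+ 1) :+ r) :- p :* (con (+ 1) :+ N)) :* (t :- (con (+ 1) :+ r) :- p :* (con (+ 1) :+ N)) :+ (con (+ 1) :+ r)))
                :+ w :* (p :* p)) refl (varianceScale ε) t (ι r) p (ι N) ⟩
      p ⊗ (varianceScale ε ⊗ ((t ⊝ ι r ⊝ p ⊗ (1ℚ ⊕ ι N)) ⊗ (t ⊝ ι r ⊝ p ⊗ (1ℚ ⊕ ι N)) ⊕ ι r))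
        ⊕ (1ℚ ⊝ p) ⊗ (varianceScale ε ⊗ ((t ⊝ (1ℚ ⊕ ι r) ⊝ p ⊗ (1ℚ ⊕ ι N)) ⊗ (t ⊝ (1ℚ ⊕ ι r) ⊝ p ⊗ (1ℚ ⊕ ι N)) ⊕ (1ℚ ⊕ ι r)))
        ⊕ varianceScale ε ⊗ (p ⊗ p)
        ≡⟨ cong (_⊕ varianceScale ε ⊗ (p ⊗ p)) (trans (trans (E->>= G trial (next N r) (onLoop G F g)) (bernoulli _))
             (cong₂ (λ x y → p ⊗ x ⊕ (1ℚ ⊝ p) ⊗ y) (after r refl) (after (suc r) (ι-suc r)))) ⟨
      E (⟦_⟧ G (attempt trial state N r)) (onLoop G F g) ⊕ varianceScale ε ⊗ (p ⊗ p) ∎)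
      where
      open ≡-Reasoning
      t = ι (hits ε)
      after : ∀ r {x} → ι r ≡ x → F (state (suc N) r) ≡ varianceScale ε ⊗ ((t ⊝ x ⊝ p ⊗ (1ℚ ⊕ ι N)) ⊗ (t ⊝ x ⊝ p ⊗ (1ℚ ⊕ ι N)) ⊕ x)
      after r refl = trans (F≡ (suc N) r) (cong (λ N → varianceScale ε ⊗ ((t ⊝ ι r ⊝ p ⊗ N) ⊗ (t ⊝ ι r ⊝ p ⊗ N) ⊕ ι r)) (ι-suc N))

    await-cost-step : ∀ b c p⁻¹ Φ → p⁻¹ ⊗ p ≡ 1ℚ → cost G trial ≤ c → (∀ N r → Φ (state N r) ≡ awaitCost b c p⁻¹ r) → ∀ N r →
      1ℚ ⊕ (cost G (attempt trial state N r) ⊕ E (⟦_⟧ G (attempt trial state N r)) (onLoop G Φ (λ _ → 0ℚ)))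
        ≤ Φ (state N (suc r))
    await-cost-step b c p⁻¹ Φ p⁻¹p cost≤c Φ≡ N r = ≤-cert (c ⊝ cost G trial) (gap cost≤c) (begin
      Φ (state N (suc r))
        ≡⟨ trans (Φ≡ N (suc r)) (cong (λ r → b ⊕ r ⊗ ((1ℚ ⊕ c) ⊗ p⁻¹)) (ι-suc r)) ⟩
      b ⊕ (1ℚ ⊕ ι r) ⊗ ((1ℚ ⊕ c) ⊗ p⁻¹)
        ≡⟨ solve 6 (λ b r c i p k → b :+ (con (+ 1) :+ r) :* ((con (+ 1) :+ c) :* i) :=
             con (+ 1) :+ (k :+ con (+ 0) :+ (p :* (b :+ r :* ((con (+ 1) :+ c) :* i)) :+ (con (+ 1) :- p) :* (b :+ (con (+ 1) :+ r) :* ((con (+ 1) :+ c) :* i))))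
             :+ (c :- k) :+ (con (+ 1) :+ c) :* (i :* p :- con (+ 1))) refl b (ι r) c p⁻¹ p (cost G trial) ⟩
      rhs ⊕ (c ⊝ cost G trial) ⊕ (1ℚ ⊕ c) ⊗ (p⁻¹ ⊗ p ⊝ 1ℚ)
        ≡⟨ trans (cong (λ z → rhs ⊕ (c ⊝ cost G trial) ⊕ (1ℚ ⊕ c) ⊗ (z ⊝ 1ℚ)) p⁻¹p)
             (solve 2 (λ x c → x :+ (con (+ 1) :+ c) :* (con (+ 1) :- con (+ 1)) := x) refl (rhs ⊕ (c ⊝ cost G trial)) c) ⟩
      rhs ⊕ (c ⊝ cost G trial)
        ≡⟨ cong (_⊕ (c ⊝ cost G trial)) (cong (1ℚ ⊕_) (cong₂ _⊕_
             (trans (cost->>= G trial (next N r)) (cong (cost G trial ⊕_) (const (⟦_⟧ G trial) 0ℚ)))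
             (trans (trans (E->>= G trial (next N r) (onLoop G Φ (λ _ → 0ℚ))) (bernoulli _))
               (cong₂ (λ x y → p ⊗ x ⊕ (1ℚ ⊝ p) ⊗ y) (Φ≡ (suc N) r)
                 (trans (Φ≡ (suc N) (suc r)) (cong (λ r → b ⊕ r ⊗ ((1ℚ ⊕ c) ⊗ p⁻¹)) (ι-suc r))))))) ⟨
      1ℚ ⊕ (cost G (attempt trial state N r) ⊕ E (⟦_⟧ G (attempt trial state N r)) (onLoop G Φ (λ _ → 0ℚ))) ⊕ (c ⊝ cost G trial) ∎)
      where
      open ≡-Reasoning
      rhs = 1ℚ ⊕ (cost G trial ⊕ 0ℚ ⊕ (p ⊗ (b ⊕ ι r ⊗ ((1ℚ ⊕ c) ⊗ p⁻¹)) ⊕ (1ℚ ⊝ p) ⊗ (b ⊕ (1ℚ ⊕ ι r) ⊗ ((1ℚ ⊕ c) ⊗ p⁻¹))))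

-- The edge density by pair queries

pairTrial : ∀ {V} → Prog V Bool pairs
pairTrial = randVert (λ x → randVert (λ y → pair x y ret))

densityBody : ∀ {V} → ℚ → ℕ × ℕ → Prog V ((ℕ × ℕ) ⊎ Output) pairs
densityBody ε (N , zero)  = ret (inj₂ (inj₂ (estimate ε 1ℚ N)))
densityBody ε (N , suc r) = attempt pairTrial _,_ N r

pairAlgorithm : Algorithm
pairAlgorithm V _ ε = loop (densityBody ε) (0 , hits ε)

sumℕ-mono : ∀ k {f g : Fin k → ℕ} → (∀ i → f i ℕ.≤ g i) → sumℕFin k f ℕ.≤ sumℕFin k g
sumℕ-mono zero    f≤g = ℕ.z≤n
sumℕ-mono (suc k) f≤g = ℕ.+-mono-≤ (f≤g Fin.zero) (sumℕ-mono k (f≤g ∘ Fin.suc))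

sumℕ-const : ∀ k c → sumℕFin k (λ _ → c) ≡ k ℕ.* c
sumℕ-const zero    c = refl
sumℕ-const (suc k) c = cong (c ℕ.+_) (sumℕ-const k c)

module _ (G : Graph) where
  open Graph G using (n; adj; nonempty)

  indicator-Bernoulli : ∀ {A : Set} (μ : Mean A) (b : A → Bool) (f : Bool → ℚ) →
    E μ (λ a → f (b a)) ≡ E μ (λ a → 𝟙 (b a)) ⊗ f true ⊕ (1ℚ ⊝ E μ (λ a → 𝟙 (b a))) ⊗ f false
  indicator-Bernoulli μ b f = begin
    E μ (λ a → f (b a))
      ≡⟨ E-cong μ (λ a → interpolate (b a)) ⟩
    E μ (λ a → f false ⊕ (f true ⊝ f false) ⊗ 𝟙 (b a))
      ≡⟨ trans (shift μ (f false) _) (cong (f false ⊕_) (scale μ _ _)) ⟩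
    f false ⊕ (f true ⊝ f false) ⊗ E μ (λ a → 𝟙 (b a))
      ≡⟨ solve 3 (λ x y p → y :+ (x :- y) :* p := p :* x :+ (con (+ 1) :- p) :* y) refl (f true) (f false) _ ⟩
    E μ (λ a → 𝟙 (b a)) ⊗ f true ⊕ (1ℚ ⊝ E μ (λ a → 𝟙 (b a))) ⊗ f false ∎
    where
    open ≡-Reasoning
    interpolate : ∀ b → f b ≡ f false ⊕ (f true ⊝ f false) ⊗ 𝟙 b
    interpolate false = solve 2 (λ x y → y := y :+ (x :- y) :* con (+ 0)) refl (f true) (f false)
    interpolate true  = solve 2 (λ x y → x := y :+ (x :- y) :* con (+ 1)) refl (f true) (f false)

  -- `edgeProb` is 2m/n² = d/n, the probability that two independent random vertices are adjacent;
  -- `ρ` is its reciprocal n/d.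
  edgeProb ρ : ℚ
  edgeProb = inv n ⊗ (inv n ⊗ ι (twoM G))
  ρ = ι (n ℕ.* n) ⊗ inv (twoM G)

  nOverD≡ρ : nOverD G ≡ ρ
  nOverD≡ρ = trans (divℕ≡⊗inv _ (twoM G)) (cong (_⊗ inv (twoM G)) (fromℕ≡ι (n ℕ.* n)))

  deg≤n : ∀ x → deg G x ℕ.≤ n
  deg≤n x = ℕ.≤-trans (sumℕ-mono n (λ y → if≤1 (adj x y))) (ℕ.≤-reflexive (trans (sumℕ-const n 1) (ℕ.*-identityʳ n)))
    where
    if≤1 : ∀ b → (if b then 1 else 0) ℕ.≤ 1
    if≤1 false = ℕ.z≤n
    if≤1 true  = ℕ.≤-refl

  n≤twoM : n ℕ.≤ twoM G
  n≤twoM = ℕ.≤-trans (ℕ.≤-reflexive (sym (trans (sumℕ-const n 1) (ℕ.*-identityʳ n)))) (sumℕ-mono n (deg-pos G))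

  twoM≤n² : twoM G ℕ.≤ n ℕ.* n
  twoM≤n² = ℕ.≤-trans (sumℕ-mono n deg≤n) (ℕ.≤-reflexive (sumℕ-const n n))

  0<twoM : 0 ℕ.< twoM G
  0<twoM = ℕ.≤-trans nonempty n≤twoM

  0≤ρ : 0ℚ ≤ ρ
  0≤ρ = 0≤⊗ (0≤ι (n ℕ.* n)) (0≤inv (twoM G))

  0≤edgeProb : 0ℚ ≤ edgeProb
  0≤edgeProb = 0≤⊗ (0≤inv n) (0≤⊗ (0≤inv n) (0≤ι (twoM G)))

  ρ⊗edgeProb : ρ ⊗ edgeProb ≡ 1ℚ
  ρ⊗edgeProb = trans (cong (λ z → z ⊗ inv (twoM G) ⊗ edgeProb) (ι-* n n)) (trans
    (solve 4 (λ n i m j → n :* n :* j :* (i :* (i :* m)) := (i :* n) :* (i :* n) :* (j :* m)) refl (ι n) (inv n) (ι (twoM G)) (inv (twoM G)))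
    (trans (cong₂ (λ x y → x ⊗ x ⊗ y) (inv⊗ nonempty) (inv⊗ 0<twoM)) (trans (⊗-identityʳ _) (⊗-identityˡ 1ℚ))))

  edgeProb⊗ρ : edgeProb ⊗ ρ ≡ 1ℚ
  edgeProb⊗ρ = trans (⊗-comm edgeProb ρ) ρ⊗edgeProb

  1≤ρ : 1ℚ ≤ ρ
  1≤ρ = subst (_≤ ρ) (trans (⊗-comm _ _) (inv⊗ 0<twoM)) (⊗-monoˡ-≤ (0≤inv (twoM G)) (ι-mono twoM≤n²))

  E-adj : E (vertex G) (λ x → E (vertex G) (λ y → 𝟙 (adj x y))) ≡ edgeProb
  E-adj = trans (E-cong (vertex G) (λ x → trans (E-vertex G _) (cong (inv n ⊗_) (sym (count≡∑𝟙 n (adj x))))))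
    (trans (scale (vertex G) (inv n) _) (trans (cong (inv n ⊗_) (E-vertex G _)) (cong (λ z → inv n ⊗ (inv n ⊗ z)) (sym (ι-∑ n (deg G))))))

  pairTrial-Bernoulli : Bernoulli G pairTrial edgeProb
  pairTrial-Bernoulli f = subst (λ p → E μ (λ { (x , y) → f (adj x y) }) ≡ p ⊗ f true ⊕ (1ℚ ⊝ p) ⊗ f false) E-adj
    (indicator-Bernoulli μ (λ { (x , y) → adj x y }) f)
    where
    μ : Mean (Fin n × Fin n)
    μ = bindMean (vertex G) (λ x → bindMean (vertex G) (λ y → pure (x , y)))

  pairTrial-cost : cost G pairTrial ≡ ι 3
  pairTrial-cost = trans (cong (1ℚ ⊕_) (trans (const (vertex G) _) (cong (1ℚ ⊕_) (const (vertex G) _))))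
    (solve 0 (con (+ 1) :+ (con (+ 1) :+ (con (+ 1) :+ con (+ 0))) := con (+ 3)) refl)

  module _ {ε : ℚ} (0<ε : 0ℚ < ε) (ε<1 : ε < 1ℚ) where

    private
      Φ F : ℕ × ℕ → ℚ
      Φ (N , r) = awaitCost 1ℚ (ι 3) ρ r
      F (N , r) = awaitFailure ε edgeProb N r

      Φ-step : ∀ l → 1ℚ ⊕ (cost G (densityBody ε l) ⊕ E (⟦_⟧ G (densityBody ε l)) (onLoop G Φ (λ _ → 0ℚ))) ≤ Φ l
      Φ-step (N , zero)  = ℚ.≤-reflexive (solve 1 (λ z → con (+ 1) :+ (con (+ 0) :+ con (+ 0)) := con (+ 1) :+ con (+ 0) :* z) refl ((1ℚ ⊕ ι 3) ⊗ ρ))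
      Φ-step (N , suc r) = await-cost-step G {trial = pairTrial} pairTrial-Bernoulli _,_ 1ℚ (ι 3) ρ Φ ρ⊗edgeProb (ℚ.≤-reflexive pairTrial-cost) (λ _ _ → refl) N r

      F-step : ∀ l → E (⟦_⟧ G (densityBody ε l)) (onLoop G F (failure G (Correct ε G))) ≤ F l
      F-step (N , zero)  = subst (λ Q → (if approxᵇ ε Q (estimate ε 1ℚ N) then 0ℚ else 1ℚ) ≤ F (N , zero)) (sym nOverD≡ρ)
        (await-done 0<ε ε<1 0≤edgeProb edgeProb⊗ρ ρ⊗edgeProb)
      F-step (N , suc r) = await-failure-step G {trial = pairTrial} pairTrial-Bernoulli _,_ ε F (failure G (Correct ε G)) (λ _ _ → refl) N r

      0≤Φ : ∀ l → 0ℚ ≤ Φ l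
      0≤Φ (N , r) = 0≤awaitCost (ι 3) ρ r 0≤1 (0≤ι 3) 0≤ρ

      0≤F : ∀ l → 0ℚ ≤ F l
      0≤F (N , r) = 0≤awaitFailure ε edgeProb N r

      open module S = Soundness G (densityBody ε) (0 , hits ε) Φ 0≤Φ Φ-step

    pairAlgorithm-succeeds : Succeeds pairAlgorithm ε G
    pairAlgorithm-succeeds = S.Success.succeeds (Correct ε G) F 0≤F F-step
      (≤-cert (ι 8 ⊗ F (0 , hits ε)) (0≤⊗ (0≤ι 8) (0≤F (0 , hits ε)))
        (trans (sym (awaitFailure-start ε edgeProb)) (solve 1 (λ f → con (+ 12) :* f := con (+ 4) :* f :+ con (+ 8) :* f) refl (F (0 , hits ε)))))

    -- The initial potential is 1 + 12q · 4ρ. Since qε² ≤ 2, the second term contributes at most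
    -- 96ρ, and the first is covered by ε² ≤ 1 ≤ ρ.
    pairAlgorithm-cost : ∀ k → ExpCost pairAlgorithm ε G k ⊗ (ε ⊗ ε) ≤ ι 97 ⊗ ρ
    pairAlgorithm-cost k = ℚ.≤-trans (⊗-monoˡ-≤ (0≤sq ε) (S.expCost≤ k (ret (inj₁ (0 , hits ε)))))
      (≤-cert w 0≤w (begin
        ι 97 ⊗ ρ
          ≡⟨ solve 3 (λ ρ q e → con (+ 97) :* ρ :=
               (con (+ 0) :+ (con (+ 1) :+ (con (+ 12) :* q) :* ((con (+ 1) :+ con (+ 3)) :* ρ))) :* (e :* e)
               :+ (con (+ 48) :* ρ :* (con (+ 2) :- q :* (e :* e)) :+ ((con (+ 1) :- e) :* (con (+ 1) :+ e) :+ (ρ :- con (+ 1))))) refl ρ q ε ⟩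
        (0ℚ ⊕ (1ℚ ⊕ (ι 12 ⊗ q) ⊗ ((1ℚ ⊕ ι 3) ⊗ ρ))) ⊗ (ε ⊗ ε) ⊕ w
          ≡⟨ cong (λ z → (0ℚ ⊕ (1ℚ ⊕ z ⊗ ((1ℚ ⊕ ι 3) ⊗ ρ))) ⊗ (ε ⊗ ε) ⊕ w) (sym (ι-* 12 (inverseSquare ε))) ⟩
        (0ℚ ⊕ Φ (0 , hits ε)) ⊗ (ε ⊗ ε) ⊕ w ∎))
      where
      open ≡-Reasoning
      q = ι (inverseSquare ε)
      w = ι 48 ⊗ ρ ⊗ (ι 2 ⊝ q ⊗ (ε ⊗ ε)) ⊕ ((1ℚ ⊝ ε) ⊗ (1ℚ ⊕ ε) ⊕ (ρ ⊝ 1ℚ))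
      0≤ε = ℚ.<⇒≤ 0<ε
      0≤w : 0ℚ ≤ w
      0≤w = 0≤⊕ (0≤⊗ (0≤⊗ (0≤ι 48) 0≤ρ) (gap (qε²≤2 0<ε ε<1))) (0≤⊕ (0≤⊗ (gap (ℚ.<⇒≤ ε<1)) (0≤⊕ 0≤1 0≤ε)) (gap 1≤ρ))

-- Independent repetitions

module _ {V A B : Set} {κ : Oracle} (p : Prog V A κ) (combine : A → B → B) (start : B) where

  repeat : ℕ → Prog V B κ
  repeat zero    = ret start
  repeat (suc k) = repeat k >>= λ s → p >>= λ a → ret (combine a s)

E-deviation : ∀ {A : Set} (μ : Mean A) c (g : A → ℚ) →
  E μ (λ a → (c ⊕ (g a ⊝ E μ g)) ⊗ (c ⊕ (g a ⊝ E μ g))) ≡ c ⊗ c ⊕ E μ (λ a → (g a ⊝ E μ g) ⊗ (g a ⊝ E μ g))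
E-deviation μ c g = begin
  E μ (λ a → (c ⊕ (g a ⊝ m)) ⊗ (c ⊕ (g a ⊝ m)))
    ≡⟨ E-cong μ (λ a → solve 3 (λ c g m → (c :+ (g :- m)) :* (c :+ (g :- m)) :=
         (c :* c :- con (+ 2) :* c :* m) :+ (con (+ 2) :* c :* g :+ (g :- m) :* (g :- m))) refl c (g a) m) ⟩
  E μ (λ a → (c ⊗ c ⊝ ι 2 ⊗ c ⊗ m) ⊕ (ι 2 ⊗ c ⊗ g a ⊕ (g a ⊝ m) ⊗ (g a ⊝ m)))
    ≡⟨ trans (shift μ _ _) (cong (c ⊗ c ⊝ ι 2 ⊗ c ⊗ m ⊕_) (trans (add μ _ _) (cong₂ _⊕_ (scale μ (ι 2 ⊗ c) g) refl))) ⟩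
  (c ⊗ c ⊝ ι 2 ⊗ c ⊗ m) ⊕ (ι 2 ⊗ c ⊗ m ⊕ v)
    ≡⟨ solve 3 (λ c m v → (c :* c :- con (+ 2) :* c :* m) :+ (con (+ 2) :* c :* m :+ v) := c :* c :+ v) refl c m v ⟩
  c ⊗ c ⊕ v ∎
  where
  open ≡-Reasoning
  m = E μ g
  v = E μ (λ a → (g a ⊝ m) ⊗ (g a ⊝ m))

variance≤second-moment : ∀ {A : Set} (μ : Mean A) (g : A → ℚ) →
  E μ (λ a → (g a ⊝ E μ g) ⊗ (g a ⊝ E μ g)) ≤ E μ (λ a → g a ⊗ g a)
variance≤second-moment μ g = ≤-cert (m ⊗ m) (0≤sq m) (sym (begin
  E μ (λ a → (g a ⊝ m) ⊗ (g a ⊝ m)) ⊕ m ⊗ m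
    ≡⟨ cong (_⊕ m ⊗ m) (E-cong μ (λ a → solve 2 (λ g m → (g :- m) :* (g :- m) := m :* m :+ ((con (+ 0) :- con (+ 2) :* m) :* g :+ g :* g)) refl (g a) m)) ⟩
  E μ (λ a → m ⊗ m ⊕ ((0ℚ ⊝ ι 2 ⊗ m) ⊗ g a ⊕ g a ⊗ g a)) ⊕ m ⊗ m
    ≡⟨ cong (_⊕ m ⊗ m) (trans (shift μ _ _) (cong (m ⊗ m ⊕_) (trans (add μ _ _) (cong₂ _⊕_ (scale μ (0ℚ ⊝ ι 2 ⊗ m) g) refl)))) ⟩
  m ⊗ m ⊕ ((0ℚ ⊝ ι 2 ⊗ m) ⊗ m ⊕ s) ⊕ m ⊗ m
    ≡⟨ solve 2 (λ m s → m :* m :+ ((con (+ 0) :- con (+ 2) :* m) :* m :+ s) :+ m :* m := s) refl m s ⟩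
  s ∎))
  where
  open ≡-Reasoning
  m = E μ g
  s = E μ (λ a → g a ⊗ g a)

E-complement : ∀ {A : Set} (μ : Mean A) f → E μ (λ a → 1ℚ ⊝ f a) ≡ 1ℚ ⊝ E μ f
E-complement μ f = begin
  E μ (λ a → 1ℚ ⊝ f a)           ≡⟨ shift μ 1ℚ (λ a → ⊖ f a) ⟩
  1ℚ ⊕ E μ (λ a → ⊖ f a)         ≡⟨ cong (1ℚ ⊕_) (E-cong μ (λ a → solve 1 (λ x → :- x := :- con (+ 1) :* x) refl (f a))) ⟩
  1ℚ ⊕ E μ (λ a → (⊖ 1ℚ) ⊗ f a)  ≡⟨ cong (1ℚ ⊕_) (scale μ (⊖ 1ℚ) f) ⟩
  1ℚ ⊕ (⊖ 1ℚ) ⊗ E μ f            ≡⟨ solve 1 (λ x → con (+ 1) :+ :- con (+ 1) :* x := con (+ 1) :- x) refl (E μ f) ⟩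
  1ℚ ⊝ E μ f                     ∎
  where open ≡-Reasoning

module _ (G : Graph) where
  open Graph G using (n; adj; nonempty)

  module Repeat {A B : Set} {κ : Oracle} (p : Prog (Fin n) A κ) (combine : A → B → B) (start : B) where

    private
      μ : Mean A
      μ = ⟦_⟧ G p
      rep : ℕ → Prog (Fin n) B κ
      rep = repeat p combine start

    E-suc : ∀ k f → E (⟦_⟧ G (rep (suc k))) f ≡ E (⟦_⟧ G (rep k)) (λ s → E μ (λ a → f (combine a s)))
    E-suc k f = trans (E->>= G (rep k) _ f) (E-cong (⟦_⟧ G (rep k)) (λ s → E->>= G p (λ a → ret (combine a s)) f))

    -- `mono` compares functions everywhere, but some bounds hold only for values that can occur.
    -- `Q` holds for every single draw, and `P` is the invariant that it implies for the accumulated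
    -- state.
    repeat-mono : (Q : A → Set) → (∀ {f g} → (∀ a → Q a → f a ≤ g a) → E μ f ≤ E μ g) →
      (P : ℕ → B → Set) → P 0 start → (∀ k a s → Q a → P k s → P (suc k) (combine a s)) →
      ∀ k {f g} → (∀ s → P k s → f s ≤ g s) → E (⟦_⟧ G (rep k)) f ≤ E (⟦_⟧ G (rep k)) g
    repeat-mono Q support P P-start P-combine zero    f≤g = f≤g start P-start
    repeat-mono Q support P P-start P-combine (suc k) f≤g = subst₂ _≤_ (sym (E-suc k _)) (sym (E-suc k _))
      (repeat-mono Q support P P-start P-combine k (λ s Ps → support (λ a Qa → f≤g (combine a s) (P-combine k a s Qa Ps))))

    repeat-cost : ∀ k → cost G (rep k) ≡ ι k ⊗ cost G p
    repeat-cost zero    = sym (⊗-zeroˡ (cost G p))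
    repeat-cost (suc k) = begin
      cost G (rep (suc k))
        ≡⟨ cost->>= G (rep k) _ ⟩
      cost G (rep k) ⊕ E (⟦_⟧ G (rep k)) (λ s → cost G (p >>= λ a → ret (combine a s)))
        ≡⟨ cong₂ _⊕_ (repeat-cost k) (trans (E-cong (⟦_⟧ G (rep k)) (λ s → trans (cost->>= G p _) (trans (cong (cost G p ⊕_) (const μ 0ℚ)) (⊕-identityʳ _))))
             (const (⟦_⟧ G (rep k)) (cost G p))) ⟩
      ι k ⊗ cost G p ⊕ cost G p
        ≡⟨ solve 2 (λ k c → k :* c :+ c := (con (+ 1) :+ k) :* c) refl (ι k) (cost G p) ⟩
      (1ℚ ⊕ ι k) ⊗ cost G p
        ≡⟨ cong (_⊗ cost G p) (ι-suc k) ⟨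
      ι (suc k) ⊗ cost G p ∎
      where open ≡-Reasoning

    module Sum (h : A → ℚ) (S : B → ℚ) (S-start : S start ≡ 0ℚ) (S-combine : ∀ a s → S (combine a s) ≡ h a ⊕ S s) where

      repeat-mean : ∀ k → E (⟦_⟧ G (rep k)) S ≡ ι k ⊗ E μ h
      repeat-mean zero    = trans S-start (sym (⊗-zeroˡ (E μ h)))
      repeat-mean (suc k) = begin
        E (⟦_⟧ G (rep (suc k))) S
          ≡⟨ trans (E-suc k S) (E-cong (⟦_⟧ G (rep k)) (λ s → trans (E-cong μ (λ a → trans (S-combine a s) (⊕-comm _ _))) (shift μ (S s) h))) ⟩
        E (⟦_⟧ G (rep k)) (λ s → S s ⊕ E μ h)
          ≡⟨ trans (add (⟦_⟧ G (rep k)) _ _) (cong₂ _⊕_ (repeat-mean k) (const (⟦_⟧ G (rep k)) (E μ h))) ⟩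
        ι k ⊗ E μ h ⊕ E μ h
          ≡⟨ solve 2 (λ k m → k :* m :+ m := (con (+ 1) :+ k) :* m) refl (ι k) (E μ h) ⟩
        (1ℚ ⊕ ι k) ⊗ E μ h
          ≡⟨ cong (_⊗ E μ h) (ι-suc k) ⟨
        ι (suc k) ⊗ E μ h ∎
        where open ≡-Reasoning

      variance : ℚ
      variance = E μ (λ a → (h a ⊝ E μ h) ⊗ (h a ⊝ E μ h))

      -- Variances of independent draws add up. The offset `c` allows a centre other than the mean,
      -- as required after conditioning on another sample.
      repeat-deviation : ∀ k c →
        E (⟦_⟧ G (rep k)) (λ s → (c ⊕ (S s ⊝ ι k ⊗ E μ h)) ⊗ (c ⊕ (S s ⊝ ι k ⊗ E μ h))) ≡ c ⊗ c ⊕ ι k ⊗ variance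
      repeat-deviation zero    c = trans (cong (λ z → (c ⊕ (z ⊝ 0ℚ ⊗ E μ h)) ⊗ (c ⊕ (z ⊝ 0ℚ ⊗ E μ h))) S-start)
        (solve 3 (λ c m v → (c :+ (con (+ 0) :- con (+ 0) :* m)) :* (c :+ (con (+ 0) :- con (+ 0) :* m)) := c :* c :+ con (+ 0) :* v) refl c (E μ h) variance)
      repeat-deviation (suc k) c = begin
        E (⟦_⟧ G (rep (suc k))) (λ s → (c ⊕ (S s ⊝ ι (suc k) ⊗ m)) ⊗ (c ⊕ (S s ⊝ ι (suc k) ⊗ m)))
          ≡⟨ trans (E-suc k _) (E-cong (⟦_⟧ G (rep k)) (λ s → E-cong μ (λ a → cong (λ z → z ⊗ z) (regroup a s)))) ⟩
        E (⟦_⟧ G (rep k)) (λ s → E μ (λ a → ((c ⊕ (S s ⊝ ι k ⊗ m)) ⊕ (h a ⊝ m)) ⊗ ((c ⊕ (S s ⊝ ι k ⊗ m)) ⊕ (h a ⊝ m))))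
          ≡⟨ E-cong (⟦_⟧ G (rep k)) (λ s → E-deviation μ (c ⊕ (S s ⊝ ι k ⊗ m)) h) ⟩
        E (⟦_⟧ G (rep k)) (λ s → (c ⊕ (S s ⊝ ι k ⊗ m)) ⊗ (c ⊕ (S s ⊝ ι k ⊗ m)) ⊕ variance)
          ≡⟨ trans (add (⟦_⟧ G (rep k)) _ _) (cong₂ _⊕_ (repeat-deviation k c) (const (⟦_⟧ G (rep k)) variance)) ⟩
        c ⊗ c ⊕ ι k ⊗ variance ⊕ variance
          ≡⟨ solve 3 (λ x k v → x :+ k :* v :+ v := x :+ (con (+ 1) :+ k) :* v) refl (c ⊗ c) (ι k) variance ⟩
        c ⊗ c ⊕ (1ℚ ⊕ ι k) ⊗ variance
          ≡⟨ cong (λ z → c ⊗ c ⊕ z ⊗ variance) (ι-suc k) ⟨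
        c ⊗ c ⊕ ι (suc k) ⊗ variance ∎
        where
        open ≡-Reasoning
        m = E μ h
        regroup : ∀ a s → c ⊕ (S (combine a s) ⊝ ι (suc k) ⊗ m) ≡ (c ⊕ (S s ⊝ ι k ⊗ m)) ⊕ (h a ⊝ m)
        regroup a s = trans (cong₂ (λ x y → c ⊕ (x ⊝ y ⊗ m)) (S-combine a s) (ι-suc k))
          (solve 5 (λ c h s k m → c :+ (h :+ s :- (con (+ 1) :+ k) :* m) := (c :+ (s :- k :* m)) :+ (h :- m)) refl c (h a) (S s) (ι k) m)

      repeat-variance : ∀ k c →
        E (⟦_⟧ G (rep k)) (λ s → (c ⊕ (S s ⊝ ι k ⊗ E μ h)) ⊗ (c ⊕ (S s ⊝ ι k ⊗ E μ h))) ≤ c ⊗ c ⊕ ι k ⊗ E μ (λ a → h a ⊗ h a)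
      repeat-variance k c = ℚ.≤-trans (ℚ.≤-reflexive (repeat-deviation k c))
        (⊕-mono-≤ (ℚ.≤-refl {c ⊗ c}) (⊗-monoʳ-≤ (0≤ι k) (variance≤second-moment μ h)))

      repeat-second-moment : ∀ k →
        E (⟦_⟧ G (rep k)) (λ s → S s ⊗ S s) ≤ (ι k ⊗ E μ h) ⊗ (ι k ⊗ E μ h) ⊕ ι k ⊗ E μ (λ a → h a ⊗ h a)
      repeat-second-moment k = subst (_≤ _) (E-cong (⟦_⟧ G (rep k)) (λ s → cong (λ z → z ⊗ z)
        (solve 2 (λ m s → m :+ (s :- m) := s) refl (ι k ⊗ E μ h) (S s)))) (repeat-variance k (ι k ⊗ E μ h))

    -- A single miss has probability at most 1/(1 + γ), and Bernoulli's inequality (1 + γ)^k ≥ 1 +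
    -- kγ turns the k-th power into a linear bound.
    repeat-miss : ∀ {γ} (h : A → ℚ) (S : B → ℚ) → 0ℚ ≤ γ → (∀ s → 0ℚ ≤ S s) →
      S start ≤ 1ℚ → (∀ a s → S (combine a s) ≤ S s ⊗ h a) → E μ h ⊗ (1ℚ ⊕ γ) ≤ 1ℚ →
      ∀ k → (1ℚ ⊕ ι k ⊗ γ) ⊗ E (⟦_⟧ G (rep k)) S ≤ 1ℚ
    repeat-miss {γ} h S 0≤γ 0≤S S-start S-combine rare zero = subst (_≤ 1ℚ)
      (solve 2 (λ γ s → s := (con (+ 1) :+ con (+ 0) :* γ) :* s) refl γ (S start)) S-start
    repeat-miss {γ} h S 0≤γ 0≤S S-start S-combine rare (suc k) = begin
      (1ℚ ⊕ ι (suc k) ⊗ γ) ⊗ E (⟦_⟧ G (rep (suc k))) S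
        ≤⟨ ⊗-monoʳ-≤ 0≤factor (ℚ.≤-trans (ℚ.≤-reflexive (E-suc k S)) (ℚ.≤-trans
             (mono (⟦_⟧ G (rep k)) (λ s → ℚ.≤-trans (mono μ (λ a → S-combine a s)) (ℚ.≤-reflexive (trans (scale μ (S s) h) (⊗-comm _ _)))))
             (ℚ.≤-reflexive (scale (⟦_⟧ G (rep k)) (E μ h) S)))) ⟩
      (1ℚ ⊕ ι (suc k) ⊗ γ) ⊗ (b ⊗ x)
        ≡⟨ cong (λ z → (1ℚ ⊕ z ⊗ γ) ⊗ (b ⊗ x)) (ι-suc k) ⟩
      (1ℚ ⊕ (1ℚ ⊕ ι k) ⊗ γ) ⊗ (b ⊗ x)
        ≤⟨ ≤-cert (ι k ⊗ (γ ⊗ γ) ⊗ (b ⊗ x)) (0≤⊗ (0≤⊗ (0≤ι k) (0≤sq γ)) 0≤bx)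
             (solve 4 (λ k γ b x → (b :* (con (+ 1) :+ γ)) :* ((con (+ 1) :+ k :* γ) :* x) :=
                (con (+ 1) :+ (con (+ 1) :+ k) :* γ) :* (b :* x) :+ k :* (γ :* γ) :* (b :* x)) refl (ι k) γ b x) ⟩
      (b ⊗ (1ℚ ⊕ γ)) ⊗ ((1ℚ ⊕ ι k ⊗ γ) ⊗ x)
        ≤⟨ ⊗-monoˡ-≤ (0≤⊗ (0≤⊕ 0≤1 (0≤⊗ (0≤ι k) 0≤γ)) 0≤x) rare ⟩
      1ℚ ⊗ ((1ℚ ⊕ ι k ⊗ γ) ⊗ x)
        ≡⟨ ⊗-identityˡ _ ⟩
      (1ℚ ⊕ ι k ⊗ γ) ⊗ x
        ≤⟨ repeat-miss h S 0≤γ 0≤S S-start S-combine rare k ⟩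
      1ℚ ∎
      where
      open ℚ.≤-Reasoning
      b = E μ h
      x = E (⟦_⟧ G (rep k)) S
      0≤x : 0ℚ ≤ x
      0≤x = 0≤E (⟦_⟧ G (rep k)) 0≤S
      0≤bx : 0ℚ ≤ b ⊗ x
      0≤bx = subst (0ℚ ≤_) (scale (⟦_⟧ G (rep k)) b S) (0≤E (⟦_⟧ G (rep k)) (λ s → subst (0ℚ ≤_)
        (trans (scale μ (S s) h) (⊗-comm _ _)) (0≤E μ (λ a → ℚ.≤-trans (0≤S (combine a s)) (S-combine a s)))))
      0≤factor : 0ℚ ≤ 1ℚ ⊕ ι (suc k) ⊗ γ
      0≤factor = 0≤⊕ 0≤1 (0≤⊗ (0≤ι (suc k)) 0≤γ)

  E-vertex-swap : ∀ {A : Set} (μ : Mean A) (f : A → Fin n → ℚ) → E μ (λ a → E (vertex G) (f a)) ≡ E (vertex G) (λ v → E μ (λ a → f a v))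
  E-vertex-swap μ f = trans (E-cong μ (λ a → E-vertex G (f a))) (trans (scale μ (inv n) _)
    (trans (cong (inv n ⊗_) (E-∑ μ n (λ v a → f a v))) (sym (E-vertex G _))))

-- Edges between two random samples

listSum : {V : Set} → (V → ℚ) → List V → ℚ
listSum h []       = 0ℚ
listSum h (v ∷ vs) = h v ⊕ listSum h vs

keep : {V : Set} → V × Bool → List V → List V
keep (v , b) vs = if b then v ∷ vs else vs

flagged : ∀ {V κ} → ℕ → Prog V (V × Bool) κ
flagged θ = randVert (λ v → degree v (λ d → ret (v , (d ℕ.≤ᵇ θ))))

sampleLight : ∀ {V κ} → ℕ → ℕ → Prog V (List V) κ
sampleLight θ = repeat (flagged θ) keep []

listSum-keep : ∀ {V : Set} (h : V → ℚ) a vs → listSum h (keep a vs) ≡ 𝟙 (proj₂ a) ⊗ h (proj₁ a) ⊕ listSum h vs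
listSum-keep h (v , true)  vs = cong (_⊕ listSum h vs) (sym (⊗-identityˡ (h v)))
listSum-keep h (v , false) vs = sym (trans (cong (_⊕ listSum h vs) (⊗-zeroˡ (h v))) (⊕-identityˡ _))

listSum-⊗ : ∀ {V : Set} c (h : V → ℚ) vs → listSum (λ v → c ⊗ h v) vs ≡ c ⊗ listSum h vs
listSum-⊗ c h []       = sym (⊗-zeroʳ c)
listSum-⊗ c h (v ∷ vs) = trans (cong (c ⊗ h v ⊕_) (listSum-⊗ c h vs)) (sym (⊗-distribˡ c _ _))

E-listSum : ∀ {A V : Set} (μ : Mean A) (h : V → A → ℚ) vs → E μ (λ a → listSum (λ v → h v a) vs) ≡ listSum (λ v → E μ (h v)) vs
E-listSum μ h []       = const μ 0ℚ
E-listSum μ h (v ∷ vs) = trans (add μ (h v) _) (cong (E μ (h v) ⊕_) (E-listSum μ h vs))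

𝟙-idem : ∀ b → 𝟙 b ⊗ 𝟙 b ≡ 𝟙 b
𝟙-idem false = ⊗-zeroˡ 0ℚ
𝟙-idem true  = ⊗-identityˡ 1ℚ

module _ (G : Graph) where
  open Graph G using (n; adj; nonempty) renaming (sym to adj-sym)

  -- Edges between two independent samples, with multiplicity, rather than inside one sample: given
  -- `Y`, this is a sum of independent terms, one for each draw of the second sample.
  cross : List (Fin n) → List (Fin n) → ℚ
  cross Y Z = listSum (λ z → listSum (λ y → 𝟙 (adj y z)) Y) Z

  module Light (θ : ℕ) where

    light : Fin n → Bool
    light v = deg G v ℕ.≤ᵇ θ

    lightNbrs : Fin n → ℚ
    lightNbrs y = E (vertex G) (λ z → 𝟙 (light z) ⊗ 𝟙 (adj y z))

    lightProb : ℚ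
    lightProb = E (vertex G) (λ y → 𝟙 (light y) ⊗ lightNbrs y)

    0≤lightNbrs : ∀ y → 0ℚ ≤ lightNbrs y
    0≤lightNbrs y = 0≤E (vertex G) (λ z → 0≤⊗ (0≤𝟙 (light z)) (0≤𝟙 (adj y z)))

    n-lightNbrs≤deg : ∀ y → ι n ⊗ lightNbrs y ≤ ι (deg G y)
    n-lightNbrs≤deg y = ℚ.≤-trans (⊗-monoʳ-≤ (0≤ι n) (mono (vertex G) (λ z →
        ℚ.≤-trans (⊗-monoˡ-≤ (0≤𝟙 (adj y z)) (𝟙≤1 (light z))) (ℚ.≤-reflexive (⊗-identityˡ _)))))
      (ℚ.≤-reflexive (trans (cong (ι n ⊗_) (E-vertex G _)) (trans (sym (⊗-assoc (ι n) (inv n) _))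
        (trans (cong₂ _⊗_ (trans (⊗-comm (ι n) (inv n)) (inv⊗ nonempty)) refl) (trans (⊗-identityˡ _) (sym (count≡∑𝟙 n (adj y))))))))

    -- The hypothesis kθ ≤ cn says that a vertex of degree at most θ has on average at most `c`
    -- neighbours in a sample of size k. This keeps the variance of the edge count within a constant
    -- factor of its mean.
    module Batch (k : ℕ) (c : ℚ) (c-bound : ι k ⊗ ι θ ≤ c ⊗ ι n) where

      private
        sample : Prog (Fin n) (List (Fin n)) additives
        sample = sampleLight θ k
        σ : Mean (List (Fin n))
        σ = ⟦_⟧ G sample
        K : ℚ
        K = ι k

      module SumOf (h : Fin n → ℚ) = Repeat.Sum G {κ = additives} (flagged θ) keep []
        (λ a → 𝟙 (proj₂ a) ⊗ h (proj₁ a)) (listSum h) refl (listSum-keep h)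

      few-lightNbrs : ∀ y → 𝟙 (light y) ⊗ (K ⊗ lightNbrs y) ≤ 𝟙 (light y) ⊗ c
      few-lightNbrs y with deg G y ℕ.≤ᵇ θ in isLight
      ... | false = ℚ.≤-reflexive (trans (⊗-zeroˡ _) (sym (⊗-zeroˡ _)))
      ... | true  = ⊗-monoʳ-≤ 0≤1 (≤-by-inverse (ι n) (0≤inv n) (inv⊗ nonempty) (begin
        ι n ⊗ (K ⊗ lightNbrs y) ≡⟨ solve 3 (λ n k r → n :* (k :* r) := k :* (n :* r)) refl (ι n) K (lightNbrs y) ⟩
        K ⊗ (ι n ⊗ lightNbrs y) ≤⟨ ⊗-monoʳ-≤ (0≤ι k) (n-lightNbrs≤deg y) ⟩
        K ⊗ ι (deg G y)         ≤⟨ ⊗-monoʳ-≤ (0≤ι k) (ι-mono (ℕ.≤ᵇ⇒≤ (deg G y) θ (subst T (sym isLight) tt))) ⟩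
        K ⊗ ι θ                 ≤⟨ c-bound ⟩
        c ⊗ ι n                 ≡⟨ ⊗-comm c (ι n) ⟩
        ι n ⊗ c                 ∎))
        where open ℚ.≤-Reasoning

      m : ℚ
      m = K ⊗ (K ⊗ lightProb)

      private
        rate : List (Fin n) → ℚ
        rate Y = E (vertex G) (λ z → 𝟙 (light z) ⊗ listSum (λ y → 𝟙 (adj y z)) Y)

        rate≡ : ∀ Y → rate Y ≡ listSum lightNbrs Y
        rate≡ Y = trans (E-cong (vertex G) (λ z → sym (listSum-⊗ (𝟙 (light z)) (λ y → 𝟙 (adj y z)) Y)))
          (E-listSum (vertex G) (λ y z → 𝟙 (light z) ⊗ 𝟙 (adj y z)) Y)

        square : ℚ → ℚ
        square x = x ⊗ x

        rate-variance : E σ (λ Y → square (K ⊗ rate Y ⊝ m)) ≤ c ⊗ m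
        rate-variance = begin
          E σ (λ Y → square (K ⊗ rate Y ⊝ m))
            ≡⟨ E-cong σ (λ Y → cong square (trans (cong (λ r → K ⊗ r ⊝ m) (rate≡ Y))
                 (solve 3 (λ k s p → k :* s :- k :* (k :* p) := con (+ 0) :+ (k :* s :- k :* (k :* p))) refl K (listSum lightNbrs Y) lightProb))) ⟩
          E σ (λ Y → square (0ℚ ⊕ (K ⊗ listSum lightNbrs Y ⊝ m)))
            ≡⟨ E-cong σ (λ Y → cong₂ (λ x y → square (0ℚ ⊕ (x ⊝ K ⊗ y))) (sym (listSum-⊗ K lightNbrs Y))
                 (sym (trans (E-cong (vertex G) (λ y → solve 3 (λ l k r → l :* (k :* r) := k :* (l :* r)) refl (𝟙 (light y)) K (lightNbrs y))) (scale (vertex G) K _)))) ⟩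
          E σ (λ Y → square (0ℚ ⊕ (listSum (λ y → K ⊗ lightNbrs y) Y ⊝ K ⊗ E (vertex G) (λ y → 𝟙 (light y) ⊗ (K ⊗ lightNbrs y)))))
            ≤⟨ SumOf.repeat-variance (λ y → K ⊗ lightNbrs y) k 0ℚ ⟩
          0ℚ ⊗ 0ℚ ⊕ K ⊗ E (vertex G) (λ y → square (𝟙 (light y) ⊗ (K ⊗ lightNbrs y)))
            ≡⟨ solve 1 (λ x → con (+ 0) :* con (+ 0) :+ x := x) refl _ ⟩
          K ⊗ E (vertex G) (λ y → square (𝟙 (light y) ⊗ (K ⊗ lightNbrs y)))
            ≤⟨ ⊗-monoʳ-≤ (0≤ι k) (mono (vertex G) (λ y → ℚ.≤-trans
                 (⊗-monoˡ-≤ (0≤⊗ (0≤𝟙 (light y)) (0≤⊗ (0≤ι k) (0≤lightNbrs y))) (few-lightNbrs y))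
                 (ℚ.≤-reflexive (trans (solve 4 (λ l c k r → (l :* c) :* (l :* (k :* r)) := c :* k :* ((l :* l) :* r)) refl (𝟙 (light y)) c K (lightNbrs y))
                   (cong (λ l → c ⊗ K ⊗ (l ⊗ lightNbrs y)) (𝟙-idem (light y))))))) ⟩
          K ⊗ E (vertex G) (λ y → c ⊗ K ⊗ (𝟙 (light y) ⊗ lightNbrs y))
            ≡⟨ trans (cong (K ⊗_) (scale (vertex G) (c ⊗ K) _)) (solve 3 (λ k c p → k :* (c :* k :* p) := c :* (k :* (k :* p))) refl K c lightProb) ⟩
          c ⊗ m ∎
          where open ℚ.≤-Reasoning

        column : Fin n → List (Fin n) → ℚ
        column z = listSum (λ y → 𝟙 (adj y z))

        column-mean : ∀ z → E (vertex G) (λ y → 𝟙 (light y) ⊗ 𝟙 (adj y z)) ≡ lightNbrs z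
        column-mean z = E-cong (vertex G) (λ y → cong (λ b → 𝟙 (light y) ⊗ 𝟙 b) (adj-sym y z))

        -- For light `z` the number of sampled light neighbours has mean Kr ≤ c, hence second moment
        -- at most (Kr)² + Kr ≤ (1 + c)Kr.
        column-second-moment : ∀ z → 𝟙 (light z) ⊗ E σ (λ Y → square (column z Y)) ≤ (1ℚ ⊕ c) ⊗ K ⊗ (𝟙 (light z) ⊗ lightNbrs z)
        column-second-moment z = begin
          l ⊗ E σ (λ Y → square (column z Y))
            ≤⟨ ⊗-monoʳ-≤ (0≤𝟙 (light z)) (SumOf.repeat-second-moment (λ y → 𝟙 (adj y z)) k) ⟩
          l ⊗ (square (K ⊗ E (vertex G) (λ y → 𝟙 (light y) ⊗ 𝟙 (adj y z))) ⊕ K ⊗ E (vertex G) (λ y → square (𝟙 (light y) ⊗ 𝟙 (adj y z))))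
            ≡⟨ cong₂ (λ x y → l ⊗ (square (K ⊗ x) ⊕ K ⊗ y)) (column-mean z) (trans (E-cong (vertex G) (λ y → trans
                 (solve 2 (λ l a → (l :* a) :* (l :* a) := (l :* l) :* (a :* a)) refl (𝟙 (light y)) (𝟙 (adj y z))) (cong₂ _⊗_ (𝟙-idem (light y)) (𝟙-idem (adj y z))))) (column-mean z)) ⟩
          l ⊗ (square (K ⊗ r) ⊕ K ⊗ r)
            ≤⟨ ≤-cert ((l ⊗ c ⊝ l ⊗ (K ⊗ r)) ⊗ (K ⊗ r)) (0≤⊗ (gap (few-lightNbrs z)) (0≤⊗ (0≤ι k) (0≤lightNbrs z)))
                 (solve 4 (λ l c k r → (con (+ 1) :+ c) :* k :* (l :* r) := l :* ((k :* r) :* (k :* r) :+ k :* r) :+ (l :* c :- l :* (k :* r)) :* (k :* r)) refl l c K r) ⟩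
          (1ℚ ⊕ c) ⊗ K ⊗ (l ⊗ r) ∎
          where
          open ℚ.≤-Reasoning
          l = 𝟙 (light z)
          r = lightNbrs z

        square-rate : E σ (λ Y → K ⊗ E (vertex G) (λ z → square (𝟙 (light z) ⊗ column z Y))) ≤ (1ℚ ⊕ c) ⊗ m
        square-rate = begin
          E σ (λ Y → K ⊗ E (vertex G) (λ z → square (𝟙 (light z) ⊗ column z Y)))
            ≡⟨ trans (scale σ K _) (cong (K ⊗_) (trans (E-vertex-swap G σ (λ Y z → square (𝟙 (light z) ⊗ column z Y))) (E-cong (vertex G) (λ z → trans (E-cong σ (λ Y → trans
                 (solve 2 (λ l x → (l :* x) :* (l :* x) := (l :* l) :* (x :* x)) refl (𝟙 (light z)) (column z Y))
                 (cong (_⊗ square (column z Y)) (𝟙-idem (light z))))) (scale σ (𝟙 (light z)) _))))) ⟩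
          K ⊗ E (vertex G) (λ z → 𝟙 (light z) ⊗ E σ (λ Y → square (column z Y)))
            ≤⟨ ⊗-monoʳ-≤ (0≤ι k) (mono (vertex G) column-second-moment) ⟩
          K ⊗ E (vertex G) (λ z → (1ℚ ⊕ c) ⊗ K ⊗ (𝟙 (light z) ⊗ lightNbrs z))
            ≡⟨ trans (cong (K ⊗_) (scale (vertex G) ((1ℚ ⊕ c) ⊗ K) _)) (solve 3 (λ k c p → k :* (c :* k :* p) := c :* (k :* (k :* p))) refl K (1ℚ ⊕ c) lightProb) ⟩
          (1ℚ ⊕ c) ⊗ m ∎
          where open ℚ.≤-Reasoning

      -- Law of total variance: the conditional mean given `Y` contributes cm, and the fluctuation
      -- of the second sample around it (1 + c)m.
      cross-variance : E σ (λ Y → E σ (λ Z → square (cross Y Z ⊝ m))) ≤ (1ℚ ⊕ (c ⊕ c)) ⊗ m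
      cross-variance = begin
        E σ (λ Y → E σ (λ Z → square (cross Y Z ⊝ m)))
          ≡⟨ E-cong σ (λ Y → E-cong σ (λ Z → cong square
               (solve 3 (λ x m r → x :- m := (r :- m) :+ (x :- r)) refl (cross Y Z) m (K ⊗ rate Y)))) ⟩
        E σ (λ Y → E σ (λ Z → square ((K ⊗ rate Y ⊝ m) ⊕ (cross Y Z ⊝ K ⊗ rate Y))))
          ≤⟨ mono σ (λ Y → SumOf.repeat-variance (λ z → column z Y) k (K ⊗ rate Y ⊝ m)) ⟩
        E σ (λ Y → square (K ⊗ rate Y ⊝ m) ⊕ K ⊗ E (vertex G) (λ z → square (𝟙 (light z) ⊗ column z Y)))
          ≡⟨ add σ _ _ ⟩
        E σ (λ Y → square (K ⊗ rate Y ⊝ m)) ⊕ E σ (λ Y → K ⊗ E (vertex G) (λ z → square (𝟙 (light z) ⊗ column z Y)))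
          ≤⟨ ⊕-mono-≤ rate-variance square-rate ⟩
        c ⊗ m ⊕ (1ℚ ⊕ c) ⊗ m
          ≡⟨ solve 2 (λ c m → c :* m :+ (con (+ 1) :+ c) :* m := (con (+ 1) :+ (c :+ c)) :* m) refl c m ⟩
        (1ℚ ⊕ (c ⊕ c)) ⊗ m ∎
        where open ℚ.≤-Reasoning

    cross-mean : ∀ k → E (⟦_⟧ G (sampleLight {κ = additives} θ k)) (λ Y → E (⟦_⟧ G (sampleLight {κ = additives} θ k)) (cross Y)) ≡ ι k ⊗ (ι k ⊗ lightProb)
    cross-mean k = trans (E-cong σ (λ Y → trans (SumOf.repeat-mean (λ z → listSum (λ y → 𝟙 (adj y z)) Y) k)
        (cong (ι k ⊗_) (trans (E-cong (vertex G) (λ z → sym (listSum-⊗ (𝟙 (light z)) (λ y → 𝟙 (adj y z)) Y)))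
          (E-listSum (vertex G) (λ y z → 𝟙 (light z) ⊗ 𝟙 (adj y z)) Y)))))
      (trans (scale σ (ι k) _) (cong (ι k ⊗_) (SumOf.repeat-mean lightNbrs k)))
      where
      σ = ⟦_⟧ G (sampleLight {κ = additives} θ k)
      module SumOf (h : Fin n → ℚ) = Repeat.Sum G {κ = additives} (flagged θ) keep []
        (λ a → 𝟙 (proj₂ a) ⊗ h (proj₁ a)) (listSum h) refl (listSum-keep h)

-- Counting the edges between two samples with Additive queries

sumL : {V : Set} → (V → ℕ) → List V → ℕ
sumL h []       = 0
sumL h (v ∷ vs) = h v ℕ.+ sumL h vs

sumL-cong : ∀ {V : Set} {g h : V → ℕ} → (∀ v → g v ≡ h v) → ∀ vs → sumL g vs ≡ sumL h vs
sumL-cong g≡h []       = refl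
sumL-cong g≡h (v ∷ vs) = cong₂ ℕ._+_ (g≡h v) (sumL-cong g≡h vs)

open import Algebra.Properties.CommutativeSemigroup ℕ.+-commutativeSemigroup using () renaming (interchange to +-interchange)

sumL-+ : ∀ {V : Set} (g h : V → ℕ) vs → sumL (λ v → g v ℕ.+ h v) vs ≡ sumL g vs ℕ.+ sumL h vs
sumL-+ g h []       = refl
sumL-+ g h (v ∷ vs) = trans (cong (g v ℕ.+ h v ℕ.+_) (sumL-+ g h vs)) (+-interchange (g v) (h v) _ _)

sumL-++ : ∀ {V : Set} (h : V → ℕ) us vs → sumL h (us ++ vs) ≡ sumL h us ℕ.+ sumL h vs
sumL-++ h []       vs = refl
sumL-++ h (u ∷ us) vs = trans (cong (h u ℕ.+_) (sumL-++ h us vs)) (sym (ℕ.+-assoc (h u) _ _))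

module Queries {V : Set} (_≟_ : DecidableEquality V) where

  member : List V → V → Bool
  member S x = any (λ y → ⌊ y ≟ x ⌋) S

  -- `kept B xs` takes one copy of each vertex of `xs` outside `B`, so that `kept B xs ++ B` is free
  -- of duplicates whenever `B` is; `repeats B xs` is what remains of `xs`.
  kept repeats : List V → List V → List V
  kept B []       = []
  kept B (x ∷ xs) = if member (kept B xs ++ B) x then kept B xs else x ∷ kept B xs
  repeats B []       = []
  repeats B (x ∷ xs) = if member (kept B xs ++ B) x then x ∷ repeats B xs else repeats B xs

  -- A pair query simulated by `Additive` on two vertices. Equal vertices are answered without a
  -- query, as there are no loops.
  adjacent : V → V → Prog V ℕ additives
  adjacent y z = if ⌊ y ≟ z ⌋ then ret 0 else additive (y ∷ z ∷ []) ret

  columnCount : List V → V → Prog V ℕ additives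
  columnCount []       z = ret 0
  columnCount (y ∷ ys) z = adjacent y z >>= λ a → columnCount ys z >>= λ s → ret (a ℕ.+ s)

  pairwiseCount : List V → List V → Prog V ℕ additives
  pairwiseCount ys []       = ret 0
  pairwiseCount ys (z ∷ zs) = columnCount ys z >>= λ a → pairwiseCount ys zs >>= λ s → ret (a ℕ.+ s)

  -- Additive sees sets, so only the distinct vertices are counted with it; repeated ones are few and are checked pair by pair.
  crossQuery : List V → List V → Prog V ℕ additives
  crossQuery Y Z =
    pairwiseCount Y (repeats KY Z) >>= λ a →
    pairwiseCount (repeats [] Y) KZ >>= λ b →
    additive (KZ ++ KY) λ e → additive KZ λ e₁ → additive KY λ e₂ →
    ret (a ℕ.+ (b ℕ.+ (e ℕ.∸ (e₁ ℕ.+ e₂))))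
    where
    KY = kept [] Y
    KZ = kept KY Z

  batch : ℕ → ℕ → Prog V ℕ additives
  batch θ k = sampleLight θ k >>= λ Y → sampleLight θ k >>= λ Z → crossQuery Y Z

  sumL-split : ∀ (h : V → ℕ) B xs → sumL h xs ≡ sumL h (kept B xs) ℕ.+ sumL h (repeats B xs)
  sumL-split h B []       = refl
  sumL-split h B (x ∷ xs) with member (kept B xs ++ B) x
  ... | false = trans (cong (h x ℕ.+_) (sumL-split h B xs)) (sym (ℕ.+-assoc (h x) _ _))
  ... | true  = trans (cong (h x ℕ.+_) (sumL-split h B xs)) (trans (sym (ℕ.+-assoc (h x) _ _))
    (trans (cong (ℕ._+ sumL h (repeats B xs)) (ℕ.+-comm (h x) _)) (ℕ.+-assoc (sumL h (kept B xs)) (h x) (sumL h (repeats B xs)))))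

  distinct : List V → Set
  distinct []       = ⊤
  distinct (x ∷ xs) = member xs x ≡ false × distinct xs

  distinct-kept : ∀ B xs → distinct B → distinct (kept B xs ++ B)
  distinct-kept B []       dB = dB
  distinct-kept B (x ∷ xs) dB with member (kept B xs ++ B) x in fresh
  ... | false = fresh , distinct-kept B xs dB
  ... | true  = distinct-kept B xs dB

  distinct-prefix : ∀ xs ys → distinct (xs ++ ys) → distinct xs
  distinct-prefix []       ys d       = tt
  distinct-prefix (x ∷ xs) ys (f , d) = member-prefix xs f , distinct-prefix xs ys d
    where
    member-prefix : ∀ xs → member (xs ++ ys) x ≡ false → member xs x ≡ false
    member-prefix []       _ = refl
    member-prefix (u ∷ us) f with ⌊ u ≟ x ⌋
    ... | false = member-prefix us f

  length-kept : ∀ B xs → length (kept B xs) ℕ.≤ length xs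
  length-kept B []       = ℕ.z≤n
  length-kept B (x ∷ xs) with member (kept B xs ++ B) x
  ... | false = ℕ.s≤s (length-kept B xs)
  ... | true  = ℕ.m≤n⇒m≤1+n (length-kept B xs)

module _ (G : Graph) where
  open Graph G using (n; adj; irr; nonempty) renaming (sym to adj-sym)
  open Queries (Fin._≟_ {n})

  edge : Fin n → Fin n → ℕ
  edge x y = if adj x y then 1 else 0

  crossℕ : List (Fin n) → List (Fin n) → ℕ
  crossℕ Y Z = sumL (λ z → sumL (λ y → edge y z) Y) Z

  ι-sumL : ∀ {V : Set} (h : V → ℕ) vs → ι (sumL h vs) ≡ listSum (ι ∘ h) vs
  ι-sumL h []       = refl
  ι-sumL h (v ∷ vs) = trans (ι-+ (h v) _) (cong (ι (h v) ⊕_) (ι-sumL h vs))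

  listSum-cong : ∀ {V : Set} {g h : V → ℚ} → (∀ v → g v ≡ h v) → ∀ vs → listSum g vs ≡ listSum h vs
  listSum-cong g≡h []       = refl
  listSum-cong g≡h (v ∷ vs) = cong₂ _⊕_ (g≡h v) (listSum-cong g≡h vs)

  ι-cross : ∀ Y Z → ι (crossℕ Y Z) ≡ cross G Y Z
  ι-cross Y Z = trans (ι-sumL _ Z) (listSum-cong (λ z → trans (ι-sumL _ Y) (listSum-cong (λ y → ι-edge (adj y z)) Y)) Z)
    where
    ι-edge : ∀ b → ι (if b then 1 else 0) ≡ 𝟙 b
    ι-edge false = refl
    ι-edge true  = refl

  pairSum : List (Fin n) → ℕ
  pairSum []       = 0
  pairSum (x ∷ xs) = sumL (edge x) xs ℕ.+ pairSum xs

  pairSum-++ : ∀ us vs → pairSum (us ++ vs) ≡ crossℕ vs us ℕ.+ (pairSum us ℕ.+ pairSum vs)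
  pairSum-++ []       vs = refl
  pairSum-++ (u ∷ us) vs = trans (cong₂ ℕ._+_ (sumL-++ (edge u) us vs) (pairSum-++ us vs)) (trans
    (cong (λ r → (sumL (edge u) us ℕ.+ r) ℕ.+ (crossℕ vs us ℕ.+ (pairSum us ℕ.+ pairSum vs)))
      (sumL-cong (λ v → cong (if_then 1 else 0) (adj-sym u v)) vs))
    (solveℕ 5 (λ a r c p q → (a ∔ r) ∔ (c ∔ (p ∔ q)) ≐ (r ∔ c) ∔ ((a ∔ p) ∔ q)) refl
      (sumL (edge u) us) (sumL (λ y → edge y u) vs) (crossℕ vs us) (pairSum us) (pairSum vs)))
    where
    open import Data.Nat.Solver using (module +-*-Solver)
    open +-*-Solver using () renaming (solve to solveℕ; _:+_ to _∔_; _:=_ to _≐_)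

  double-pairSum : ∀ S → sumL (λ x → sumL (edge x) S) S ≡ pairSum S ℕ.+ pairSum S
  double-pairSum []      = refl
  double-pairSum (s ∷ S) = trans (cong₂ ℕ._+_ (cong (λ b → (if b then 1 else 0) ℕ.+ sumL (edge s) S) (irr s))
      (trans (sumL-+ (λ x → edge x s) (λ x → sumL (edge x) S) S)
        (cong₂ ℕ._+_ (sumL-cong (λ x → cong (if_then 1 else 0) (adj-sym x s)) S) (double-pairSum S))))
    (trans (sym (ℕ.+-assoc (sumL (edge s) S) _ _)) (+-interchange (sumL (edge s) S) (sumL (edge s) S) (pairSum S) (pairSum S)))

  sumℕ-cong : ∀ k {f g : Fin k → ℕ} → (∀ i → f i ≡ g i) → sumℕFin k f ≡ sumℕFin k g
  sumℕ-cong zero    f≡g = refl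
  sumℕ-cong (suc k) f≡g = cong₂ ℕ._+_ (f≡g Fin.zero) (sumℕ-cong k (f≡g ∘ Fin.suc))

  sumℕ-+ : ∀ k (f g : Fin k → ℕ) → sumℕFin k (λ i → f i ℕ.+ g i) ≡ sumℕFin k f ℕ.+ sumℕFin k g
  sumℕ-+ zero    f g = refl
  sumℕ-+ (suc k) f g = trans (cong (f Fin.zero ℕ.+ g Fin.zero ℕ.+_) (sumℕ-+ k (f ∘ Fin.suc) (g ∘ Fin.suc)))
    (+-interchange (f Fin.zero) (g Fin.zero) _ _)

  sumℕ-0 : ∀ k → sumℕFin k (λ _ → 0) ≡ 0
  sumℕ-0 zero    = refl
  sumℕ-0 (suc k) = sumℕ-0 k

  sumℕ-δ : ∀ k (s : Fin k) (h : Fin k → ℕ) → sumℕFin k (λ x → if ⌊ s Fin.≟ x ⌋ then h x else 0) ≡ h s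
  sumℕ-δ (suc k) Fin.zero    h = trans (cong (h Fin.zero ℕ.+_) (sumℕ-0 k)) (ℕ.+-identityʳ _)
  sumℕ-δ (suc k) (Fin.suc s) h = trans (sumℕ-cong k (λ x → cong (if_then h (Fin.suc x) else 0) (isYes-map (s Fin.≟ x)))) (sumℕ-δ k s (h ∘ Fin.suc))
    where
    isYes-map : ∀ {x} (d : Dec (s ≡ x)) → ⌊ Dec.map′ (cong Fin.suc) Fin.suc-injective d ⌋ ≡ ⌊ d ⌋
    isYes-map (yes _) = refl
    isYes-map (no _)  = refl

  sum-member : ∀ S (h : Fin n → ℕ) → distinct S → sumℕFin n (λ x → if member S x then h x else 0) ≡ sumL h S
  sum-member []      h d       = sumℕ-0 n
  sum-member (s ∷ S) h (f , d) = trans (sumℕ-cong n (λ x → case x))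
    (trans (sumℕ-+ n _ _) (cong₂ ℕ._+_ (sumℕ-δ n s h) (sum-member S h d)))
    where
    case : ∀ x → (if ⌊ s Fin.≟ x ⌋ ∨ member S x then h x else 0) ≡ (if ⌊ s Fin.≟ x ⌋ then h x else 0) ℕ.+ (if member S x then h x else 0)
    case x with s Fin.≟ x
    ... | no _     = refl
    ... | yes refl rewrite f = sym (ℕ.+-identityʳ (h s))

  -- Without duplicates, summing over the members of `S` is summing over its positions. By symmetry
  -- and the zero diagonal the ordered sum is twice `pairSum`, so the halving is exact.
  edgesIn≡pairSum : ∀ S → distinct S → edgesIn G S ≡ pairSum S
  edgesIn≡pairSum S d = trans (cong ℕ.⌊_/2⌋ (trans (sumℕ-cong n (λ x → row (member S x) x))
      (trans (sum-member S (λ x → sumL (edge x) S) d) (double-pairSum S))))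
    (sym (ℕ.n≡⌊n+n/2⌋ (pairSum S)))
    where
    swap-if : ∀ b c → (if b ∧ c then 1 else 0) ≡ (if b then (if c then 1 else 0) else 0)
    swap-if false c = refl
    swap-if true  c = refl
    row : ∀ b x → countFin n (λ y → b ∧ member S y ∧ adj x y) ≡ (if b then sumL (edge x) S else 0)
    row false x = sumℕ-0 n
    row true  x = trans (sumℕ-cong n (λ y → swap-if (member S y) (adj x y))) (sum-member S (edge x) d)

  adjacent-value : ∀ y z f → E (⟦_⟧ G (adjacent y z)) f ≡ f (edge y z)
  -- The query decides `y ≟ z`, whereas distinctness of the two-element list unfolds to `z ≟ y`;
  -- both are therefore decided.
  adjacent-value y z f with z Fin.≟ y | y Fin.≟ z in eq
  ... | _        | yes refl rewrite irr y = refl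
  ... | yes refl | no y≢y   = ⊥-elim (y≢y refl)
  ... | no z≢y   | no _     = cong f (trans (edgesIn≡pairSum (y ∷ z ∷ []) (fresh , (refl , tt)))
    (trans (ℕ.+-identityʳ _) (ℕ.+-identityʳ _)))
    where
    fresh : member (z ∷ []) y ≡ false
    fresh with z Fin.≟ y
    ... | yes z≡y = ⊥-elim (z≢y z≡y)
    ... | no _    = refl

  adjacent-cost : ∀ y z → cost G (adjacent y z) ≤ ι 3
  adjacent-cost y z with y Fin.≟ z
  ... | yes _ = 0≤ι 3
  ... | no _  = ℚ.≤-reflexive (⊕-identityʳ (ι 3))

  columnCount-value : ∀ ys z f → E (⟦_⟧ G (columnCount ys z)) f ≡ f (sumL (λ y → edge y z) ys)
  columnCount-value []       z f = refl
  columnCount-value (y ∷ ys) z f = trans (E->>= G (adjacent y z) _ f) (trans (adjacent-value y z _)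
    (trans (E->>= G (columnCount ys z) _ f) (columnCount-value ys z _)))

  columnCount-cost : ∀ ys z → cost G (columnCount ys z) ≤ ι (length ys) ⊗ ι 3
  columnCount-cost []       z = ℚ.≤-reflexive (sym (⊗-zeroˡ (ι 3)))
  columnCount-cost (y ∷ ys) z = ℚ.≤-trans (ℚ.≤-reflexive (trans (cost->>= G (adjacent y z) _) (cong (cost G (adjacent y z) ⊕_)
      (trans (adjacent-value y z _) (trans (cost->>= G (columnCount ys z) _) (trans (cong (cost G (columnCount ys z) ⊕_) (const (⟦_⟧ G (columnCount ys z)) 0ℚ)) (⊕-identityʳ _)))))))
    (ℚ.≤-trans (⊕-mono-≤ (adjacent-cost y z) (columnCount-cost ys z))
      (ℚ.≤-reflexive (trans (solve 1 (λ l → con (+ 3) :+ l :* con (+ 3) := (con (+ 1) :+ l) :* con (+ 3)) refl (ι (length ys))) (cong (_⊗ ι 3) (sym (ι-suc (length ys)))))))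

  pairwiseCount-value : ∀ ys zs f → E (⟦_⟧ G (pairwiseCount ys zs)) f ≡ f (crossℕ ys zs)
  pairwiseCount-value ys []       f = refl
  pairwiseCount-value ys (z ∷ zs) f = trans (E->>= G (columnCount ys z) _ f) (trans (columnCount-value ys z _)
    (trans (E->>= G (pairwiseCount ys zs) _ f) (pairwiseCount-value ys zs _)))

  pairwiseCount-cost : ∀ ys zs → cost G (pairwiseCount ys zs) ≤ ι (length zs) ⊗ (ι (length ys) ⊗ ι 3)
  pairwiseCount-cost ys []       = ℚ.≤-reflexive (sym (⊗-zeroˡ _))
  pairwiseCount-cost ys (z ∷ zs) = ℚ.≤-trans (ℚ.≤-reflexive (trans (cost->>= G (columnCount ys z) _) (cong (cost G (columnCount ys z) ⊕_)
      (trans (columnCount-value ys z _) (trans (cost->>= G (pairwiseCount ys zs) _) (trans (cong (cost G (pairwiseCount ys zs) ⊕_) (const (⟦_⟧ G (pairwiseCount ys zs)) 0ℚ)) (⊕-identityʳ _)))))))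
    (ℚ.≤-trans (⊕-mono-≤ (columnCount-cost ys z) (pairwiseCount-cost ys zs))
      (ℚ.≤-reflexive (trans (solve 2 (λ c l → c :+ l :* c := (con (+ 1) :+ l) :* c) refl (ι (length ys) ⊗ ι 3) (ι (length zs))) (cong (_⊗ (ι (length ys) ⊗ ι 3)) (sym (ι-suc (length zs)))))))

  crossℕ-splitʳ : ∀ Y B Z → crossℕ Y Z ≡ crossℕ Y (kept B Z) ℕ.+ crossℕ Y (repeats B Z)
  crossℕ-splitʳ Y B Z = sumL-split _ B Z

  crossℕ-splitˡ : ∀ Y B Z → crossℕ Y Z ≡ crossℕ (kept B Y) Z ℕ.+ crossℕ (repeats B Y) Z
  crossℕ-splitˡ Y B Z = trans (sumL-cong (λ z → sumL-split (λ y → edge y z) B Y) Z) (sumL-+ _ _ Z)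

  -- The position pairs of Y × Z split into Y × repeats of Z, repeats of Y × `KZ`, and `KY` × `KZ`.
  -- For the last, disjoint and duplicate-free, the count is e(KZ ∪ KY) - e(KZ) - e(KY).
  crossQuery-value : ∀ Y Z f → E (⟦_⟧ G (crossQuery Y Z)) f ≡ f (crossℕ Y Z)
  crossQuery-value Y Z f = trans (E->>= G (pairwiseCount Y (repeats KY Z)) _ f) (trans (pairwiseCount-value Y (repeats KY Z) _)
    (trans (E->>= G (pairwiseCount (repeats [] Y) KZ) _ f) (trans (pairwiseCount-value (repeats [] Y) KZ _) (cong f value))))
    where
    KY = kept [] Y
    KZ = kept KY Z
    dKY : distinct KY
    dKY = distinct-prefix KY [] (distinct-kept [] Y tt)
    dKZKY : distinct (KZ ++ KY)
    dKZKY = distinct-kept KY Z dKY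
    additive-value : edgesIn G (KZ ++ KY) ℕ.∸ (edgesIn G KZ ℕ.+ edgesIn G KY) ≡ crossℕ KY KZ
    additive-value = trans (cong₂ ℕ._∸_ (trans (edgesIn≡pairSum (KZ ++ KY) dKZKY) (pairSum-++ KZ KY))
      (cong₂ ℕ._+_ (edgesIn≡pairSum KZ (distinct-prefix KZ KY dKZKY)) (edgesIn≡pairSum KY dKY)))
      (ℕ.m+n∸n≡m (crossℕ KY KZ) (pairSum KZ ℕ.+ pairSum KY))
    value : crossℕ Y (repeats KY Z) ℕ.+ (crossℕ (repeats [] Y) KZ ℕ.+ (edgesIn G (KZ ++ KY) ℕ.∸ (edgesIn G KZ ℕ.+ edgesIn G KY))) ≡ crossℕ Y Z
    value = trans (cong (λ e → crossℕ Y (repeats KY Z) ℕ.+ (crossℕ (repeats [] Y) KZ ℕ.+ e)) additive-value)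
      (trans (cong (crossℕ Y (repeats KY Z) ℕ.+_) (trans (ℕ.+-comm (crossℕ (repeats [] Y) KZ) _) (sym (crossℕ-splitˡ Y [] KZ))))
      (trans (ℕ.+-comm (crossℕ Y (repeats KY Z)) _) (sym (crossℕ-splitʳ Y KY Z))))

module _ (G : Graph) where
  open Graph G using (n; adj; nonempty)
  open Queries (Fin._≟_ {n})

  crossQuery-cost : ∀ Y Z k → length Y ℕ.≤ k → length Z ℕ.≤ k →
    cost G (crossQuery Y Z) ≤ ι 3 ⊗ ι k ⊗ (ι (length (repeats (kept [] Y) Z)) ⊕ ι (length (repeats [] Y))) ⊕ (ι 3 ⊕ ι 4 ⊗ ι k)
  crossQuery-cost Y Z k Y≤k Z≤k = begin
    cost G (crossQuery Y Z)
      ≡⟨ trans (cost->>= G (pairwiseCount Y (repeats KY Z)) _) (cong₂ _⊕_ refl (trans (pairwiseCount-value G Y (repeats KY Z) _)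
           (trans (cost->>= G (pairwiseCount (repeats [] Y) KZ) _) (cong₂ _⊕_ refl (pairwiseCount-value G (repeats [] Y) KZ _))))) ⟩
    cost G (pairwiseCount Y (repeats KY Z)) ⊕ (cost G (pairwiseCount (repeats [] Y) KZ)
      ⊕ (ι (suc (length (KZ ++ KY))) ⊕ (ι (suc (length KZ)) ⊕ (ι (suc (length KY)) ⊕ 0ℚ))))
      ≤⟨ ⊕-mono-≤ (pairwiseCount-cost G Y (repeats KY Z)) (⊕-mono-≤ (pairwiseCount-cost G (repeats [] Y) KZ) (ℚ.≤-reflexive sizes)) ⟩
    ι (length (repeats KY Z)) ⊗ (ι (length Y) ⊗ ι 3) ⊕ (z ⊗ (ι (length (repeats [] Y)) ⊗ ι 3)
      ⊕ (ι 3 ⊕ ι 2 ⊗ (z ⊕ y)))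
      ≤⟨ ⊕-mono-≤ (⊗-monoʳ-≤ (0≤ι _) (⊗-monoˡ-≤ (0≤ι 3) (ι-mono Y≤k))) (⊕-mono-≤ (⊗-monoˡ-≤ (0≤⊗ (0≤ι _) (0≤ι 3)) z≤k)
           (⊕-mono-≤ (ℚ.≤-refl {ι 3}) (⊗-monoʳ-≤ (0≤ι 2) (⊕-mono-≤ z≤k y≤k)))) ⟩
    ι (length (repeats KY Z)) ⊗ (ι k ⊗ ι 3) ⊕ (ι k ⊗ (ι (length (repeats [] Y)) ⊗ ι 3) ⊕ (ι 3 ⊕ ι 2 ⊗ (ι k ⊕ ι k)))
      ≡⟨ solve 3 (λ a k b → a :* (k :* con (+ 3)) :+ (k :* (b :* con (+ 3)) :+ (con (+ 3) :+ con (+ 2) :* (k :+ k))) :=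
           con (+ 3) :* k :* (a :+ b) :+ (con (+ 3) :+ con (+ 4) :* k)) refl (ι (length (repeats KY Z))) (ι k) (ι (length (repeats [] Y))) ⟩
    ι 3 ⊗ ι k ⊗ (ι (length (repeats KY Z)) ⊕ ι (length (repeats [] Y))) ⊕ (ι 3 ⊕ ι 4 ⊗ ι k) ∎
    where
    open ℚ.≤-Reasoning
    KY = kept [] Y
    KZ = kept KY Z
    y = ι (length KY)
    z = ι (length KZ)
    y≤k : y ≤ ι k
    y≤k = ι-mono (ℕ.≤-trans (length-kept [] Y) Y≤k)
    z≤k : z ≤ ι k
    z≤k = ι-mono (ℕ.≤-trans (length-kept KY Z) Z≤k)
    sizes : ι (suc (length (KZ ++ KY))) ⊕ (ι (suc (length KZ)) ⊕ (ι (suc (length KY)) ⊕ 0ℚ)) ≡ ι 3 ⊕ ι 2 ⊗ (z ⊕ y)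
    sizes = trans (cong₂ _⊕_ (trans (cong (ι ∘ suc) (List.length-++ KZ)) (trans (ι-suc (length KZ ℕ.+ length KY)) (cong (1ℚ ⊕_) (ι-+ (length KZ) (length KY)))))
        (cong₂ (λ a b → a ⊕ (b ⊕ 0ℚ)) (ι-suc (length KZ)) (ι-suc (length KY))))
      (solve 2 (λ z y → (con (+ 1) :+ (z :+ y)) :+ ((con (+ 1) :+ z) :+ ((con (+ 1) :+ y) :+ con (+ 0))) := con (+ 3) :+ con (+ 2) :* (z :+ y)) refl z y)

  𝟙-∨ : ∀ b c → 𝟙 (b ∨ c) ≤ 𝟙 b ⊕ 𝟙 c
  𝟙-∨ false c = ℚ.≤-reflexive (sym (⊕-identityˡ (𝟙 c)))
  𝟙-∨ true  c = ≤-cert (𝟙 c) (0≤𝟙 c) refl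

  member-prob : ∀ L → E (vertex G) (λ v → 𝟙 (member L v)) ≤ ι (length L) ⊗ inv n
  member-prob []      = ℚ.≤-reflexive (trans (const (vertex G) 0ℚ) (sym (⊗-zeroˡ (inv n))))
  member-prob (s ∷ L) = begin
    E (vertex G) (λ v → 𝟙 (⌊ s Fin.≟ v ⌋ ∨ member L v))
      ≤⟨ mono (vertex G) (λ v → 𝟙-∨ ⌊ s Fin.≟ v ⌋ (member L v)) ⟩
    E (vertex G) (λ v → 𝟙 ⌊ s Fin.≟ v ⌋ ⊕ 𝟙 (member L v))
      ≡⟨ trans (add (vertex G) _ _) (cong₂ _⊕_ (trans (E-vertex G _) (cong (inv n ⊗_)
           (trans (sym (count≡∑𝟙 n (λ v → ⌊ s Fin.≟ v ⌋))) (cong ι (sumℕ-δ G n s (λ _ → 1)))))) refl) ⟩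
    inv n ⊗ ι 1 ⊕ E (vertex G) (λ v → 𝟙 (member L v))
      ≤⟨ ⊕-mono-≤ (ℚ.≤-refl {inv n ⊗ ι 1}) (member-prob L) ⟩
    inv n ⊗ ι 1 ⊕ ι (length L) ⊗ inv n
      ≡⟨ trans (solve 2 (λ i l → i :* con (+ 1) :+ l :* i := (con (+ 1) :+ l) :* i) refl (inv n) (ι (length L))) (cong (_⊗ inv n) (sym (ι-suc (length L)))) ⟩
    ι (suc (length L)) ⊗ inv n ∎
    where open ℚ.≤-Reasoning

  module _ (θ : ℕ) where

    private
      module R = Repeat G {κ = additives} (flagged {Fin n} θ) keep []

      σ : ℕ → Mean (List (Fin n))
      σ k = ⟦_⟧ G (sampleLight {κ = additives} θ k)

      length-keep : ∀ k a (vs : List (Fin n)) → length vs ℕ.≤ k → length (keep a vs) ℕ.≤ suc k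
      length-keep k (v , false) vs le = ℕ.m≤n⇒m≤1+n le
      length-keep k (v , true)  vs le = ℕ.s≤s le

    sample-mono : ∀ k {f g : List (Fin n) → ℚ} → (∀ vs → length vs ℕ.≤ k → f vs ≤ g vs) → E (σ k) f ≤ E (σ k) g
    sample-mono = R.repeat-mono (λ _ → ⊤) (λ f≤g → mono (⟦_⟧ G (flagged {κ = additives} θ)) (λ a → f≤g a tt)) (λ k vs → length vs ℕ.≤ k) ℕ.z≤n (λ k a vs _ → length-keep k a vs)

    repeats-mean : ∀ {k b} B → length B ℕ.≤ b → ∀ j → j ℕ.≤ k →
      E (σ j) (λ vs → ι (length (repeats B vs))) ≤ ι j ⊗ (ι (k ℕ.+ b) ⊗ inv n)
    repeats-mean {k} {b} B B≤b zero    j≤k = ℚ.≤-reflexive (sym (⊗-zeroˡ _))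
    repeats-mean {k} {b} B B≤b (suc j) j<k = begin
      E (σ (suc j)) (λ vs → ι (length (repeats B vs)))
        ≡⟨ R.E-suc j _ ⟩
      E (σ j) (λ vs → E (vertex G) (λ v → ι (length (repeats B (keep (v , (deg G v ℕ.≤ᵇ θ)) vs)))))
        ≤⟨ sample-mono j (λ vs vs≤j → ℚ.≤-trans (mono (vertex G) (λ v → new v (deg G v ℕ.≤ᵇ θ) vs))
             (ℚ.≤-trans (ℚ.≤-reflexive (shift (vertex G) _ _)) (⊕-mono-≤ (ℚ.≤-refl {ι (length (repeats B vs))})
               (ℚ.≤-trans (member-prob (kept B vs ++ B)) (⊗-monoˡ-≤ (0≤inv n) (ι-mono (size vs vs≤j))))))) ⟩
      E (σ j) (λ vs → ι (length (repeats B vs)) ⊕ u)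
        ≡⟨ trans (add (σ j) _ _) (cong₂ _⊕_ refl (const (σ j) u)) ⟩
      E (σ j) (λ vs → ι (length (repeats B vs))) ⊕ u
        ≤⟨ ⊕-mono-≤ (repeats-mean B B≤b j (ℕ.<⇒≤ j<k)) (ℚ.≤-refl {u}) ⟩
      ι j ⊗ u ⊕ u
        ≡⟨ trans (solve 2 (λ j u → j :* u :+ u := (con (+ 1) :+ j) :* u) refl (ι j) u) (cong (_⊗ u) (sym (ι-suc j))) ⟩
      ι (suc j) ⊗ u ∎
      where
      open ℚ.≤-Reasoning
      u = ι (k ℕ.+ b) ⊗ inv n
      size : ∀ vs → length vs ℕ.≤ j → length (kept B vs ++ B) ℕ.≤ k ℕ.+ b
      size vs vs≤j = ℕ.≤-trans (ℕ.≤-reflexive (List.length-++ (kept B vs)))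
        (ℕ.+-mono-≤ (ℕ.≤-trans (length-kept B vs) (ℕ.≤-trans vs≤j (ℕ.<⇒≤ j<k))) B≤b)
      new : ∀ v l vs → ι (length (repeats B (keep (v , l) vs))) ≤ ι (length (repeats B vs)) ⊕ 𝟙 (member (kept B vs ++ B) v)
      new v false vs = ≤-cert (𝟙 (member (kept B vs ++ B) v)) (0≤𝟙 (member (kept B vs ++ B) v)) refl
      new v true  vs with member (kept B vs ++ B) v
      ... | false = ℚ.≤-reflexive (sym (⊕-identityʳ _))
      ... | true  = ℚ.≤-reflexive (trans (ι-suc (length (repeats B vs))) (⊕-comm 1ℚ _))

    batch-value : ∀ k f → E (⟦_⟧ G (batch θ k)) f ≡ E (σ k) (λ Y → E (σ k) (λ Z → f (crossℕ G Y Z)))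
    batch-value k f = trans (E->>= G (sampleLight θ k) _ f) (E-cong (σ k) (λ Y →
      trans (E->>= G (sampleLight θ k) (crossQuery Y) f) (E-cong (σ k) (λ Z → crossQuery-value G Y Z f))))

    sample-cost : ∀ k → cost G (sampleLight {κ = additives} θ k) ≡ ι 2 ⊗ ι k
    sample-cost k = trans (R.repeat-cost k) (trans (cong (ι k ⊗_) (trans (cong (1ℚ ⊕_) (const (vertex G) (1ℚ ⊕ 0ℚ)))
      (solve 0 (con (+ 1) :+ (con (+ 1) :+ con (+ 0)) := con (+ 2)) refl))) (⊗-comm (ι k) (ι 2)))

    -- A draw hits an earlier vertex with probability at most k/n in the first sample and 2k/n in
    -- the second. That gives at most 3k²/n repeats on average, each checked against at most k
    -- vertices at cost 3; hence the term 9k³/n.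
    batch-cost : ∀ k → cost G (batch θ k) ≤ ι 3 ⊕ ι 8 ⊗ ι k ⊕ ι 9 ⊗ (ι k ⊗ ι k ⊗ ι k ⊗ inv n)
    batch-cost k = begin
      cost G (batch θ k)
        ≡⟨ trans (cost->>= G (sampleLight θ k) _) (cong₂ _⊕_ (sample-cost k) (E-cong (σ k) (λ Y →
             trans (cost->>= G (sampleLight θ k) (crossQuery Y)) (cong₂ _⊕_ (sample-cost k) refl)))) ⟩
      ι 2 ⊗ K ⊕ E (σ k) (λ Y → ι 2 ⊗ K ⊕ E (σ k) (λ Z → cost G (crossQuery Y Z)))
        ≡⟨ cong (ι 2 ⊗ K ⊕_) (shift (σ k) _ _) ⟩
      ι 2 ⊗ K ⊕ (ι 2 ⊗ K ⊕ E (σ k) (λ Y → E (σ k) (λ Z → cost G (crossQuery Y Z))))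
        ≤⟨ ⊕-mono-≤ ℚ.≤-refl (⊕-mono-≤ ℚ.≤-refl (sample-mono k (λ Y Y≤k → inner Y Y≤k))) ⟩
      ι 2 ⊗ K ⊕ (ι 2 ⊗ K ⊕ E (σ k) (λ Y → (ι 3 ⊕ ι 4 ⊗ K ⊕ ι 3 ⊗ K ⊗ (K ⊗ u)) ⊕ ι 3 ⊗ K ⊗ ι (length (repeats [] Y))))
        ≡⟨ cong (λ z → ι 2 ⊗ K ⊕ (ι 2 ⊗ K ⊕ z)) (trans (shift (σ k) _ _) (cong ((ι 3 ⊕ ι 4 ⊗ K ⊕ ι 3 ⊗ K ⊗ (K ⊗ u)) ⊕_) (scale (σ k) (ι 3 ⊗ K) _))) ⟩
      ι 2 ⊗ K ⊕ (ι 2 ⊗ K ⊕ ((ι 3 ⊕ ι 4 ⊗ K ⊕ ι 3 ⊗ K ⊗ (K ⊗ u)) ⊕ ι 3 ⊗ K ⊗ E (σ k) (λ Y → ι (length (repeats [] Y)))))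
        ≤⟨ ⊕-mono-≤ ℚ.≤-refl (⊕-mono-≤ ℚ.≤-refl (⊕-mono-≤ ℚ.≤-refl (⊗-monoʳ-≤ (0≤⊗ (0≤ι 3) (0≤ι k)) (repeats-mean {k} {0} [] ℕ.z≤n k ℕ.≤-refl)))) ⟩
      ι 2 ⊗ K ⊕ (ι 2 ⊗ K ⊕ ((ι 3 ⊕ ι 4 ⊗ K ⊕ ι 3 ⊗ K ⊗ (K ⊗ u)) ⊕ ι 3 ⊗ K ⊗ (K ⊗ (ι (k ℕ.+ 0) ⊗ inv n))))
        ≡⟨ trans (cong₂ (λ x y → ι 2 ⊗ K ⊕ (ι 2 ⊗ K ⊕ ((ι 3 ⊕ ι 4 ⊗ K ⊕ ι 3 ⊗ K ⊗ (K ⊗ (x ⊗ inv n))) ⊕ ι 3 ⊗ K ⊗ (K ⊗ (y ⊗ inv n))))) (ι-+ k k) (cong ι (ℕ.+-identityʳ k)))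
             (solve 2 (λ k i → con (+ 2) :* k :+ (con (+ 2) :* k :+ ((con (+ 3) :+ con (+ 4) :* k :+ con (+ 3) :* k :* (k :* ((k :+ k) :* i))) :+ con (+ 3) :* k :* (k :* (k :* i))))
                := con (+ 3) :+ con (+ 8) :* k :+ con (+ 9) :* (k :* k :* k :* i)) refl K (inv n)) ⟩
      ι 3 ⊕ ι 8 ⊗ K ⊕ ι 9 ⊗ (K ⊗ K ⊗ K ⊗ inv n) ∎
      where
      open ℚ.≤-Reasoning
      K = ι k
      u = ι (k ℕ.+ k) ⊗ inv n
      inner : ∀ Y → length Y ℕ.≤ k → E (σ k) (λ Z → cost G (crossQuery Y Z)) ≤ (ι 3 ⊕ ι 4 ⊗ K ⊕ ι 3 ⊗ K ⊗ (K ⊗ u)) ⊕ ι 3 ⊗ K ⊗ ι (length (repeats [] Y))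
      inner Y Y≤k = begin
        E (σ k) (λ Z → cost G (crossQuery Y Z))
          ≤⟨ sample-mono k (λ Z Z≤k → crossQuery-cost Y Z k Y≤k Z≤k) ⟩
        E (σ k) (λ Z → ι 3 ⊗ K ⊗ (ι (length (repeats (kept [] Y) Z)) ⊕ y) ⊕ (ι 3 ⊕ ι 4 ⊗ K))
          ≡⟨ trans (add (σ k) _ _) (cong₂ _⊕_ (trans (scale (σ k) (ι 3 ⊗ K) _) (cong (ι 3 ⊗ K ⊗_) (trans (add (σ k) _ _) (cong₂ _⊕_ refl (const (σ k) y))))) (const (σ k) _)) ⟩
        ι 3 ⊗ K ⊗ (E (σ k) (λ Z → ι (length (repeats (kept [] Y) Z))) ⊕ y) ⊕ (ι 3 ⊕ ι 4 ⊗ K)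
          ≤⟨ ⊕-mono-≤ (⊗-monoʳ-≤ (0≤⊗ (0≤ι 3) (0≤ι k)) (⊕-mono-≤ (repeats-mean (kept [] Y) (ℕ.≤-trans (length-kept [] Y) Y≤k) k ℕ.≤-refl) ℚ.≤-refl)) ℚ.≤-refl ⟩
        ι 3 ⊗ K ⊗ (K ⊗ u ⊕ y) ⊕ (ι 3 ⊕ ι 4 ⊗ K)
          ≡⟨ solve 3 (λ k u y → con (+ 3) :* k :* (k :* u :+ y) :+ (con (+ 3) :+ con (+ 4) :* k)
               := (con (+ 3) :+ con (+ 4) :* k :+ con (+ 3) :* k :* (k :* u)) :+ con (+ 3) :* k :* y) refl K u y ⟩
        (ι 3 ⊕ ι 4 ⊗ K ⊕ ι 3 ⊗ K ⊗ (K ⊗ u)) ⊕ ι 3 ⊗ K ⊗ y ∎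
        where y = ι (length (repeats [] Y))

-- The heaviest of many random neighbours

neighbourDegree : ∀ {V κ} → Prog V (V × ℕ) κ
neighbourDegree = randVert (λ x → randNbr x (λ y → degree y (λ d → ret (y , d))))

larger : {V : Set} → V × ℕ → V × ℕ → V × ℕ
larger a s = if proj₂ a ℕ.≤ᵇ proj₂ s then s else a

-- The first draw supplies the initial champion, so there are R + 1 draws.
champion : ∀ {V κ} → ℕ → Prog V (V × ℕ) κ
champion R = neighbourDegree >>= λ s → repeat neighbourDegree larger s R

module _ (G : Graph) where
  open Graph G using (n; adj; nonempty) renaming (sym to adj-sym)

  private
    module R s = Repeat G {κ = additives} neighbourDegree larger s

    nbr : Mean (Fin n × ℕ)
    nbr = ⟦_⟧ G (neighbourDegree {Fin n} {additives})

    κ : ℕ → Mean (Fin n × ℕ)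
    κ R = ⟦_⟧ G (champion {Fin n} {additives} R)

  E-champion : ∀ R f → E (κ R) f ≡ E nbr (λ s → E (⟦_⟧ G (repeat {κ = additives} neighbourDegree larger s R)) f)
  E-champion R f = E->>= G (neighbourDegree {κ = additives}) (λ s → repeat neighbourDegree larger s R) f

  neighbourDegree-cost : cost G (neighbourDegree {Fin n} {additives}) ≡ ι 3
  neighbourDegree-cost = trans (cong (1ℚ ⊕_) (trans (E-cong (vertex G) (λ x → cong (1ℚ ⊕_) (const (neighbour G x) (1ℚ ⊕ 0ℚ)))) (const (vertex G) _)))
    (solve 0 (con (+ 1) :+ (con (+ 1) :+ (con (+ 1) :+ con (+ 0))) := con (+ 3)) refl)

  champion-cost : ∀ R → cost G (champion {Fin n} {additives} R) ≡ ι 3 ⊕ ι 3 ⊗ ι R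
  champion-cost R = trans (cost->>= G (neighbourDegree {κ = additives}) (λ s → repeat neighbourDegree larger s R)) (cong₂ _⊕_ neighbourDegree-cost
    (trans (E-cong nbr (λ s → trans (R.repeat-cost s R) (trans (cong (ι R ⊗_) neighbourDegree-cost) (⊗-comm (ι R) (ι 3))))) (const nbr _)))

  -- The champion carries its own degree, so only pairs (y , deg y) occur.
  champion-mono : ∀ R {f g : Fin n × ℕ → ℚ} → (∀ y → f (y , deg G y) ≤ g (y , deg G y)) → E (κ R) f ≤ E (κ R) g
  champion-mono R {f} {g} f≤g = subst₂ _≤_ (sym (E-champion R f)) (sym (E-champion R g))
    (support (λ s Qs → R.repeat-mono s Q support (λ _ → Q) Qs (λ _ → Q-larger) R (λ { (y , d) refl → f≤g y })))
    where
    Q : Fin n × ℕ → Set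
    Q (y , d) = d ≡ deg G y
    support : ∀ {f g : Fin n × ℕ → ℚ} → (∀ a → Q a → f a ≤ g a) → E nbr f ≤ E nbr g
    support f≤g = mono (vertex G) (λ x → mono (neighbour G x) (λ y → f≤g (y , deg G y) refl))
    Q-larger : ∀ a s → Q a → Q s → Q (larger a s)
    Q-larger a s Qa Qs with proj₂ a ℕ.≤ᵇ proj₂ s
    ... | true  = Qs
    ... | false = Qa

  tail : ℕ → ℚ
  tail t = E (vertex G) (λ x → E (neighbour G x) (λ y → 𝟙 (not (deg G y ℕ.≤ᵇ t))))

  tail-antitone : ∀ {s t} → s ℕ.≤ t → tail t ≤ tail s
  tail-antitone {s} {t} s≤t = mono (vertex G) (λ x → mono (neighbour G x) (λ y → step (deg G y)))
    where
    step : ∀ d → 𝟙 (not (d ℕ.≤ᵇ t)) ≤ 𝟙 (not (d ℕ.≤ᵇ s))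
    step d with d ℕ.≤ᵇ t in d≤t | d ℕ.≤ᵇ s in d≤s
    ... | true  | b     = 0≤𝟙 (not b)
    ... | false | false = ℚ.≤-refl
    ... | false | true  = ⊥-elim (subst T d≤t (ℕ.≤⇒≤ᵇ (ℕ.≤-trans (ℕ.≤ᵇ⇒≤ d s (subst T (sym d≤s) tt)) s≤t)))

  tail-n : tail n ≤ 0ℚ
  tail-n = E≤ (vertex G) (λ x → E≤ (neighbour G x) (λ y → ℚ.≤-reflexive (cong (𝟙 ∘ not) (T⇒≡true (ℕ.≤⇒≤ᵇ (deg≤n G y))))))
    where
    T⇒≡true : ∀ {b} → T b → b ≡ true
    T⇒≡true {true} _ = refl

  module Tail (γ : ℚ) (0≤γ : 0ℚ ≤ γ) where

    frequent : ℕ → Bool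
    frequent t = not (tail t ℚ.≤ᵇ γ)

    frequent⇒ : ∀ t → frequent t ≡ true → γ ≤ tail t
    frequent⇒ t eq with tail t ℚ.≤ᵇ γ in le
    ... | false = ≰ᵇ⇒≥ (tail t) γ le

    infrequent⇒ : ∀ t → frequent t ≡ false → tail t ≤ γ
    infrequent⇒ t eq with tail t ℚ.≤ᵇ γ in le
    ... | true = ℚ.≤ᵇ⇒≤ (subst T (sym le) tt)

    infrequent⇐ : ∀ t → tail t ≤ γ → frequent t ≡ false
    infrequent⇐ t le with tail t ℚ.≤ᵇ γ | ℚ.≤⇒≤ᵇ le
    ... | true | _ = refl

    infrequent-mono : ∀ {s t} → s ℕ.≤ t → frequent s ≡ false → frequent t ≡ false
    infrequent-mono {s} {t} s≤t eq = infrequent⇐ t (ℚ.≤-trans (tail-antitone s≤t) (infrequent⇒ s eq))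

    -- `frequent` is downward closed and fails at n, so a search down from n finds the last frequent
    -- level, if there is any.
    threshold : frequent 0 ≡ false ⊎ ∃ λ t → frequent t ≡ true × frequent (suc t) ≡ false
    threshold = search n (infrequent⇐ n (ℚ.≤-trans tail-n 0≤γ))
      where
      search : ∀ t → frequent t ≡ false → frequent 0 ≡ false ⊎ ∃ λ t → frequent t ≡ true × frequent (suc t) ≡ false
      search zero    eq = inj₁ eq
      search (suc t) eq with frequent t in eq′
      ... | true  = inj₂ (t , eq′ , eq)
      ... | false = search t eq′

    -- A draw of degree d is bad if (vertex, neighbour) pairs still exceed degree d with probability
    -- above γ: discarding the vertices above d would then lose too many edges.
    bad : Fin n × ℕ → ℚ
    bad a = 𝟙 (frequent (proj₂ a))

    frequency : ℚ
    frequency = E nbr bad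

    frequency≤ : ∀ t → frequent (suc t) ≡ false → frequency ≤ 1ℚ ⊝ tail t
    frequency≤ t infreq = ℚ.≤-trans (mono nbr {bad} {λ a → 1ℚ ⊝ 𝟙 (not (proj₂ a ℕ.≤ᵇ t))} (λ a → below (proj₂ a)))
      (ℚ.≤-reflexive (E-complement nbr (λ a → 𝟙 (not (proj₂ a ℕ.≤ᵇ t)))))
      where
      below : ∀ d → 𝟙 (frequent d) ≤ 1ℚ ⊝ 𝟙 (not (d ℕ.≤ᵇ t))
      below d with d ℕ.≤ᵇ t in d≤t
      ... | true  = ℚ.≤-trans (𝟙≤1 (frequent d)) (ℚ.≤-reflexive (solve 0 (con (+ 1) := con (+ 1) :- con (+ 0)) refl))
      ... | false = ℚ.≤-reflexive (trans (cong 𝟙 (infrequent-mono (ℕ.≰⇒> (λ le → subst T d≤t (ℕ.≤⇒≤ᵇ le))) infreq))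
        (solve 0 (con (+ 0) := con (+ 1) :- con (+ 1)) refl))

    -- If t is the last frequent level, a bad draw has degree at most t, which has probability 1 -
    -- `tail t` ≤ 1 - γ ≤ 1/(1 + γ).
    frequent-rare : frequency ⊗ (1ℚ ⊕ γ) ≤ 1ℚ
    frequent-rare = [ never , sometimes ]′ threshold
      where
      0≤1+γ : 0ℚ ≤ 1ℚ ⊕ γ
      0≤1+γ = 0≤⊕ 0≤1 0≤γ
      never : frequent 0 ≡ false → frequency ⊗ (1ℚ ⊕ γ) ≤ 1ℚ
      never none = ℚ.≤-trans (⊗-monoˡ-≤ 0≤1+γ (E≤ nbr {bad} (λ a → ℚ.≤-reflexive (cong 𝟙 (infrequent-mono ℕ.z≤n none)))))
        (ℚ.≤-trans (ℚ.≤-reflexive (⊗-zeroˡ (1ℚ ⊕ γ))) 0≤1)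
      sometimes : ∃ (λ t → frequent t ≡ true × frequent (suc t) ≡ false) → frequency ⊗ (1ℚ ⊕ γ) ≤ 1ℚ
      sometimes (t , freq , infreq) = ℚ.≤-trans (⊗-monoˡ-≤ 0≤1+γ (frequency≤ t infreq))
        (≤-cert (γ ⊗ γ ⊕ (tail t ⊝ γ) ⊗ (1ℚ ⊕ γ)) (0≤⊕ (0≤sq γ) (0≤⊗ (gap (frequent⇒ t freq)) 0≤1+γ))
          (solve 2 (λ p γ → con (+ 1) := (con (+ 1) :- p) :* (con (+ 1) :+ γ) :+ (γ :* γ :+ (p :- γ) :* (con (+ 1) :+ γ))) refl (tail t) γ))

    implied : ∀ {s t} → s ℕ.≤ t → 𝟙 (frequent t) ≤ 𝟙 (frequent s) ⊗ 𝟙 (frequent t)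
    implied {s} {t} s≤t = go (frequent s) (frequent t) (infrequent-mono s≤t)
      where
      go : ∀ b c → (b ≡ false → c ≡ false) → 𝟙 c ≤ 𝟙 b ⊗ 𝟙 c
      go true  c     _ = ℚ.≤-reflexive (sym (⊗-identityˡ (𝟙 c)))
      go false false _ = ℚ.≤-reflexive (sym (⊗-zeroˡ 0ℚ))
      go false true  h with () ← h refl

    -- Frequency of the larger degree implies that of the smaller. The champion is thus bad only if
    -- all draws are, as `repeat-miss` requires.
    larger-bad : ∀ a s → bad (larger a s) ≤ bad s ⊗ bad a
    larger-bad (u , d) (v , e) with d ℕ.≤ᵇ e in d≤e
    ... | true  = ℚ.≤-trans (implied (ℕ.≤ᵇ⇒≤ d e (subst T (sym d≤e) tt))) (ℚ.≤-reflexive (⊗-comm (𝟙 (frequent d)) (𝟙 (frequent e))))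
    ... | false = implied (ℕ.<⇒≤ (ℕ.≰⇒> (λ le → subst T d≤e (ℕ.≤⇒≤ᵇ le))))

    champion-bad-from : ∀ R s → (1ℚ ⊕ ι R ⊗ γ) ⊗ E (⟦_⟧ G (repeat {κ = additives} neighbourDegree larger s R)) bad ≤ 1ℚ
    champion-bad-from R s = R.repeat-miss s bad bad 0≤γ (λ s → 0≤𝟙 (frequent (proj₂ s))) (𝟙≤1 (frequent (proj₂ s))) larger-bad frequent-rare R

    champion-frequent : ∀ R → (1ℚ ⊕ ι R ⊗ γ) ⊗ E (κ R) bad ≤ 1ℚ
    champion-frequent R = subst (_≤ 1ℚ) (trans (scale nbr (1ℚ ⊕ ι R ⊗ γ) after) (cong ((1ℚ ⊕ ι R ⊗ γ) ⊗_) (sym (E-champion R bad))))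
      (E≤ nbr {λ s → (1ℚ ⊕ ι R ⊗ γ) ⊗ after s} (champion-bad-from R))
      where
      after : Fin n × ℕ → ℚ
      after s = E (⟦_⟧ G (repeat {κ = additives} neighbourDegree larger s R)) bad

  lightProb≤edgeProb : ∀ θ → Light.lightProb G θ ≤ edgeProb G
  lightProb≤edgeProb θ = subst (Light.lightProb G θ ≤_) (E-adj G) (mono (vertex G) (λ y →
    ℚ.≤-trans (⊗-monoˡ-≤ (Light.0≤lightNbrs G θ y) (𝟙≤1 (Light.light G θ y))) (ℚ.≤-trans (ℚ.≤-reflexive (⊗-identityˡ _))
      (mono (vertex G) (λ z → ℚ.≤-trans (⊗-monoˡ-≤ (0≤𝟙 (adj y z)) (𝟙≤1 (Light.light G θ z))) (ℚ.≤-reflexive (⊗-identityˡ _)))))))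

  E-deg : E (vertex G) (λ x → ι (deg G x)) ≡ ι n ⊗ edgeProb G
  E-deg = trans (E-vertex G _) (trans (cong (inv n ⊗_) (sym (ι-∑ n (deg G)))) (sym (trans (sym (⊗-assoc (ι n) (inv n) _))
    (trans (cong₂ _⊗_ (trans (⊗-comm (ι n) (inv n)) (inv⊗ nonempty)) refl) (⊗-identityˡ _)))))

  -- `s` is the degree cutoff, in the role of √(nd), and `τ` stands for 1/s; an inequality between
  -- them suffices and leaves room for factors of ε. An edge with a heavy endpoint is charged to a
  -- (vertex, neighbour) draw if one of its ends has degree at most s, and to the product of both
  -- degrees otherwise.
  module Bias (θ : ℕ) (s τ : ℚ) (0≤s : 0ℚ ≤ s) (0≤τ : 0ℚ ≤ τ) (1≤sτ : 1ℚ ≤ s ⊗ τ) where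
    open Light G θ

    heavy : Fin n → ℚ
    heavy v = 𝟙 (not (light v))

    private
      0≤share : ∀ d → 0ℚ ≤ s ⊗ inv d
      0≤share d = 0≤⊗ 0≤s (0≤inv d)

      1≤share : ∀ d → 0 ℕ.< d → ι d ≤ s → 1ℚ ≤ s ⊗ inv d
      1≤share d 0<d d≤s = subst (_≤ s ⊗ inv d) (trans (⊗-comm (ι d) (inv d)) (inv⊗ 0<d)) (⊗-monoˡ-≤ (0≤inv d) d≤s)

    -- Either an endpoint has degree at most s (if it is only the heavy one, the other is heavy as well), or both exceed s.
    charge : ∀ d e → 0 ℕ.< d → 0 ℕ.< e → (e ℕ.≤ᵇ θ) ≡ false →
      1ℚ ≤ s ⊗ inv d ⊕ s ⊗ inv e ⊗ 𝟙 (not (d ℕ.≤ᵇ θ)) ⊕ (τ ⊗ ι d) ⊗ (τ ⊗ ι e)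
    charge d e 0<d 0<e e>θ with ℚ.≤-total (ι d) s | ℚ.≤-total (ι e) s
    ... | inj₁ d≤s | _ = ≤-cert (s ⊗ inv d ⊝ 1ℚ ⊕ (s ⊗ inv e ⊗ 𝟙 (not (d ℕ.≤ᵇ θ)) ⊕ (τ ⊗ ι d) ⊗ (τ ⊗ ι e)))
        (0≤⊕ (gap (1≤share d 0<d d≤s)) (0≤⊕ (0≤⊗ (0≤share e) (0≤𝟙 (not (d ℕ.≤ᵇ θ)))) (0≤⊗ (0≤⊗ 0≤τ (0≤ι d)) (0≤⊗ 0≤τ (0≤ι e)))))
        (solve 3 (λ a b c → a :+ b :+ c := con (+ 1) :+ (a :- con (+ 1) :+ (b :+ c))) refl (s ⊗ inv d) _ _)
    ... | inj₂ s≤d | inj₁ e≤s = ≤-cert (s ⊗ inv e ⊝ 1ℚ ⊕ (s ⊗ inv d ⊕ (τ ⊗ ι d) ⊗ (τ ⊗ ι e)))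
        (0≤⊕ (gap (1≤share e 0<e e≤s)) (0≤⊕ (0≤share d) (0≤⊗ (0≤⊗ 0≤τ (0≤ι d)) (0≤⊗ 0≤τ (0≤ι e)))))
        (trans (cong (λ b → s ⊗ inv d ⊕ s ⊗ inv e ⊗ 𝟙 (not b) ⊕ (τ ⊗ ι d) ⊗ (τ ⊗ ι e)) d>θ)
          (solve 3 (λ a b c → a :+ b :* con (+ 1) :+ c := con (+ 1) :+ (b :- con (+ 1) :+ (a :+ c))) refl (s ⊗ inv d) (s ⊗ inv e) _))
      where
      d>θ : (d ℕ.≤ᵇ θ) ≡ false
      d>θ with d ℕ.≤ᵇ θ in d≤θ
      ... | false = refl
      ... | true  = ⊥-elim (subst T e>θ (ℕ.≤⇒≤ᵇ (ℕ.≤-trans (ι-cancel (ℚ.≤-trans e≤s s≤d)) (ℕ.≤ᵇ⇒≤ d θ (subst T (sym d≤θ) tt)))))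
    ... | inj₂ s≤d | inj₂ s≤e = ≤-cert ((τ ⊗ ι d) ⊗ (τ ⊗ ι e) ⊝ 1ℚ ⊕ (s ⊗ inv d ⊕ s ⊗ inv e ⊗ 𝟙 (not (d ℕ.≤ᵇ θ))))
        (0≤⊕ (gap (ℚ.≤-trans (ℚ.≤-reflexive (sym (⊗-identityˡ 1ℚ))) (⊗-mono-≤ 0≤1 (0≤⊗ 0≤τ (0≤ι e)) (big s≤d) (big s≤e))))
          (0≤⊕ (0≤share d) (0≤⊗ (0≤share e) (0≤𝟙 (not (d ℕ.≤ᵇ θ))))))
        (solve 3 (λ a b c → a :+ b :+ c := con (+ 1) :+ (c :- con (+ 1) :+ (a :+ b))) refl (s ⊗ inv d) _ _)
      where
      big : ∀ {x} → s ≤ x → 1ℚ ≤ τ ⊗ x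
      big {x} s≤x = ℚ.≤-trans 1≤sτ (ℚ.≤-trans (ℚ.≤-reflexive (⊗-comm s τ)) (⊗-monoʳ-≤ 0≤τ s≤x))

    shareʳ : Fin n → Fin n → ℚ
    shareʳ x y = inv (deg G x) ⊗ (𝟙 (adj x y) ⊗ heavy y)

    shareˡ : Fin n → Fin n → ℚ
    shareˡ x y = shareʳ y x

    edge-charge : ∀ x y → 𝟙 (adj x y) ≤ 𝟙 (light x) ⊗ (𝟙 (light y) ⊗ 𝟙 (adj x y))
      ⊕ (s ⊗ shareʳ x y ⊕ s ⊗ shareˡ x y ⊕ (τ ⊗ ι (deg G x)) ⊗ (τ ⊗ ι (deg G y)))
    edge-charge x y rewrite adj-sym y x = go (adj x y) (deg G x ℕ.≤ᵇ θ) (deg G y ℕ.≤ᵇ θ) refl refl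
      where
      d = deg G x
      e = deg G y
      0≤de : 0ℚ ≤ (τ ⊗ ι d) ⊗ (τ ⊗ ι e)
      0≤de = 0≤⊗ (0≤⊗ 0≤τ (0≤ι d)) (0≤⊗ 0≤τ (0≤ι e))
      go : ∀ a l m → (d ℕ.≤ᵇ θ) ≡ l → (e ℕ.≤ᵇ θ) ≡ m → 𝟙 a ≤ 𝟙 l ⊗ (𝟙 m ⊗ 𝟙 a)
        ⊕ (s ⊗ (inv d ⊗ (𝟙 a ⊗ 𝟙 (not m))) ⊕ s ⊗ (inv e ⊗ (𝟙 a ⊗ 𝟙 (not l))) ⊕ (τ ⊗ ι d) ⊗ (τ ⊗ ι e))
      go false l m _ _ = 0≤⊕ (0≤⊗ (0≤𝟙 l) (0≤⊗ (0≤𝟙 m) ℚ.≤-refl)) (0≤⊕ (0≤⊕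
        (0≤⊗ 0≤s (0≤⊗ (0≤inv d) (0≤⊗ ℚ.≤-refl (0≤𝟙 (not m))))) (0≤⊗ 0≤s (0≤⊗ (0≤inv e) (0≤⊗ ℚ.≤-refl (0≤𝟙 (not l)))))) 0≤de)
      go true true true _ _ = ≤-cert ((τ ⊗ ι d) ⊗ (τ ⊗ ι e)) 0≤de (solve 4 (λ s d e z → con (+ 1) :* (con (+ 1) :* con (+ 1)) :+ (s :* (d :* (con (+ 1) :* con (+ 0))) :+ s :* (e :* (con (+ 1) :* con (+ 0))) :+ z) := con (+ 1) :+ z) refl
        s (inv d) (inv e) _)
      go true l false eq e>θ = ℚ.≤-trans (charge d e (deg-pos G x) (deg-pos G y) e>θ) (ℚ.≤-reflexive (trans
        (cong (λ b → s ⊗ inv d ⊕ s ⊗ inv e ⊗ 𝟙 (not b) ⊕ (τ ⊗ ι d) ⊗ (τ ⊗ ι e)) eq)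
        (solve 6 (λ l s d e h z → s :* d :+ s :* e :* h :+ z := l :* (con (+ 0) :* con (+ 1)) :+ (s :* (d :* (con (+ 1) :* con (+ 1))) :+ s :* (e :* (con (+ 1) :* h)) :+ z)) refl
          (𝟙 l) s (inv d) (inv e) (𝟙 (not l)) _)))
      go true false true d>θ e≤θ = ℚ.≤-trans (charge e d (deg-pos G y) (deg-pos G x) d>θ) (ℚ.≤-reflexive (trans
        (cong (λ b → s ⊗ inv e ⊕ s ⊗ inv d ⊗ 𝟙 (not b) ⊕ (τ ⊗ ι e) ⊗ (τ ⊗ ι d)) e≤θ)
        (solve 5 (λ s d e x y → s :* e :+ s :* d :* con (+ 0) :+ y :* x := con (+ 0) :* (con (+ 1) :* con (+ 1)) :+ (s :* (d :* (con (+ 1) :* con (+ 0))) :+ s :* (e :* (con (+ 1) :* con (+ 1))) :+ x :* y)) refl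
          s (inv d) (inv e) (τ ⊗ ι d) (τ ⊗ ι e))))

    E-shareʳ : E (vertex G) (λ x → E (vertex G) (shareʳ x)) ≡ inv n ⊗ tail θ
    E-shareʳ = trans (E-cong (vertex G) (λ x → trans (E-vertex G (shareʳ x)) (cong (inv n ⊗_)
      (trans (∑-⊗ n (inv (deg G x)) _) (sym (E-neighbour G x heavy)))))) (scale (vertex G) (inv n) _)

    -- `edge-charge` averaged over a random pair of vertices: either share averages to `tail θ` / n,
    -- and the product term factorises into the square of τ times the average degree.
    bias : edgeProb G ≤ lightProb ⊕ (ι 2 ⊗ (s ⊗ (inv n ⊗ tail θ)) ⊕ (τ ⊗ (ι n ⊗ edgeProb G)) ⊗ (τ ⊗ (ι n ⊗ edgeProb G)))
    bias = begin
      edgeProb G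
        ≡⟨ E-adj G ⟨
      U (λ x → U (λ y → 𝟙 (adj x y)))
        ≤⟨ mono (vertex G) (λ x → mono (vertex G) (edge-charge x)) ⟩
      U (λ x → U (λ y → 𝟙 (light x) ⊗ (𝟙 (light y) ⊗ 𝟙 (adj x y)) ⊕ (s ⊗ shareʳ x y ⊕ s ⊗ shareˡ x y ⊕ (τ ⊗ ι (deg G x)) ⊗ (τ ⊗ ι (deg G y)))))
        ≡⟨ E-cong (vertex G) (λ x → trans (add (vertex G) _ _) (cong₂ _⊕_ (scale (vertex G) _ _) (trans (add (vertex G) _ _)
             (cong₂ _⊕_ (trans (add (vertex G) _ _) (cong₂ _⊕_ (scale (vertex G) s _) (scale (vertex G) s _)))
               (trans (scale (vertex G) _ _) (cong (τ ⊗ ι (deg G x) ⊗_) (trans (scale (vertex G) τ _) (cong (τ ⊗_) E-deg)))))))) ⟩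
      U (λ x → 𝟙 (light x) ⊗ lightNbrs x ⊕ (s ⊗ U (shareʳ x) ⊕ s ⊗ U (shareˡ x) ⊕ (τ ⊗ ι (deg G x)) ⊗ D))
        ≡⟨ trans (add (vertex G) _ _) (cong (lightProb ⊕_) (trans (add (vertex G) _ _) (cong₂ _⊕_
             (trans (add (vertex G) _ _) (cong₂ _⊕_ (trans (scale (vertex G) s _) (cong (s ⊗_) E-shareʳ))
               (trans (scale (vertex G) s _) (cong (s ⊗_) (trans (E-vertex-swap G (vertex G) shareˡ) E-shareʳ)))))
             (trans (E-cong (vertex G) (λ x → ⊗-comm _ D)) (trans (scale (vertex G) D _) (cong (D ⊗_) (trans (scale (vertex G) τ _) (cong (τ ⊗_) E-deg)))))))) ⟩
      lightProb ⊕ (s ⊗ (inv n ⊗ tail θ) ⊕ s ⊗ (inv n ⊗ tail θ) ⊕ D ⊗ D)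
        ≡⟨ cong (lightProb ⊕_) (solve 2 (λ a d → a :+ a :+ d := con (+ 2) :* a :+ d) refl _ _) ⟩
      lightProb ⊕ (ι 2 ⊗ (s ⊗ (inv n ⊗ tail θ)) ⊕ D ⊗ D) ∎
      where
      open ℚ.≤-Reasoning
      U = E (vertex G)
      D = τ ⊗ (ι n ⊗ edgeProb G)

-- The search with additive queries

-- 2³⁰, sealed because multiplication by a literal would unfold it in unary.
opaque
  acceptance : ℕ
  acceptance = 1073741824

  acceptance≡ : acceptance ≡ 1073741824
  acceptance≡ = refl

data Stage (V : Set) : Set where
  phase    : ℕ → Stage V
  counting : V → ℕ → ℕ → Stage V

module Search {V : Set} (_≟_ : DecidableEquality V) (ε : ℚ) where
  open Queries _≟_

  adjacentTrial : V → Prog V Bool additives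
  adjacentTrial y = randVert (λ z → adjacent y z >>= λ a → ret (0 ℕ.<ᵇ a))

  hitTest : V → ℕ → Prog V Bool additives
  hitTest y = repeat (adjacentTrial y) _∨_ false

  countLight : ℕ → ℕ → Prog V ℕ additives
  countLight θ k = repeat (batch θ k) ℕ._+_ 0 (inverseSquare ε)

  accepted : ℕ → Bool
  accepted X = acceptance ℕ.* inverseSquare ε ℕ.≤ᵇ X

  -- X has mean close to qk² · d/n, and this solves for n/d.
  ratio : ℕ → ℕ → ℚ
  ratio k X = ι (inverseSquare ε) ⊗ (ι k ⊗ ι k) ⊗ inv X

  verdict : ℕ → ℕ → Stage V ⊎ Output
  verdict j X = if accepted X then inj₂ (inj₂ (ratio (2 ℕ.^ j) X)) else inj₁ (phase (suc j))

  proceed : ℕ → V → ℕ → Bool → Prog V (Stage V ⊎ Output) additives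
  proceed j y θ true  = ret (inj₁ (counting y 0 (hits ε)))
  proceed j y θ false = countLight θ (2 ℕ.^ j) >>= λ X → ret (verdict j X)

  examine : ℕ → V × ℕ → Prog V (Stage V ⊎ Output) additives
  examine j (y , θ) = hitTest y (2 ℕ.^ j) >>= proceed j y θ

  searchBody : Stage V → Prog V (Stage V ⊎ Output) additives
  searchBody (phase j)            = champion (inverseSquare ε ℕ.* 2 ℕ.^ j) >>= examine j
  searchBody (counting y N zero)    = degree y (λ d → ret (inj₂ (inj₁ (estimate ε (ι d) N))))
  searchBody (counting y N (suc r)) = attempt (adjacentTrial y) (counting y) N r

additiveAlgorithm : Algorithm
additiveAlgorithm V _≟_ ε = loop (Search.searchBody _≟_ ε) (phase 0)

module _ (G : Graph) where
  open Graph G using (n; adj; nonempty)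
  open Queries (Fin._≟_ {n})

  module Vertex (y : Fin n) (ε : ℚ) where
    open Search (Fin._≟_ {n}) ε

    nbrProb : ℚ
    nbrProb = inv n ⊗ ι (deg G y)

    0≤nbrProb : 0ℚ ≤ nbrProb
    0≤nbrProb = 0≤⊗ (0≤inv n) (0≤ι (deg G y))

    nbrProb⁻¹ : ℚ
    nbrProb⁻¹ = ι n ⊗ inv (deg G y)

    nbrProb-inverse : nbrProb⁻¹ ⊗ nbrProb ≡ 1ℚ
    nbrProb-inverse = trans (solve 4 (λ n e i d → n :* e :* (i :* d) := (i :* n) :* (e :* d)) refl (ι n) (inv (deg G y)) (inv n) (ι (deg G y)))
      (trans (cong₂ _⊗_ (inv⊗ nonempty) (inv⊗ (deg-pos G y))) (⊗-identityˡ 1ℚ))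

    E-nbr : E (vertex G) (λ z → 𝟙 (adj y z)) ≡ nbrProb
    E-nbr = trans (E-vertex G _) (cong (inv n ⊗_) (sym (count≡∑𝟙 n (adj y))))

    E-adjacentTrial : ∀ f → E (⟦_⟧ G (adjacentTrial y)) f ≡ E (vertex G) (λ z → f (adj y z))
    E-adjacentTrial f = E-cong (vertex G) (λ z → trans (E->>= G (adjacent y z) _ f) (trans (adjacent-value G y z _) (cong f (positive (adj y z)))))
      where
      positive : ∀ b → (0 ℕ.<ᵇ (if b then 1 else 0)) ≡ b
      positive false = refl
      positive true  = refl

    adjacentTrial-Bernoulli : Bernoulli G (adjacentTrial y) nbrProb
    adjacentTrial-Bernoulli f = trans (E-adjacentTrial f) (trans (indicator-Bernoulli G (vertex G) (adj y) f)
      (cong (λ p → p ⊗ f true ⊕ (1ℚ ⊝ p) ⊗ f false) E-nbr))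

    adjacentTrial-cost : cost G (adjacentTrial y) ≤ ι 4
    adjacentTrial-cost = ℚ.≤-trans (⊕-mono-≤ (ℚ.≤-refl {1ℚ}) (E≤ (vertex G) (λ z → ℚ.≤-trans
      (ℚ.≤-reflexive (trans (cost->>= G (adjacent y z) _) (trans (cong (cost G (adjacent y z) ⊕_) (const (⟦_⟧ G (adjacent y z)) 0ℚ)) (⊕-identityʳ _))))
      (adjacent-cost G y z)))) (ℚ.≤-reflexive (sym (ι-suc 3)))

    private
      module R = Repeat G (adjacentTrial y) _∨_ false

    hitProb : ℕ → ℚ
    hitProb k = E (⟦_⟧ G (hitTest y k)) 𝟙

    0≤hitProb : ∀ k → 0ℚ ≤ hitProb k
    0≤hitProb k = 0≤E (⟦_⟧ G (hitTest y k)) 0≤𝟙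

    hitProb≤1 : ∀ k → hitProb k ≤ 1ℚ
    hitProb≤1 k = E≤ (⟦_⟧ G (hitTest y k)) 𝟙≤1

    hitProb≤ : ∀ k → hitProb k ≤ ι k ⊗ nbrProb
    hitProb≤ zero    = ℚ.≤-reflexive (sym (⊗-zeroˡ nbrProb))
    hitProb≤ (suc k) = begin
      hitProb (suc k)
        ≡⟨ R.E-suc k 𝟙 ⟩
      E (⟦_⟧ G (hitTest y k)) (λ s → E (⟦_⟧ G (adjacentTrial y)) (λ a → 𝟙 (a ∨ s)))
        ≤⟨ mono (⟦_⟧ G (hitTest y k)) {λ s → E (⟦_⟧ G (adjacentTrial y)) (λ a → 𝟙 (a ∨ s))} {λ s → nbrProb ⊕ 𝟙 s} (λ s → union s) ⟩
      E (⟦_⟧ G (hitTest y k)) (λ s → nbrProb ⊕ 𝟙 s)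
        ≡⟨ shift (⟦_⟧ G (hitTest y k)) nbrProb 𝟙 ⟩
      nbrProb ⊕ hitProb k
        ≤⟨ ⊕-mono-≤ (ℚ.≤-refl {nbrProb}) (hitProb≤ k) ⟩
      nbrProb ⊕ ι k ⊗ nbrProb
        ≡⟨ trans (solve 2 (λ p k → p :+ k :* p := (con (+ 1) :+ k) :* p) refl nbrProb (ι k)) (cong (_⊗ nbrProb) (sym (ι-suc k))) ⟩
      ι (suc k) ⊗ nbrProb ∎
      where
      open ℚ.≤-Reasoning
      union : ∀ s → E (⟦_⟧ G (adjacentTrial y)) (λ a → 𝟙 (a ∨ s)) ≤ nbrProb ⊕ 𝟙 s
      union s = subst (_≤ nbrProb ⊕ 𝟙 s) (sym (adjacentTrial-Bernoulli (λ a → 𝟙 (a ∨ s))))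
        (≤-cert (nbrProb ⊗ 𝟙 s) (0≤⊗ 0≤nbrProb (0≤𝟙 s))
          (solve 2 (λ p s → p :+ s := p :* con (+ 1) :+ (con (+ 1) :- p) :* s :+ p :* s) refl nbrProb (𝟙 s)))

    missProb : ℕ → ℚ
    missProb k = 1ℚ ⊝ hitProb k

    0≤missProb : ∀ k → 0ℚ ≤ missProb k
    0≤missProb k = gap (hitProb≤1 k)

    missProb≤1 : ∀ k → missProb k ≤ 1ℚ
    missProb≤1 k = ≤-cert (hitProb k) (0≤hitProb k) (solve 1 (λ h → con (+ 1) := con (+ 1) :- h :+ h) refl (hitProb k))

    -- `repeat-miss` with γ = deg y / n, because (1 - γ)(1 + γ) ≤ 1.
    missProb≤ : ∀ k → (1ℚ ⊕ ι k ⊗ nbrProb) ⊗ missProb k ≤ 1ℚ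
    missProb≤ k = subst (λ z → (1ℚ ⊕ ι k ⊗ nbrProb) ⊗ z ≤ 1ℚ) miss≡
      (R.repeat-miss (𝟙 ∘ not) (𝟙 ∘ not) 0≤nbrProb (0≤𝟙 ∘ not) ℚ.≤-refl both rare k)
      where
      𝟙-not : ∀ b → 𝟙 (not b) ≡ 1ℚ ⊝ 𝟙 b
      𝟙-not false = solve 0 (con (+ 1) := con (+ 1) :- con (+ 0)) refl
      𝟙-not true  = solve 0 (con (+ 0) := con (+ 1) :- con (+ 1)) refl
      miss≡ : E (⟦_⟧ G (hitTest y k)) (𝟙 ∘ not) ≡ missProb k
      miss≡ = trans (E-cong (⟦_⟧ G (hitTest y k)) 𝟙-not) (E-complement (⟦_⟧ G (hitTest y k)) 𝟙)
      both : ∀ a s → 𝟙 (not (a ∨ s)) ≤ 𝟙 (not s) ⊗ 𝟙 (not a)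
      both false s = ℚ.≤-reflexive (sym (⊗-identityʳ (𝟙 (not s))))
      both true  s = 0≤⊗ (0≤𝟙 (not s)) ℚ.≤-refl
      rare : E (⟦_⟧ G (adjacentTrial y)) (𝟙 ∘ not) ⊗ (1ℚ ⊕ nbrProb) ≤ 1ℚ
      rare = subst (λ z → z ⊗ (1ℚ ⊕ nbrProb) ≤ 1ℚ) (sym (adjacentTrial-Bernoulli (𝟙 ∘ not)))
        (≤-cert (nbrProb ⊗ nbrProb) (0≤sq nbrProb)
          (solve 1 (λ p → con (+ 1) := (p :* con (+ 0) :+ (con (+ 1) :- p) :* con (+ 1)) :* (con (+ 1) :+ p) :+ p :* p) refl nbrProb))

    hitTest-cost : ∀ k → cost G (hitTest y k) ≤ ι 4 ⊗ ι k
    hitTest-cost k = ℚ.≤-trans (ℚ.≤-reflexive (R.repeat-cost k)) (ℚ.≤-trans (⊗-monoʳ-≤ (0≤ι k) adjacentTrial-cost) (ℚ.≤-reflexive (⊗-comm (ι k) (ι 4))))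

    E-hitTest : ∀ k f → E (⟦_⟧ G (hitTest y k)) f ≡ hitProb k ⊗ f true ⊕ missProb k ⊗ f false
    E-hitTest k f = indicator-Bernoulli G (⟦_⟧ G (hitTest y k)) (λ b → b) f

  module Count (θ : ℕ) (ε : ℚ) (k : ℕ) where
    open Search (Fin._≟_ {n}) ε
    open Light G θ using (lightProb)

    private
      q = inverseSquare ε
      K = ι k
      σ : Mean (List (Fin n))
      σ = ⟦_⟧ G (sampleLight {κ = additives} θ k)
      β : Mean ℕ
      β = ⟦_⟧ G (batch θ k)

    batchMean : ℚ
    batchMean = K ⊗ (K ⊗ lightProb)

    E-batch : E β ι ≡ batchMean
    E-batch = trans (batch-value G θ k ι) (trans (E-cong σ (λ Y → E-cong σ (λ Z → ι-cross G Y Z))) (Light.cross-mean G θ k))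

    private
      module S = Repeat.Sum G (batch θ k) ℕ._+_ 0 ι ι refl ι-+

    count : Mean ℕ
    count = ⟦_⟧ G (countLight θ k)

    count-mean : E count ι ≡ ι q ⊗ batchMean
    count-mean = trans (S.repeat-mean q) (cong (ι q ⊗_) E-batch)

    count-variance : ∀ c → K ⊗ ι θ ≤ c ⊗ ι n →
      E count (λ X → (ι X ⊝ ι q ⊗ batchMean) ⊗ (ι X ⊝ ι q ⊗ batchMean)) ≤ ι q ⊗ ((1ℚ ⊕ (c ⊕ c)) ⊗ batchMean)
    count-variance c c-bound = begin
      E count (λ X → (ι X ⊝ ι q ⊗ batchMean) ⊗ (ι X ⊝ ι q ⊗ batchMean))
        ≡⟨ E-cong count (λ X → cong (λ z → z ⊗ z) (trans (cong (λ m → ι X ⊝ ι q ⊗ m) (sym E-batch)) (sym (⊕-identityˡ (ι X ⊝ ι q ⊗ E β ι))))) ⟩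
      E count (λ X → (0ℚ ⊕ (ι X ⊝ ι q ⊗ E β ι)) ⊗ (0ℚ ⊕ (ι X ⊝ ι q ⊗ E β ι)))
        ≡⟨ S.repeat-deviation q 0ℚ ⟩
      0ℚ ⊗ 0ℚ ⊕ ι q ⊗ S.variance
        ≡⟨ trans (cong (_⊕ ι q ⊗ S.variance) (⊗-zeroˡ 0ℚ)) (⊕-identityˡ (ι q ⊗ S.variance)) ⟩
      ι q ⊗ S.variance
        ≤⟨ ⊗-monoʳ-≤ (0≤ι q) batch-variance ⟩
      ι q ⊗ ((1ℚ ⊕ (c ⊕ c)) ⊗ batchMean) ∎
      where
      open ℚ.≤-Reasoning
      batch-variance : S.variance ≤ (1ℚ ⊕ (c ⊕ c)) ⊗ batchMean
      batch-variance = subst (_≤ (1ℚ ⊕ (c ⊕ c)) ⊗ batchMean)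
        (sym (trans (cong (λ m → E β (λ X → (ι X ⊝ m) ⊗ (ι X ⊝ m))) E-batch)
          (trans (batch-value G θ k (λ X → (ι X ⊝ batchMean) ⊗ (ι X ⊝ batchMean)))
            (E-cong σ (λ Y → E-cong σ (λ Z → cong (λ x → (x ⊝ batchMean) ⊗ (x ⊝ batchMean)) (ι-cross G Y Z)))))))
        (Light.Batch.cross-variance G θ k c c-bound)

    count-cost : cost G (countLight θ k) ≤ ι q ⊗ (ι 3 ⊕ ι 8 ⊗ K ⊕ ι 9 ⊗ (K ⊗ K ⊗ K ⊗ inv n))
    count-cost = ℚ.≤-trans (ℚ.≤-reflexive (Repeat.repeat-cost G (batch θ k) ℕ._+_ 0 q)) (⊗-monoʳ-≤ (0≤ι q) (batch-cost G θ k))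

-- Analysis of a single phase

module Phase (G : Graph) {ε : ℚ} (0<ε : 0ℚ < ε) (ε<1 : ε < 1ℚ) (j : ℕ) where
  open Graph G using (n; adj; nonempty)
  open Search (Fin._≟_ {n}) ε

  q k : ℕ
  q = inverseSquare ε
  k = 2 ℕ.^ j

  p K : ℚ
  p = edgeProb G
  K = ι k

  0<q : 0 ℕ.< q
  0<q = 0<inverseSquare ε

  0<k : 0 ℕ.< k
  0<k = ℕ.m^n>0 2 j

  -- The expected number of edges in one batch, were no vertex too heavy.
  x : ℚ
  x = K ⊗ (K ⊗ p)

  x⁻¹ : ℚ
  x⁻¹ = inv k ⊗ inv k ⊗ ρ G

  0≤x⁻¹ : 0ℚ ≤ x⁻¹
  0≤x⁻¹ = 0≤⊗ (0≤⊗ (0≤inv k) (0≤inv k)) (0≤ρ G)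

  0≤x : 0ℚ ≤ x
  0≤x = 0≤⊗ (0≤ι k) (0≤⊗ (0≤ι k) (0≤edgeProb G))

  x⁻¹⊗x : x⁻¹ ⊗ x ≡ 1ℚ
  x⁻¹⊗x = trans (solve 4 (λ i r k p → i :* i :* r :* (k :* (k :* p)) := (i :* k) :* (i :* k) :* (r :* p)) refl (inv k) (ρ G) K p)
    (trans (cong₂ (λ a b → a ⊗ a ⊗ b) (inv⊗ 0<k) (ρ⊗edgeProb G)) (trans (⊗-identityʳ _) (⊗-identityˡ 1ℚ)))

  x⁻¹⊗p : x⁻¹ ⊗ p ≡ inv k ⊗ inv k
  x⁻¹⊗p = trans (⊗-assoc (inv k ⊗ inv k) (ρ G) p) (trans (cong (inv k ⊗ inv k ⊗_) (ρ⊗edgeProb G)) (⊗-identityʳ _))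

  μ : ℚ
  μ = ι q ⊗ x

  μ⁻¹ : ℚ
  μ⁻¹ = inv q ⊗ x⁻¹

  0≤μ : 0ℚ ≤ μ
  0≤μ = 0≤⊗ (0≤ι q) 0≤x

  0≤ε : 0ℚ ≤ ε
  0≤ε = ℚ.<⇒≤ 0<ε

  0≤1-ε : 0ℚ ≤ 1ℚ ⊝ ε
  0≤1-ε = gap (ℚ.<⇒≤ ε<1)

  μ⁻¹⊗μ : μ⁻¹ ⊗ μ ≡ 1ℚ
  μ⁻¹⊗μ = trans (solve 4 (λ i y q x → i :* y :* (q :* x) := (i :* q) :* (y :* x)) refl (inv q) x⁻¹ (ι q) x)
    (trans (cong₂ _⊗_ (inv⊗ 0<q) x⁻¹⊗x) (⊗-identityˡ 1ℚ))

  -- The Chebyshev factor for a deviation of εμ/4: since qε² ≥ 1, it is at least 16/(εμ)². Only a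
  -- quarter of the error is used because the restriction to light vertices takes another quarter.
  w : ℚ
  w = ι 16 ⊗ ι q ⊗ (μ⁻¹ ⊗ μ⁻¹)

  0≤w : 0ℚ ≤ w
  0≤w = 0≤⊗ (0≤⊗ (0≤ι 16) (0≤ι q)) (0≤sq μ⁻¹)

  deviant : ∀ d → (ε ⊗ μ) ⊗ (ε ⊗ μ) ≤ (ι 4 ⊗ d) ⊗ (ι 4 ⊗ d) → 1ℚ ≤ w ⊗ (d ⊗ d)
  deviant d le = begin
    1ℚ                                                   ≤⟨ 1≤qε² 0<ε ε<1 ⟩
    ι q ⊗ (ε ⊗ ε)                                        ≡⟨ trans (sym (⊗-identityˡ _)) (cong (_⊗ (ι q ⊗ (ε ⊗ ε))) (sym (trans (cong₂ _⊗_ μ⁻¹⊗μ μ⁻¹⊗μ) (⊗-identityˡ 1ℚ)))) ⟩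
    (μ⁻¹ ⊗ μ) ⊗ (μ⁻¹ ⊗ μ) ⊗ (ι q ⊗ (ε ⊗ ε))              ≡⟨ solve 4 (λ i m q e → (i :* m) :* (i :* m) :* (q :* (e :* e)) := q :* (i :* i) :* ((e :* m) :* (e :* m))) refl μ⁻¹ μ (ι q) ε ⟩
    ι q ⊗ (μ⁻¹ ⊗ μ⁻¹) ⊗ ((ε ⊗ μ) ⊗ (ε ⊗ μ))              ≤⟨ ⊗-monoʳ-≤ (0≤⊗ (0≤ι q) (0≤sq μ⁻¹)) le ⟩
    ι q ⊗ (μ⁻¹ ⊗ μ⁻¹) ⊗ ((ι 4 ⊗ d) ⊗ (ι 4 ⊗ d))          ≡⟨ solve 3 (λ q i d → q :* (i :* i) :* ((con (+ 4) :* d) :* (con (+ 4) :* d)) := con (+ 16) :* q :* (i :* i) :* (d :* d)) refl (ι q) μ⁻¹ d ⟩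
    w ⊗ (d ⊗ d)                                          ∎
    where open ℚ.≤-Reasoning

  penalty : ℚ → ℕ → ℚ
  penalty ν X = w ⊗ ((ι X ⊝ ν) ⊗ (ι X ⊝ ν))

  0≤penalty : ∀ ν X → 0ℚ ≤ penalty ν X
  0≤penalty ν X = 0≤⊗ 0≤w (0≤sq (ι X ⊝ ν))

  0≤εμ : 0ℚ ≤ ε ⊗ μ
  0≤εμ = 0≤⊗ 0≤ε 0≤μ

  too-large : ∀ ν X → ε ⊗ μ ≤ ι 4 ⊗ (ι X ⊝ ν) → 1ℚ ≤ penalty ν X
  too-large ν X le = deviant (ι X ⊝ ν) (sq-mono 0<ε ε<1 0≤εμ le)

  too-small : ∀ ν X → ε ⊗ μ ≤ ι 4 ⊗ (ν ⊝ ι X) → 1ℚ ≤ penalty ν X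
  too-small ν X le = deviant (ι X ⊝ ν) (sq-mono⁻ 0<ε ε<1 0≤εμ (≤-cert (ι 4 ⊗ (ν ⊝ ι X) ⊝ ε ⊗ μ) (gap le)
    (solve 3 (λ ν X m → :- m := con (+ 4) :* (X :- ν) :+ (con (+ 4) :* (ν :- X) :- m)) refl ν (ι X) (ε ⊗ μ))))

  -- `ν` is to be the mean of X under the restriction to light vertices, so it may fall short of `μ`
  -- by a relative ε/4 but cannot exceed it.
  Plausible : ℚ → Set
  Plausible ν = ((ι 4 ⊝ ε) ⊗ μ ≤ ι 4 ⊗ ν) × ν ≤ μ

  -- With X ≤ μ/2 the shortfall from ν is at least (1/2 - ε/4)μ, which is at least εμ/4 because ε ≤
  -- 1.
  short : ∀ {ν} X → Plausible ν → ι 2 ⊗ ι X ≤ μ → 1ℚ ≤ penalty ν X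
  short {ν} X (lo , hi) le = too-small ν X (≤-cert
    ((ι 4 ⊗ ν ⊝ (ι 4 ⊝ ε) ⊗ μ) ⊕ (ι 2 ⊗ (μ ⊝ ι 2 ⊗ ι X) ⊕ ι 2 ⊗ ((1ℚ ⊝ ε) ⊗ μ)))
    (0≤⊕ (gap lo) (0≤⊕ (0≤⊗ (0≤ι 2) (gap le)) (0≤⊗ (0≤ι 2) (0≤⊗ 0≤1-ε 0≤μ))))
    (solve 4 (λ ν X m e → con (+ 4) :* (ν :- X) := e :* m :+ ((con (+ 4) :* ν :- (con (+ 4) :- e) :* m) :+ (con (+ 2) :* (m :- con (+ 2) :* X) :+ con (+ 2) :* ((con (+ 1) :- e) :* m)))) refl ν (ι X) μ ε))

  ratio-failure : ∀ {ν} X → 0 ℕ.< X → Plausible ν → failure G (Correct ε G) (inj₂ (ratio k X)) ≤ penalty ν X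
  ratio-failure {ν} X 0<X pl@(lo , hi) = subst (λ Q → (if approxᵇ ε Q (ratio k X) then 0ℚ else 1ℚ) ≤ penalty ν X) (sym (nOverD≡ρ G))
    (failure-≤ ε (ρ G) (ratio k X) (0≤penalty ν X) below above)
    where
    p⊗X : ∀ c → p ⊗ ι X ⊗ (c ⊗ ρ G) ≡ c ⊗ ι X
    p⊗X c = trans (solve 4 (λ p X c r → p :* X :* (c :* r) := c :* X :* (r :* p)) refl p (ι X) c (ρ G)) (trans (cong (c ⊗ ι X ⊗_) (ρ⊗edgeProb G)) (⊗-identityʳ _))
    ratio≡ : p ⊗ ι X ⊗ ratio k X ≡ μ
    ratio≡ = trans (solve 5 (λ p X q k i → p :* X :* (q :* (k :* k) :* i) := q :* (k :* (k :* p)) :* (i :* X)) refl p (ι X) (ι q) K (inv X))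
      (trans (cong (μ ⊗_) (inv⊗ 0<X)) (⊗-identityʳ μ))
    0≤pX : 0ℚ ≤ p ⊗ ι X
    0≤pX = 0≤⊗ (0≤edgeProb G) (0≤ι X)
    below : ratio k X ≤ (1ℚ ⊝ ε) ⊗ ρ G → 1ℚ ≤ penalty ν X
    below le = too-large ν X (≤-cert
      (ι 4 ⊗ (μ ⊝ ν) ⊕ (ι 4 ⊗ a ⊕ (ι 3 ⊗ (ε ⊗ ι X) ⊕ ε ⊗ (a ⊕ ε ⊗ ι X))))
      (0≤⊕ (0≤⊗ (0≤ι 4) (gap hi)) (0≤⊕ (0≤⊗ (0≤ι 4) 0≤a) (0≤⊕ (0≤⊗ (0≤ι 3) 0≤εX) (0≤⊗ 0≤ε (0≤⊕ 0≤a 0≤εX)))))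
      (solve 4 (λ ν X m e → con (+ 4) :* (X :- ν) := e :* m :+ (con (+ 4) :* (m :- ν) :+ (con (+ 4) :* ((con (+ 1) :- e) :* X :- m)
        :+ (con (+ 3) :* (e :* X) :+ e :* (((con (+ 1) :- e) :* X :- m) :+ e :* X))))) refl ν (ι X) μ ε))
      where
      a = (1ℚ ⊝ ε) ⊗ ι X ⊝ μ
      0≤a : 0ℚ ≤ a
      0≤a = gap (subst₂ _≤_ ratio≡ (p⊗X (1ℚ ⊝ ε)) (⊗-monoʳ-≤ 0≤pX le))
      0≤εX : 0ℚ ≤ ε ⊗ ι X
      0≤εX = 0≤⊗ 0≤ε (0≤ι X)
    above : (1ℚ ⊕ ε) ⊗ ρ G ≤ ratio k X → 1ℚ ≤ penalty ν X
    -- Here (1 + ε)X ≤ μ, so μ - X ≥ εX. If X ≥ μ/2 this is at least εμ/2, and the bias takes away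
    -- at most εμ/4 of it; smaller X are covered by `short`.
    above le with ℚ.≤-total (ι 2 ⊗ ι X) μ
    ... | inj₁ 2X≤μ = short X pl 2X≤μ
    ... | inj₂ μ≤2X = too-small ν X (≤-cert
      ((ι 4 ⊗ ν ⊝ (ι 4 ⊝ ε) ⊗ μ) ⊕ (ι 4 ⊗ (μ ⊝ (1ℚ ⊕ ε) ⊗ ι X) ⊕ ι 2 ⊗ (ε ⊗ (ι 2 ⊗ ι X ⊝ μ))))
      (0≤⊕ (gap lo) (0≤⊕ (0≤⊗ (0≤ι 4) (gap (subst₂ _≤_ (p⊗X (1ℚ ⊕ ε)) ratio≡ (⊗-monoʳ-≤ 0≤pX le)))) (0≤⊗ (0≤ι 2) (0≤⊗ 0≤ε (gap μ≤2X)))))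
      (solve 4 (λ ν X m e → con (+ 4) :* (ν :- X) := e :* m :+ ((con (+ 4) :* ν :- (con (+ 4) :- e) :* m)
        :+ (con (+ 4) :* (m :- (con (+ 1) :+ e) :* X) :+ con (+ 2) :* (e :* (con (+ 2) :* X :- m))))) refl ν (ι X) μ ε))

  -- Chosen so that qk draws leave the champion bad with probability at most 1/(1 + 96).
  γ : ℚ
  γ = ι 96 ⊗ inv (q ℕ.* k)

  0≤γ : 0ℚ ≤ γ
  0≤γ = 0≤⊗ (0≤ι 96) (0≤inv (q ℕ.* k))

  0<qk : 0 ℕ.< q ℕ.* k
  0<qk = ℕ.*-mono-≤ 0<q 0<k

  open Tail G γ 0≤γ using (frequent; infrequent⇒; bad; champion-frequent)

  γ⊗qK : γ ⊗ (ι q ⊗ K) ≡ ι 96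
  γ⊗qK = trans (⊗-assoc (ι 96) (inv (q ℕ.* k)) (ι q ⊗ K)) (trans (cong (ι 96 ⊗_) (trans (cong (inv (q ℕ.* k) ⊗_) (sym (ι-* q k))) (inv⊗ 0<qk))) (⊗-identityʳ (ι 96)))

  inv-n⊗n : inv n ⊗ ι n ≡ 1ℚ
  inv-n⊗n = inv⊗ nonempty

  χ : Mean (Fin n × ℕ)
  χ = ⟦_⟧ G (champion {κ = additives} (q ℕ.* k))

  -- The expectation of H at the edge count of this phase, restricted to the event that the phase reaches it.
  risk : (ℕ → ℚ) → Fin n × ℕ → ℚ
  risk H (y , θ) = Vertex.missProb G y ε k ⊗ E (Count.count G θ ε k) H

  -- 2²⁵ exceeds both 8 · 1536², which makes the edges at missed heavy vertices an ε/4 fraction, and 16 · 193 · 96,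
  -- which makes Chebyshev's bound at most 1/96.
  module _ (x-large : ι 33554432 ≤ x) where

    x⁻¹-small : ι 33554432 ⊗ x⁻¹ ≤ 1ℚ
    x⁻¹-small = subst (ι 33554432 ⊗ x⁻¹ ≤_) (trans (⊗-comm x x⁻¹) x⁻¹⊗x) (⊗-monoˡ-≤ 0≤x⁻¹ x-large)

    lightProb-large : ∀ θ → tail G θ ≤ γ → (ι 4 ⊝ ε) ⊗ p ≤ ι 4 ⊗ Light.lightProb G θ
    lightProb-large θ tail≤γ = ≤-by-inverse (ι 2) (0≤inv 2) (inv-inverse 1) (≤-cert cert 0≤cert eq)
      where
      u = inv 1536
      1536u : u ⊗ ι 1536 ≡ 1ℚ
      1536u = inv-inverse 1535
      s τ : ℚ
      -- With d = np this is s = dK · qε/1536, which is √(nd) up to the factor √x · qε/1536, and τ =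
      -- 1536ε/(dK), so that sτ = qε² ≥ 1. When the tail is at most γ = 96/(qK), the first loss in
      -- `bias` is at most 2sγ/n = εp/8; the second is (τd)² = 1536²ε²p/x, also at most εp/8.
      s = ι n ⊗ p ⊗ K ⊗ (ι q ⊗ ε ⊗ u)
      τ = inv n ⊗ ρ G ⊗ inv k ⊗ (ι 1536 ⊗ ε)
      0≤s : 0ℚ ≤ s
      0≤s = 0≤⊗ (0≤⊗ (0≤⊗ (0≤ι n) (0≤edgeProb G)) (0≤ι k)) (0≤⊗ (0≤⊗ (0≤ι q) 0≤ε) (0≤inv 1536))
      0≤τ : 0ℚ ≤ τ
      0≤τ = 0≤⊗ (0≤⊗ (0≤⊗ (0≤inv n) (0≤ρ G)) (0≤inv k)) (0≤⊗ (0≤ι 1536) 0≤ε)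
      1≤sτ : 1ℚ ≤ s ⊗ τ
      1≤sτ = ℚ.≤-trans (1≤qε² 0<ε ε<1) (ℚ.≤-reflexive (sym (trans (cong₂ _⊗_ (regroup₁ (ι n) p K (ι q) ε u) (regroup₂ (inv n) (ρ G) (inv k) (ι 1536) ε)) (trans
        (solve 8 (λ a b c d e f g h → (a :* (b :* c :* d)) :* (e :* (f :* g :* h)) := (a :* e) :* ((f :* b) :* (g :* c) :* (d :* h))) refl
          (ι q ⊗ ε) (ι n ⊗ p) K u ε (inv n ⊗ ρ G) (inv k) (ι 1536))
        (trans (cong₂ _⊗_ (⊗-assoc (ι q) ε ε) units) (⊗-identityʳ _))))))
        where
        regroup₁ : ∀ n p k q e u → n ⊗ p ⊗ k ⊗ (q ⊗ e ⊗ u) ≡ (q ⊗ e) ⊗ ((n ⊗ p) ⊗ k ⊗ u)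
        regroup₁ n p k q e u = solve 4 (λ np k qe u → np :* k :* (qe :* u) := qe :* (np :* k :* u)) refl (n ⊗ p) k (q ⊗ e) u
        regroup₂ : ∀ i r k c e → i ⊗ r ⊗ k ⊗ (c ⊗ e) ≡ e ⊗ ((i ⊗ r) ⊗ k ⊗ c)
        regroup₂ i r k c e = solve 4 (λ ir k c e → ir :* k :* (c :* e) := e :* (ir :* k :* c)) refl (i ⊗ r) k c e
        units : (inv n ⊗ ρ G ⊗ (ι n ⊗ p)) ⊗ (inv k ⊗ K) ⊗ (u ⊗ ι 1536) ≡ 1ℚ
        units = trans (cong₂ (λ a b → a ⊗ (inv k ⊗ K) ⊗ b) (trans (solve 4 (λ i r n p → i :* r :* (n :* p) := (i :* n) :* (r :* p)) refl (inv n) (ρ G) (ι n) p)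
            (trans (cong₂ _⊗_ inv-n⊗n (ρ⊗edgeProb G)) (⊗-identityˡ 1ℚ))) 1536u)
          (trans (⊗-identityʳ _) (trans (⊗-identityˡ _) (inv⊗ 0<k)))
      ℓ = Light.lightProb G θ
      D = τ ⊗ (ι n ⊗ p)
      D≡ : D ≡ inv k ⊗ (ι 1536 ⊗ ε)
      D≡ = trans (solve 6 (λ i r k c n p → i :* r :* k :* c :* (n :* p) := (i :* n) :* (r :* p) :* (k :* c)) refl (inv n) (ρ G) (inv k) (ι 1536 ⊗ ε) (ι n) p)
        (trans (cong (_⊗ (inv k ⊗ (ι 1536 ⊗ ε))) (trans (cong₂ _⊗_ inv-n⊗n (ρ⊗edgeProb G)) (⊗-identityˡ 1ℚ))) (⊗-identityˡ _))
      D² : D ⊗ D ≡ ι 2359296 ⊗ (x⁻¹ ⊗ p ⊗ (ε ⊗ ε))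
      D² = trans (cong (λ d → d ⊗ d) D≡) (trans (solve 2 (λ i e → (i :* (con (+ 1536) :* e)) :* (i :* (con (+ 1536) :* e)) := con (+ 2359296) :* (i :* i :* (e :* e))) refl (inv k) ε)
        (cong (λ z → ι 2359296 ⊗ (z ⊗ (ε ⊗ ε))) (sym x⁻¹⊗p)))
      share : ι 16 ⊗ (s ⊗ (inv n ⊗ γ)) ≡ ε ⊗ p
      share = trans (solve 7 (λ n p k qe u i g → con (+ 16) :* (n :* p :* k :* (qe :* u) :* (i :* g)) := con (+ 16) :* ((i :* n) :* (g :* (qe :* k)) :* (p :* u))) refl (ι n) p K (ι q ⊗ ε) u (inv n) γ)
        (trans (cong (λ z → ι 16 ⊗ (z ⊗ (p ⊗ u))) (trans (cong₂ _⊗_ inv-n⊗n (trans (solve 4 (λ g q e k → g :* (q :* e :* k) := g :* (q :* k) :* e) refl γ (ι q) ε K) (cong (_⊗ ε) γ⊗qK))) (⊗-identityˡ _)))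
        (trans (solve 3 (λ e p u → con (+ 16) :* (con (+ 96) :* e :* (p :* u)) := u :* con (+ 1536) :* (e :* p)) refl ε p u)
          (trans (cong (_⊗ (ε ⊗ p)) 1536u) (⊗-identityˡ _))))
      tail-part : ι 16 ⊗ (s ⊗ (inv n ⊗ tail G θ)) ≤ ε ⊗ p
      tail-part = ℚ.≤-trans (⊗-monoʳ-≤ (0≤ι 16) (⊗-monoʳ-≤ 0≤s (⊗-monoʳ-≤ (0≤inv n) tail≤γ))) (ℚ.≤-reflexive share)
      square-part : ι 8 ⊗ (D ⊗ D) ≤ ε ⊗ p
      square-part = subst (λ z → ι 8 ⊗ z ≤ ε ⊗ p) (sym D²) (≤-cert
        (ε ⊗ p ⊗ (1ℚ ⊝ ε) ⊕ ε ⊗ ε ⊗ p ⊗ ((1ℚ ⊝ ι 33554432 ⊗ x⁻¹) ⊕ ι 14680064 ⊗ x⁻¹))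
        (0≤⊕ (0≤⊗ (0≤⊗ 0≤ε (0≤edgeProb G)) 0≤1-ε) (0≤⊗ (0≤⊗ (0≤sq ε) (0≤edgeProb G)) (0≤⊕ (gap x⁻¹-small) (0≤⊗ (0≤ι 14680064) 0≤x⁻¹))))
        (solve 3 (λ e p y → e :* p := con (+ 8) :* (con (+ 2359296) :* (y :* p :* (e :* e))) :+ (e :* p :* (con (+ 1) :- e) :+ e :* e :* p :* ((con (+ 1) :- con (+ 33554432) :* y) :+ con (+ 14680064) :* y))) refl ε p x⁻¹))
      slack = ℓ ⊕ (ι 2 ⊗ (s ⊗ (inv n ⊗ tail G θ)) ⊕ D ⊗ D) ⊝ p
      cert = ι 8 ⊗ slack ⊕ ((ε ⊗ p ⊝ ι 16 ⊗ (s ⊗ (inv n ⊗ tail G θ))) ⊕ (ε ⊗ p ⊝ ι 8 ⊗ (D ⊗ D)))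
      0≤cert : 0ℚ ≤ cert
      0≤cert = 0≤⊕ (0≤⊗ (0≤ι 8) (gap (Bias.bias G θ s τ 0≤s 0≤τ 1≤sτ))) (0≤⊕ (gap tail-part) (gap square-part))
      eq : ι 2 ⊗ (ι 4 ⊗ ℓ) ≡ ι 2 ⊗ ((ι 4 ⊝ ε) ⊗ p) ⊕ cert
      eq = solve 5 (λ l e p t d → con (+ 2) :* (con (+ 4) :* l) := con (+ 2) :* ((con (+ 4) :- e) :* p) :+
        (con (+ 8) :* (l :+ (con (+ 2) :* t :+ d) :- p) :+ ((e :* p :- con (+ 16) :* t) :+ (e :* p :- con (+ 8) :* d)))) refl ℓ ε p (s ⊗ (inv n ⊗ tail G θ)) (D ⊗ D)

    plausible : ∀ θ → tail G θ ≤ γ → Plausible (ι q ⊗ Count.batchMean G θ ε k)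
    plausible θ tail≤γ =
      subst₂ _≤_ (solve 4 (λ q k e p → q :* (k :* k) :* (e :* p) := e :* (q :* (k :* (k :* p)))) refl (ι q) K (ι 4 ⊝ ε) p)
                 (solve 3 (λ q k l → q :* (k :* k) :* (con (+ 4) :* l) := con (+ 4) :* (q :* (k :* (k :* l)))) refl (ι q) K (Light.lightProb G θ))
                 (⊗-monoʳ-≤ (0≤⊗ (0≤ι q) (0≤sq K)) (lightProb-large θ tail≤γ)) ,
      ⊗-monoʳ-≤ (0≤ι q) (⊗-monoʳ-≤ (0≤ι k) (⊗-monoʳ-≤ (0≤ι k) (lightProb≤edgeProb G θ)))

    module _ (H : ℕ → ℚ) (0≤H : ∀ X → 0ℚ ≤ H X) (H≤1 : ∀ X → H X ≤ 1ℚ) (H≤penalty : ∀ {ν} X → Plausible ν → H X ≤ penalty ν X) where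

      -- A bad champion is charged in full. Otherwise, if k deg y ≥ 96n, the neighbours of y are
      -- missed with probability below 1/96; and if k deg y ≤ 96n, the batch variance is at most 1 +
      -- 2 · 96 = 193 times a bound x on the mean, and Chebyshev's inequality applies.
      risk≤ : ∀ y → ι 96 ⊗ risk H (y , deg G y) ≤ ι 96 ⊗ bad (y , deg G y) ⊕ 1ℚ
      risk≤ y = go (frequent θ) refl
        where
        θ = deg G y
        open Vertex G y ε
        open Count G θ ε k
        EH = E count H
        0≤EH : 0ℚ ≤ EH
        0≤EH = 0≤E count 0≤H
        EH≤1 : EH ≤ 1ℚ
        EH≤1 = E≤ count H≤1
        rare-miss : ι 96 ⊗ ι n ≤ K ⊗ ι θ → ι 96 ⊗ (missProb k ⊗ EH) ≤ 1ℚ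
        rare-miss le = begin
          ι 96 ⊗ (missProb k ⊗ EH)          ≤⟨ ⊗-monoʳ-≤ (0≤ι 96) (⊗-monoʳ-≤ (0≤missProb k) EH≤1) ⟩
          ι 96 ⊗ (missProb k ⊗ 1ℚ)          ≡⟨ solve 1 (λ m → con (+ 96) :* (m :* con (+ 1)) := con (+ 96) :* m) refl (missProb k) ⟩
          ι 96 ⊗ missProb k                 ≤⟨ ⊗-monoˡ-≤ (0≤missProb k) 96≤ ⟩
          (1ℚ ⊕ K ⊗ nbrProb) ⊗ missProb k   ≤⟨ missProb≤ k ⟩
          1ℚ                                ∎
          where
          open ℚ.≤-Reasoning
          96≤ : ι 96 ≤ 1ℚ ⊕ K ⊗ nbrProb
          96≤ = ≤-by-inverse (ι n) (0≤inv n) inv-n⊗n (≤-cert (ι n ⊕ (K ⊗ ι θ ⊝ ι 96 ⊗ ι n)) (0≤⊕ (0≤ι n) (gap le))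
            (trans (solve 4 (λ n k i t → n :* (con (+ 1) :+ k :* (i :* t)) := n :+ (i :* n) :* (k :* t)) refl (ι n) K (inv n) (ι θ))
              (trans (cong (λ z → ι n ⊕ z ⊗ (K ⊗ ι θ)) inv-n⊗n)
                (solve 2 (λ n x → n :+ con (+ 1) :* x := n :* con (+ 96) :+ (n :+ (x :- con (+ 96) :* n))) refl (ι n) (K ⊗ ι θ)))))
        concentrated : tail G θ ≤ γ → K ⊗ ι θ ≤ ι 96 ⊗ ι n → ι 96 ⊗ (missProb k ⊗ EH) ≤ 1ℚ
        concentrated tail≤γ le = begin
          ι 96 ⊗ (missProb k ⊗ EH)
            ≤⟨ ⊗-monoʳ-≤ (0≤ι 96) (ℚ.≤-trans (⊗-monoˡ-≤ 0≤EH (missProb≤1 k)) (ℚ.≤-reflexive (⊗-identityˡ EH))) ⟩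
          ι 96 ⊗ EH
            ≤⟨ ⊗-monoʳ-≤ (0≤ι 96) (mono count {H} {penalty ν} (λ X → H≤penalty X (plausible θ tail≤γ))) ⟩
          ι 96 ⊗ E count (penalty ν)
            ≡⟨ cong (ι 96 ⊗_) (scale count w (λ X → (ι X ⊝ ν) ⊗ (ι X ⊝ ν))) ⟩
          ι 96 ⊗ (w ⊗ E count (λ X → (ι X ⊝ ν) ⊗ (ι X ⊝ ν)))
            ≤⟨ ⊗-monoʳ-≤ (0≤ι 96) (⊗-monoʳ-≤ 0≤w (ℚ.≤-trans (count-variance (ι 96) le)
                 (⊗-monoʳ-≤ (0≤ι q) (⊗-monoʳ-≤ (0≤⊕ 0≤1 (0≤⊕ (0≤ι 96) (0≤ι 96))) batchMean≤)))) ⟩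
          ι 96 ⊗ (w ⊗ (ι q ⊗ ((1ℚ ⊕ (ι 96 ⊕ ι 96)) ⊗ x)))
            ≡⟨ trans (solve 4 (λ q i y x → con (+ 96) :* (con (+ 16) :* q :* ((i :* y) :* (i :* y)) :* (q :* ((con (+ 1) :+ (con (+ 96) :+ con (+ 96))) :* x)))
                 := con (+ 296448) :* ((i :* q) :* (i :* q) :* (y :* x) :* y)) refl (ι q) (inv q) x⁻¹ x)
               (trans (cong₂ (λ a b → ι 296448 ⊗ (a ⊗ a ⊗ b ⊗ x⁻¹)) (inv⊗ 0<q) x⁻¹⊗x) (solve 1 (λ y → con (+ 296448) :* (con (+ 1) :* con (+ 1) :* con (+ 1) :* y) := con (+ 296448) :* y) refl x⁻¹)) ⟩
          ι 296448 ⊗ x⁻¹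
            ≤⟨ ⊗-monoˡ-≤ 0≤x⁻¹ (ι-mono (ℕ.≤ᵇ⇒≤ 296448 33554432 tt)) ⟩
          ι 33554432 ⊗ x⁻¹
            ≤⟨ x⁻¹-small ⟩
          1ℚ ∎
          where
          open ℚ.≤-Reasoning
          ν = ι q ⊗ batchMean
          batchMean≤ : batchMean ≤ x
          batchMean≤ = ⊗-monoʳ-≤ (0≤ι k) (⊗-monoʳ-≤ (0≤ι k) (lightProb≤edgeProb G θ))
        go : ∀ b → frequent θ ≡ b → ι 96 ⊗ (missProb k ⊗ EH) ≤ ι 96 ⊗ 𝟙 b ⊕ 1ℚ
        go true  _ = ℚ.≤-trans (⊗-monoʳ-≤ (0≤ι 96) (ℚ.≤-trans (⊗-mono-≤ (0≤missProb k) 0≤1 (missProb≤1 k) EH≤1) (ℚ.≤-reflexive (⊗-identityˡ 1ℚ)))) (≤-cert 1ℚ 0≤1 refl)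
        go false infreq = ℚ.≤-trans ([ rare-miss , concentrated (infrequent⇒ θ infreq) ]′ (ℚ.≤-total (ι 96 ⊗ ι n) (K ⊗ ι θ)))
          (ℚ.≤-reflexive (solve 0 (con (+ 1) := con (+ 96) :* con (+ 0) :+ con (+ 1)) refl))

      phase-risk : ι 96 ⊗ E χ (risk H) ≤ ι 2
      phase-risk = begin
        ι 96 ⊗ E χ (risk H)                            ≡⟨ scale χ (ι 96) (risk H) ⟨
        E χ (λ s → ι 96 ⊗ risk H s)                      ≤⟨ champion-mono G (q ℕ.* k) {λ s → ι 96 ⊗ risk H s} {λ s → ι 96 ⊗ bad s ⊕ 1ℚ} risk≤ ⟩
        E χ (λ s → ι 96 ⊗ bad s ⊕ 1ℚ)                  ≡⟨ trans (add χ (λ s → ι 96 ⊗ bad s) (λ _ → 1ℚ)) (cong₂ _⊕_ (scale χ (ι 96) bad) (const χ 1ℚ)) ⟩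
        ι 96 ⊗ E χ bad ⊕ 1ℚ                            ≤⟨ ⊕-mono-≤ 96bad ℚ.≤-refl ⟩
        1ℚ ⊕ 1ℚ                                        ≡⟨ solve 0 (con (+ 1) :+ con (+ 1) := con (+ 2)) refl ⟩
        ι 2                                            ∎
        where
        open ℚ.≤-Reasoning
        96bad : ι 96 ⊗ E χ bad ≤ 1ℚ
        96bad = ℚ.≤-trans (≤-cert (E χ bad) (0≤E χ (λ s → 0≤𝟙 (frequent (proj₂ s))))
          (trans (cong (λ z → (1ℚ ⊕ z) ⊗ E χ bad) (trans (cong (_⊗ γ) (ι-* q k)) (trans (⊗-comm (ι q ⊗ K) γ) γ⊗qK)))
            (solve 1 (λ b → (con (+ 1) :+ con (+ 96)) :* b := con (+ 96) :* b :+ b) refl (E χ bad)))) (champion-frequent (q ℕ.* k))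

module PhaseBounds (G : Graph) {ε : ℚ} (0<ε : 0ℚ < ε) (ε<1 : ε < 1ℚ) (j : ℕ) where
  open Graph G using (n; adj; nonempty)
  open Search (Fin._≟_ {n}) ε
  open Phase G 0<ε ε<1 j

  E-examine : ∀ y θ (H : Stage (Fin n) ⊎ Output → ℚ) → E (⟦_⟧ G (examine j (y , θ))) H ≡
    Vertex.hitProb G y ε k ⊗ H (inj₁ (counting y 0 (hits ε))) ⊕ risk (λ X → H (verdict j X)) (y , θ)
  E-examine y θ H = trans (E->>= G (hitTest y k) (proceed j y θ) H) (trans (Vertex.E-hitTest G y ε k (λ b → E (⟦_⟧ G (proceed j y θ b)) H))
    (cong (λ z → Vertex.hitProb G y ε k ⊗ H (inj₁ (counting y 0 (hits ε))) ⊕ Vertex.missProb G y ε k ⊗ z)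
      (E->>= G (countLight θ k) (λ X → ret (verdict j X)) H)))

  E-phase : ∀ H → E (⟦_⟧ G (searchBody (phase j))) H ≡ E χ (λ s → E (⟦_⟧ G (examine j s)) H)
  E-phase H = E->>= G (champion {κ = additives} (q ℕ.* k)) (examine j) H

  -- `base` has to dominate the counting branch and is also granted to every verdict, so it is paid
  -- once; only the excess `Hx` is averaged over the edge count.
  phase-≤ : ∀ (H : Stage (Fin n) ⊎ Output → ℚ) base (Hx : ℕ → ℚ) → 0ℚ ≤ base →
    (∀ y → H (inj₁ (counting y 0 (hits ε))) ≤ base) → (∀ X → H (verdict j X) ≤ base ⊕ Hx X) →
    E (⟦_⟧ G (searchBody (phase j))) H ≤ base ⊕ E χ (risk Hx)
  phase-≤ H base Hx 0≤base count≤ verdict≤ = begin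
    E (⟦_⟧ G (searchBody (phase j))) H
      ≡⟨ E-phase H ⟩
    E χ (λ s → E (⟦_⟧ G (examine j s)) H)
      ≤⟨ mono χ {λ s → E (⟦_⟧ G (examine j s)) H} {λ s → base ⊕ risk Hx s} (λ s → each (proj₁ s) (proj₂ s)) ⟩
    E χ (λ s → base ⊕ risk Hx s)
      ≡⟨ shift χ base (risk Hx) ⟩
    base ⊕ E χ (risk Hx) ∎
    where
    open ℚ.≤-Reasoning
    each : ∀ y θ → E (⟦_⟧ G (examine j (y , θ))) H ≤ base ⊕ risk Hx (y , θ)
    each y θ = begin
      E (⟦_⟧ G (examine j (y , θ))) H
        ≡⟨ E-examine y θ H ⟩
      h ⊗ H (inj₁ (counting y 0 (hits ε))) ⊕ m ⊗ E C (λ X → H (verdict j X))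
        ≤⟨ ⊕-mono-≤ (⊗-monoʳ-≤ (Vertex.0≤hitProb G y ε k) (count≤ y))
             (⊗-monoʳ-≤ (Vertex.0≤missProb G y ε k) (ℚ.≤-trans (mono C {λ X → H (verdict j X)} {λ X → base ⊕ Hx X} verdict≤) (ℚ.≤-reflexive (shift C base Hx)))) ⟩
      h ⊗ base ⊕ (1ℚ ⊝ h) ⊗ (base ⊕ E C Hx)
        ≡⟨ solve 3 (λ h b e → h :* b :+ (con (+ 1) :- h) :* (b :+ e) := b :+ (con (+ 1) :- h) :* e) refl h base (E C Hx) ⟩
      base ⊕ risk Hx (y , θ) ∎
      where
      h = Vertex.hitProb G y ε k
      m = Vertex.missProb G y ε k
      C = Count.count G θ ε k

  notAccepted : ℕ → ℚ
  notAccepted X = 𝟙 (not (accepted X))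

  accepted⇒ : ∀ X → accepted X ≡ true → acceptance ℕ.* q ℕ.≤ X
  accepted⇒ X eq = ℕ.≤ᵇ⇒≤ _ X (subst T (sym eq) tt)

  rejected⇒ : ∀ X → accepted X ≡ false → X ℕ.≤ acceptance ℕ.* q
  rejected⇒ X eq = ℕ.<⇒≤ (ℕ.≰⇒> (λ le → subst T eq (ℕ.≤⇒≤ᵇ le)))

  0<acceptance : 0 ℕ.< acceptance
  0<acceptance = subst (0 ℕ.<_) (sym acceptance≡) (ℕ.s≤s ℕ.z≤n)

  0<accepted : ∀ X → accepted X ≡ true → 0 ℕ.< X
  0<accepted X eq = ℕ.≤-trans (ℕ.*-mono-≤ 0<acceptance 0<q) (accepted⇒ X eq)

  -- The value `r` of a rejection is 1 from the critical phase on, where rejecting is counted as a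
  -- failure, and 0 shortly before it, where the search merely continues.
  outputRisk : ℚ → ℕ → ℚ
  outputRisk r X = if accepted X then failure G (Correct ε G) (inj₂ (ratio k X)) else r

  0≤failure : ∀ ok o → 0ℚ ≤ failure G ok o
  0≤failure ok o with ok o
  ... | true  = ℚ.≤-refl
  ... | false = 0≤1

  failure≤1 : ∀ ok o → failure G ok o ≤ 1ℚ
  failure≤1 ok o with ok o
  ... | true  = 0≤1
  ... | false = ℚ.≤-refl

  module _ (r : ℚ) (0≤r : 0ℚ ≤ r) (r≤1 : r ≤ 1ℚ) where

    0≤outputRisk : ∀ X → 0ℚ ≤ outputRisk r X
    0≤outputRisk X with accepted X
    ... | true  = 0≤failure (Correct ε G) (inj₂ (ratio k X))
    ... | false = 0≤r

    outputRisk≤1 : ∀ X → outputRisk r X ≤ 1ℚ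
    outputRisk≤1 X with accepted X
    ... | true  = failure≤1 (Correct ε G) (inj₂ (ratio k X))
    ... | false = r≤1

  outputRisk₀≤penalty : ∀ {ν} X → Plausible ν → outputRisk 0ℚ X ≤ penalty ν X
  outputRisk₀≤penalty {ν} X pl = go (accepted X) refl
    where
    go : ∀ b → accepted X ≡ b → (if b then failure G (Correct ε G) (inj₂ (ratio k X)) else 0ℚ) ≤ penalty ν X
    go true  eq = ratio-failure X (0<accepted X eq) pl
    go false _  = 0≤penalty ν X

  module Large (x-large : ι 2 ⊗ ι acceptance ≤ x) where

    -- A rejected X is at most `acceptance` · q, hence at most μ/2.
    rejected-short : ∀ {ν} X → Plausible ν → accepted X ≡ false → 1ℚ ≤ penalty ν X
    rejected-short X pl eq = short X pl (ℚ.≤-trans (⊗-monoʳ-≤ (0≤ι 2) (ι-mono (rejected⇒ X eq)))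
      (ℚ.≤-trans (ℚ.≤-reflexive (trans (cong (ι 2 ⊗_) (ι-* acceptance q)) (solve 3 (λ t a q → t :* (a :* q) := q :* (t :* a)) refl (ι 2) (ι acceptance) (ι q))))
        (⊗-monoʳ-≤ (0≤ι q) x-large)))

    outputRisk₁≤penalty : ∀ {ν} X → Plausible ν → outputRisk 1ℚ X ≤ penalty ν X
    outputRisk₁≤penalty {ν} X pl = go (accepted X) refl
      where
      go : ∀ b → accepted X ≡ b → (if b then failure G (Correct ε G) (inj₂ (ratio k X)) else 1ℚ) ≤ penalty ν X
      go true  eq = ratio-failure X (0<accepted X eq) pl
      go false eq = rejected-short X pl eq

    notAccepted≤penalty : ∀ {ν} X → Plausible ν → notAccepted X ≤ penalty ν X
    notAccepted≤penalty {ν} X pl = go (accepted X) refl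
      where
      go : ∀ b → accepted X ≡ b → 𝟙 (not b) ≤ penalty ν X
      go true  _  = 0≤penalty ν X
      go false eq = rejected-short X pl eq

  -- Markov's inequality: X has mean at most qx, and acceptance requires `acceptance` · q. No lower
  -- bound on x enters, so it applies to phases far below the critical one.
  acceptance-rare : ι acceptance ⊗ E χ (risk (𝟙 ∘ accepted)) ≤ x
  acceptance-rare = subst (_≤ x) (scale χ (ι acceptance) (risk (𝟙 ∘ accepted)))
    (E≤ χ {λ s → ι acceptance ⊗ risk (𝟙 ∘ accepted) s} (λ s → each (proj₁ s) (proj₂ s)))
    where
    markov : ∀ X → ι acceptance ⊗ ι q ⊗ 𝟙 (accepted X) ≤ ι X
    markov X = go (accepted X) refl
      where
      go : ∀ b → accepted X ≡ b → ι acceptance ⊗ ι q ⊗ 𝟙 b ≤ ι X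
      go true  eq = ℚ.≤-trans (ℚ.≤-reflexive (trans (⊗-identityʳ _) (sym (ι-* acceptance q)))) (ι-mono (accepted⇒ X eq))
      go false _  = ℚ.≤-trans (ℚ.≤-reflexive (⊗-zeroʳ _)) (0≤ι X)
    each : ∀ y θ → ι acceptance ⊗ risk (𝟙 ∘ accepted) (y , θ) ≤ x
    each y θ = ≤-by-inverse (ι q) (0≤inv q) (inv⊗ 0<q) (begin
      ι q ⊗ (ι acceptance ⊗ (m ⊗ A))
        ≤⟨ ⊗-monoʳ-≤ (0≤ι q) (⊗-monoʳ-≤ (0≤ι acceptance) (ℚ.≤-trans (⊗-monoˡ-≤ (0≤E C (0≤𝟙 ∘ accepted)) (Vertex.missProb≤1 G y ε k)) (ℚ.≤-reflexive (⊗-identityˡ A)))) ⟩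
      ι q ⊗ (ι acceptance ⊗ A)
        ≡⟨ trans (solve 3 (λ q a e → q :* (a :* e) := a :* q :* e) refl (ι q) (ι acceptance) A) (sym (scale C (ι acceptance ⊗ ι q) (𝟙 ∘ accepted))) ⟩
      E C (λ X → ι acceptance ⊗ ι q ⊗ 𝟙 (accepted X))
        ≤⟨ mono C {λ X → ι acceptance ⊗ ι q ⊗ 𝟙 (accepted X)} {ι} markov ⟩
      E C ι
        ≡⟨ Count.count-mean G θ ε k ⟩
      ι q ⊗ Count.batchMean G θ ε k
        ≤⟨ ⊗-monoʳ-≤ (0≤ι q) (⊗-monoʳ-≤ (0≤ι k) (⊗-monoʳ-≤ (0≤ι k) (lightProb≤edgeProb G θ))) ⟩
      ι q ⊗ x ∎)
      where
      open ℚ.≤-Reasoning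
      C = Count.count G θ ε k
      m = Vertex.missProb G y ε k
      A = E C (𝟙 ∘ accepted)

  -- Without isolated vertices d ≥ 1, so 1/n ≤ d/n. This turns the k³/n cost of the repeats into a
  -- multiple of kx.
  inv-n≤p : inv n ≤ p
  inv-n≤p = subst (_≤ p) (⊗-identityʳ (inv n)) (⊗-monoʳ-≤ (0≤inv n) (subst (_≤ inv n ⊗ ι (twoM G)) (inv⊗ nonempty) (⊗-monoʳ-≤ (0≤inv n) (ι-mono (n≤twoM G)))))

  countingCost : Fin n → ℕ → ℚ
  countingCost y = awaitCost (ι 2) (ι 4) (Vertex.nbrProb⁻¹ G y ε)

  examine-cost : ∀ y θ → cost G (examine j (y , θ)) ≤ ι 4 ⊗ K ⊕ ι q ⊗ (ι 3 ⊕ ι 8 ⊗ K ⊕ ι 9 ⊗ (K ⊗ K ⊗ K ⊗ p))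
  examine-cost y θ = begin
    cost G (examine j (y , θ))
      ≡⟨ trans (cost->>= G (hitTest y k) (proceed j y θ)) (cong (cost G (hitTest y k) ⊕_) (Vertex.E-hitTest G y ε k (λ b → cost G (proceed j y θ b)))) ⟩
    cost G (hitTest y k) ⊕ (h ⊗ 0ℚ ⊕ m ⊗ cost G (proceed j y θ false))
      ≡⟨ cong (cost G (hitTest y k) ⊕_) (trans (cong₂ _⊕_ (⊗-zeroʳ h) (cong (m ⊗_) (trans (cost->>= G (countLight θ k) (λ X → ret (verdict j X)))
           (trans (cong (cost G (countLight θ k) ⊕_) (const (Count.count G θ ε k) 0ℚ)) (⊕-identityʳ _))))) (⊕-identityˡ _)) ⟩
    cost G (hitTest y k) ⊕ m ⊗ cost G (countLight θ k)
      ≤⟨ ⊕-mono-≤ (Vertex.hitTest-cost G y ε k) (ℚ.≤-trans (⊗-monoˡ-≤ (0≤cost G (countLight θ k)) (Vertex.missProb≤1 G y ε k)) (ℚ.≤-trans (ℚ.≤-reflexive (⊗-identityˡ _))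
           (ℚ.≤-trans (Count.count-cost G θ ε k) (⊗-monoʳ-≤ (0≤ι q) (⊕-mono-≤ ℚ.≤-refl (⊗-monoʳ-≤ (0≤ι 9) (⊗-monoʳ-≤ (0≤⊗ (0≤⊗ (0≤ι k) (0≤ι k)) (0≤ι k)) inv-n≤p))))))) ⟩
    ι 4 ⊗ K ⊕ ι q ⊗ (ι 3 ⊕ ι 8 ⊗ K ⊕ ι 9 ⊗ (K ⊗ K ⊗ K ⊗ p)) ∎
    where
    open ℚ.≤-Reasoning
    h = Vertex.hitProb G y ε k
    m = Vertex.missProb G y ε k

  -- A hit is as rare as the search it triggers is long.
  hit-cost : ∀ y → Vertex.hitProb G y ε k ⊗ countingCost y (hits ε) ≤ ι 2 ⊕ ι 60 ⊗ (ι q ⊗ K)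
  hit-cost y = begin
    h ⊗ (ι 2 ⊕ ι (hits ε) ⊗ ((1ℚ ⊕ ι 4) ⊗ b))
      ≡⟨ trans (cong (λ t → h ⊗ (ι 2 ⊕ t ⊗ ((1ℚ ⊕ ι 4) ⊗ b))) (ι-* 12 q))
           (solve 3 (λ h q b → h :* (con (+ 2) :+ (con (+ 12) :* q) :* ((con (+ 1) :+ con (+ 4)) :* b)) := h :* con (+ 2) :+ h :* (con (+ 60) :* (q :* b))) refl h (ι q) b) ⟩
    h ⊗ ι 2 ⊕ h ⊗ (ι 60 ⊗ (ι q ⊗ b))
      ≤⟨ ⊕-mono-≤ (⊗-monoˡ-≤ (0≤ι 2) (Vertex.hitProb≤1 G y ε k)) (⊗-monoˡ-≤ (0≤⊗ (0≤ι 60) (0≤⊗ (0≤ι q) (0≤⊗ (0≤ι n) (0≤inv (deg G y))))) (Vertex.hitProb≤ G y ε k)) ⟩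
    1ℚ ⊗ ι 2 ⊕ K ⊗ a ⊗ (ι 60 ⊗ (ι q ⊗ b))
      ≡⟨ trans (solve 4 (λ k a q b → con (+ 1) :* con (+ 2) :+ k :* a :* (con (+ 60) :* (q :* b)) := con (+ 2) :+ con (+ 60) :* (q :* k) :* (b :* a)) refl K a (ι q) b)
           (cong (ι 2 ⊕_) (trans (cong (ι 60 ⊗ (ι q ⊗ K) ⊗_) (Vertex.nbrProb-inverse G y ε)) (⊗-identityʳ _))) ⟩
    ι 2 ⊕ ι 60 ⊗ (ι q ⊗ K) ∎
    where
    open ℚ.≤-Reasoning
    h = Vertex.hitProb G y ε k
    a = Vertex.nbrProb G y ε
    b = Vertex.nbrProb⁻¹ G y ε

  phase-cost : ∀ (Φ : Stage (Fin n) → ℚ) → (∀ y → Φ (counting y 0 (hits ε)) ≡ countingCost y (hits ε)) →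
    1ℚ ⊕ (cost G (searchBody (phase j)) ⊕ E (⟦_⟧ G (searchBody (phase j))) (onLoop G Φ (λ _ → 0ℚ)))
      ≤ ι 84 ⊗ (ι q ⊗ K) ⊕ ι 9 ⊗ (ι q ⊗ K ⊗ x) ⊕ Φ (phase (suc j)) ⊗ E χ (risk notAccepted)
  phase-cost Φ Φ-counting = begin
    1ℚ ⊕ (cost G (searchBody (phase j)) ⊕ E (⟦_⟧ G (searchBody (phase j))) Φ̂)
      ≡⟨ cong (1ℚ ⊕_) (trans (cong₂ _⊕_ (trans (cost->>= G (champion {κ = additives} (q ℕ.* k)) (examine j)) (cong (_⊕ E χ (λ s → cost G (examine j s)))
           (trans (champion-cost G (q ℕ.* k)) (cong (λ z → ι 3 ⊕ ι 3 ⊗ z) (ι-* q k))))) (E-phase Φ̂))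
           (trans (⊕-assoc _ _ _) (cong (ι 3 ⊕ ι 3 ⊗ (ι q ⊗ K) ⊕_) (sym (add χ (λ s → cost G (examine j s)) (λ s → E (⟦_⟧ G (examine j s)) Φ̂)))))) ⟩
    1ℚ ⊕ (ι 3 ⊕ ι 3 ⊗ (ι q ⊗ K) ⊕ E χ (λ s → cost G (examine j s) ⊕ E (⟦_⟧ G (examine j s)) Φ̂))
      ≤⟨ ⊕-mono-≤ (ℚ.≤-refl {1ℚ}) (⊕-mono-≤ ℚ.≤-refl (mono χ {λ s → cost G (examine j s) ⊕ E (⟦_⟧ G (examine j s)) Φ̂} {λ s → B ⊕ Φ′ ⊗ risk notAccepted s} (λ s → each (proj₁ s) (proj₂ s)))) ⟩
    1ℚ ⊕ (ι 3 ⊕ ι 3 ⊗ (ι q ⊗ K) ⊕ E χ (λ s → B ⊕ Φ′ ⊗ risk notAccepted s))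
      ≡⟨ cong (λ z → 1ℚ ⊕ (ι 3 ⊕ ι 3 ⊗ (ι q ⊗ K) ⊕ z)) (trans (shift χ B (λ s → Φ′ ⊗ risk notAccepted s)) (cong (B ⊕_) (scale χ Φ′ (risk notAccepted)))) ⟩
    1ℚ ⊕ (ι 3 ⊕ ι 3 ⊗ (ι q ⊗ K) ⊕ (B ⊕ Φ′ ⊗ E χ (risk notAccepted)))
      -- The terms 6 + 71qK + 4K + 3q are all raised to multiples of qK, and 6 + 71 + 4 + 3 = 84.
      ≤⟨ ≤-cert (ι 6 ⊗ ((ι q ⊝ 1ℚ) ⊗ K ⊕ (K ⊝ 1ℚ)) ⊕ (ι 4 ⊗ ((ι q ⊝ 1ℚ) ⊗ K) ⊕ ι 3 ⊗ (ι q ⊗ (K ⊝ 1ℚ))))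
           (0≤⊕ (0≤⊗ (0≤ι 6) (0≤⊕ 0≤q-1K 0≤K-1)) (0≤⊕ (0≤⊗ (0≤ι 4) 0≤q-1K) (0≤⊗ (0≤ι 3) (0≤⊗ (0≤ι q) 0≤K-1))))
           (solve 4 (λ q k p r → con (+ 84) :* (q :* k) :+ con (+ 9) :* (q :* k :* (k :* (k :* p))) :+ r :=
             con (+ 1) :+ (con (+ 3) :+ con (+ 3) :* (q :* k) :+ ((con (+ 4) :* k :+ q :* (con (+ 3) :+ con (+ 8) :* k :+ con (+ 9) :* (k :* k :* k :* p)) :+ (con (+ 2) :+ con (+ 60) :* (q :* k))) :+ r))
             :+ (con (+ 6) :* ((q :- con (+ 1)) :* k :+ (k :- con (+ 1))) :+ (con (+ 4) :* ((q :- con (+ 1)) :* k) :+ con (+ 3) :* (q :* (k :- con (+ 1)))))) refl (ι q) K p (Φ′ ⊗ E χ (risk notAccepted))) ⟩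
    ι 84 ⊗ (ι q ⊗ K) ⊕ ι 9 ⊗ (ι q ⊗ K ⊗ x) ⊕ Φ′ ⊗ E χ (risk notAccepted) ∎
    where
    open ℚ.≤-Reasoning
    Φ̂ = onLoop G Φ (λ _ → 0ℚ)
    Φ′ = Φ (phase (suc j))
    B = ι 4 ⊗ K ⊕ ι q ⊗ (ι 3 ⊕ ι 8 ⊗ K ⊕ ι 9 ⊗ (K ⊗ K ⊗ K ⊗ p)) ⊕ (ι 2 ⊕ ι 60 ⊗ (ι q ⊗ K))
    0≤K-1 : 0ℚ ≤ K ⊝ 1ℚ
    0≤K-1 = gap (ι-mono 0<k)
    0≤q-1K : 0ℚ ≤ (ι q ⊝ 1ℚ) ⊗ K
    0≤q-1K = 0≤⊗ (gap (ι-mono 0<q)) (0≤ι k)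
    verdict≡ : ∀ X → Φ̂ (verdict j X) ≡ Φ′ ⊗ notAccepted X
    verdict≡ X with accepted X
    ... | true  = sym (⊗-zeroʳ Φ′)
    ... | false = sym (⊗-identityʳ Φ′)
    each : ∀ y θ → cost G (examine j (y , θ)) ⊕ E (⟦_⟧ G (examine j (y , θ))) Φ̂ ≤ B ⊕ Φ′ ⊗ risk notAccepted (y , θ)
    each y θ = ℚ.≤-trans (⊕-mono-≤ (examine-cost y θ) (ℚ.≤-trans (ℚ.≤-reflexive (E-examine y θ Φ̂))
        (⊕-mono-≤ (ℚ.≤-trans (ℚ.≤-reflexive (cong (Vertex.hitProb G y ε k ⊗_) (Φ-counting y))) (hit-cost y)) (ℚ.≤-reflexive rest))))
      (ℚ.≤-reflexive (sym (⊕-assoc _ (ι 2 ⊕ ι 60 ⊗ (ι q ⊗ K)) (Φ′ ⊗ risk notAccepted (y , θ)))))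
      where
      C = Count.count G θ ε k
      rest : risk (λ X → Φ̂ (verdict j X)) (y , θ) ≡ Φ′ ⊗ risk notAccepted (y , θ)
      rest = trans (cong (Vertex.missProb G y ε k ⊗_) (trans (E-cong C verdict≡) (scale C Φ′ notAccepted)))
        (solve 3 (λ m f e → m :* (f :* e) := f :* (m :* e)) refl (Vertex.missProb G y ε k) Φ′ (E C notAccepted))

-- Failure probability over all phases

quarter : ℕ → ℚ
quarter zero    = 1ℚ
quarter (suc t) = inv 4 ⊗ quarter t

0≤quarter : ∀ t → 0ℚ ≤ quarter t
0≤quarter zero    = 0≤1
0≤quarter (suc t) = 0≤⊗ (0≤inv 4) (0≤quarter t)

quarter-inverse : ∀ t → quarter t ⊗ (ι (2 ℕ.^ t) ⊗ ι (2 ℕ.^ t)) ≡ 1ℚ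
quarter-inverse zero    = trans (⊗-identityˡ _) (⊗-identityˡ 1ℚ)
quarter-inverse (suc t) = trans (cong (λ a → inv 4 ⊗ quarter t ⊗ (a ⊗ a)) (ι-* 2 (2 ℕ.^ t)))
  (trans (solve 3 (λ i c a → i :* c :* ((con (+ 2) :* a) :* (con (+ 2) :* a)) := (i :* con (+ 4)) :* (c :* (a :* a))) refl (inv 4) (quarter t) (ι (2 ℕ.^ t)))
    (trans (cong₂ _⊗_ (inv-inverse 3) (quarter-inverse t)) (⊗-identityˡ 1ℚ)))

-- Failure bounds in units of 1/96: 8 is the failure probability of the counting loop, level i bounds that of a run
-- which is i phases short of the critical one.
rise : ℕ → ℚ
rise (suc (suc (suc t))) = ι 3 ⊗ quarter t
rise _                   = ι 3

level : ℕ → ℚ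
level zero    = ι 11
level (suc i) = level i ⊕ rise i

0≤rise : ∀ i → 0ℚ ≤ rise i
0≤rise zero                = 0≤ι 3
0≤rise (suc zero)          = 0≤ι 3
0≤rise (suc (suc zero))    = 0≤ι 3
0≤rise (suc (suc (suc t))) = 0≤⊗ (0≤ι 3) (0≤quarter t)

level-suc : ∀ i → level i ≤ level (suc i)
level-suc i = ≤-cert (rise i) (0≤rise i) refl

11≤level : ∀ i → ι 11 ≤ level i
11≤level zero    = ℚ.≤-refl
11≤level (suc i) = ℚ.≤-trans (11≤level i) (level-suc i)

-- Three rises of 3 and the geometric series 3(1 + 1/4 + ...) = 4 lead from 11 up to 24, that is, to
-- a failure probability of 24/96 = 1/4.
level-sum : ∀ t → level (suc (suc (suc t))) ⊕ ι 4 ⊗ quarter t ≡ ι 24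
level-sum zero    = solve 0 (con (+ 11) :+ con (+ 3) :+ con (+ 3) :+ con (+ 3) :+ con (+ 4) :* con (+ 1) := con (+ 24)) refl
level-sum (suc t) = trans (solve 3 (λ l c i → l :+ con (+ 3) :* c :+ con (+ 4) :* (i :* c) := l :+ con (+ 3) :* c :+ (i :* con (+ 4)) :* c) refl (level (suc (suc (suc t)))) (quarter t) (inv 4))
  (trans (cong (λ z → level (suc (suc (suc t))) ⊕ ι 3 ⊗ quarter t ⊕ z ⊗ quarter t) (inv-inverse 3))
    (trans (solve 2 (λ l c → l :+ con (+ 3) :* c :+ con (+ 1) :* c := l :+ con (+ 4) :* c) refl (level (suc (suc (suc t)))) (quarter t)) (level-sum t)))

level≤24 : ∀ i → level i ≤ ι 24
level≤24 i = ℚ.≤-trans (ℚ.≤-trans (level-suc i) (ℚ.≤-trans (level-suc (suc i)) (level-suc (suc (suc i)))))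
  (≤-cert (ι 4 ⊗ quarter i) (0≤⊗ (0≤ι 4) (0≤quarter i)) (sym (level-sum i)))

n≤2^n : ∀ n → n ℕ.≤ 2 ℕ.^ n
n≤2^n zero    = ℕ.z≤n
n≤2^n (suc n) = ℕ.+-mono-≤ (ℕ.m^n>0 2 n) (ℕ.≤-trans (n≤2^n n) (ℕ.m≤m+n _ 0))

module Additive (G : Graph) {ε : ℚ} (0<ε : 0ℚ < ε) (ε<1 : ε < 1ℚ) where
  open Graph G using (n; adj; nonempty)
  open Search (Fin._≟_ {n}) ε using (searchBody; accepted; verdict; ratio; adjacentTrial)
  module Ph = Phase G 0<ε ε<1
  module PB = PhaseBounds G 0<ε ε<1

  q : ℚ
  q = ι (inverseSquare ε)

  p : ℚ
  p = edgeProb G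

  K x : ℕ → ℚ
  K j = ι (2 ℕ.^ j)
  x j = K j ⊗ (K j ⊗ p)

  0≤q : 0ℚ ≤ q
  0≤q = 0≤ι (inverseSquare ε)

  0≤K : ∀ j → 0ℚ ≤ K j
  0≤K j = 0≤ι (2 ℕ.^ j)

  0≤x : ∀ j → 0ℚ ≤ x j
  0≤x = Ph.0≤x

  K-suc : ∀ j → K (suc j) ≡ ι 2 ⊗ K j
  K-suc j = ι-* 2 (2 ℕ.^ j)

  x-shift : ∀ j m → x (j ℕ.+ m) ≡ (K m ⊗ K m) ⊗ x j
  x-shift j m = trans (cong (λ z → z ⊗ (z ⊗ p)) (trans (cong ι (ℕ.^-distribˡ-+-* 2 j m)) (ι-* (2 ℕ.^ j) (2 ℕ.^ m))))
    (solve 3 (λ a b p → a :* b :* (a :* b :* p) := (b :* b) :* (a :* (a :* p))) refl (K j) (K m) p)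

  x-mono : ∀ {i j} → i ℕ.≤ j → x i ≤ x j
  x-mono {i} {j} i≤j = ⊗-mono-≤ (0≤K i) (0≤⊗ (0≤K j) (0≤edgeProb G)) Ki≤Kj (⊗-monoˡ-≤ (0≤edgeProb G) Ki≤Kj)
    where Ki≤Kj = ι-mono (ℕ.^-monoʳ-≤ 2 i≤j)

  -- x J lies between 2³¹ = 2 · acceptance and 2³³.
  critical : ∃ λ J → ι 2147483648 ≤ x J × x J ≤ ι 8589934592
  critical = search N (ℚ.≤-trans reach (⊗-mono-≤ (0≤ι 1) (0≤⊗ (0≤K N) (0≤edgeProb G)) (ι-mono (ℕ.m^n>0 2 N)) ℚ.≤-refl))
    where
    N = proj₁ (archimedean (ι 2147483648 ⊗ ρ G))
    reach : ι 2147483648 ≤ 1ℚ ⊗ (K N ⊗ p)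
    reach = ℚ.≤-trans (ℚ.≤-reflexive (sym (trans (⊗-assoc (ι 2147483648) (ρ G) p) (trans (cong (ι 2147483648 ⊗_) (ρ⊗edgeProb G)) (⊗-identityʳ _)))))
      (ℚ.≤-trans (⊗-monoˡ-≤ (0≤edgeProb G) (ℚ.≤-trans (proj₂ (archimedean (ι 2147483648 ⊗ ρ G))) (ι-mono (n≤2^n N)))) (ℚ.≤-reflexive (sym (⊗-identityˡ _))))
    p≤1 : p ≤ 1ℚ
    p≤1 = subst₂ _≤_ (⊗-identityˡ p) (ρ⊗edgeProb G) (⊗-monoˡ-≤ (0≤edgeProb G) (1≤ρ G))
    search : ∀ j → ι 2147483648 ≤ x j → ∃ λ J → ι 2147483648 ≤ x J × x J ≤ ι 8589934592
    search zero    le = 0 , le , ℚ.≤-trans (ℚ.≤-reflexive (trans (⊗-identityˡ _) (⊗-identityˡ p))) (ℚ.≤-trans p≤1 (ι-mono (ℕ.≤ᵇ⇒≤ 1 8589934592 tt)))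
    search (suc j) le = [ stop , search j ]′ (ℚ.≤-total (x j) (ι 2147483648))
      where
      stop : x j ≤ ι 2147483648 → ∃ λ J → ι 2147483648 ≤ x J × x J ≤ ι 8589934592
      stop small = suc j , le , ≤-cert (ι 4 ⊗ (ι 2147483648 ⊝ x j)) (0≤⊗ (0≤ι 4) (gap small))
        (trans (solve 1 (λ x → con (+ 8589934592) := con (+ 4) :* x :+ con (+ 4) :* (con (+ 2147483648) :- x)) refl (x j))
          (cong (_⊕ ι 4 ⊗ (ι 2147483648 ⊝ x j)) (sym (trans (cong (λ z → z ⊗ (z ⊗ p)) (K-suc j))
            (solve 2 (λ k p → con (+ 2) :* k :* (con (+ 2) :* k :* p) := con (+ 4) :* (k :* (k :* p))) refl (K j) p)))))

  module Critical (J : ℕ) (x-J-large : ι 2147483648 ≤ x J) (x-J-small : x J ≤ ι 8589934592) where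

    ∸-next : ∀ {j i} → J ℕ.∸ j ≡ suc i → J ℕ.∸ suc j ≡ i
    ∸-next {j} {i} eq = trans (sym (ℕ.pred[m∸n]≡m∸[1+n] J j)) (cong ℕ.pred eq)

    ∸-positive : ∀ {j i} → J ℕ.∸ j ≡ suc i → j ℕ.≤ J
    ∸-positive {j} {i} eq = [ (λ j≤J → j≤J) , (λ J≤j → contradiction (trans (sym eq) (ℕ.m≤n⇒m∸n≡0 J≤j)) λ ()) ]′ (ℕ.≤-total j J)

    ∸-sum : ∀ {j i} → J ℕ.∸ j ≡ suc i → J ≡ j ℕ.+ suc i
    ∸-sum {j} {i} eq = trans (sym (ℕ.m+[n∸m]≡n (∸-positive {j} eq))) (cong (j ℕ.+_) eq)

    x-before : ∀ {j i} → J ℕ.∸ j ≡ suc i → x J ≡ (K (suc i) ⊗ K (suc i)) ⊗ x j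
    x-before {j} {i} eq = trans (cong x (∸-sum {j} eq)) (x-shift j (suc i))

    J≤ : ∀ {j} → J ℕ.∸ j ≡ 0 → J ℕ.≤ j
    J≤ = ℕ.m∸n≡0⇒m≤n

    u : ℚ
    u = inv 96

    96u : ι 96 ⊗ u ≡ 1ℚ
    96u = trans (⊗-comm (ι 96) u) (inv-inverse 95)

    0≤u : 0ℚ ≤ u
    0≤u = 0≤inv 96

    -- The subtraction is truncated, so all phases from `J` on share the bound 11/96. They can,
    -- because a rejection in any of them is counted as a failure rather than followed further.
    F : Stage (Fin n) → ℚ
    F (phase j)        = u ⊗ level (J ℕ.∸ j)
    F (counting y N r) = awaitFailure ε (Vertex.nbrProb G y ε) N r

    0≤level : ∀ i → 0ℚ ≤ level i
    0≤level i = ℚ.≤-trans (0≤ι 11) (11≤level i)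

    0≤F : ∀ l → 0ℚ ≤ F l
    0≤F (phase j)        = 0≤⊗ 0≤u (0≤level (J ℕ.∸ j))
    0≤F (counting y N r) = 0≤awaitFailure ε (Vertex.nbrProb G y ε) N r

    ok : Output → Bool
    ok = Correct ε G

    F̂ : Stage (Fin n) ⊎ Output → ℚ
    F̂ = onLoop G F (failure G ok)

    F-counting : ∀ y → F (counting y 0 (hits ε)) ≡ u ⊗ ι 8
    F-counting y = begin
      a                       ≡⟨ ⊗-identityˡ a ⟨
      1ℚ ⊗ a                  ≡⟨ cong (_⊗ a) 96u ⟨
      ι 96 ⊗ u ⊗ a            ≡⟨ solve 2 (λ u a → con (+ 96) :* u :* a := u :* con (+ 8) :* (con (+ 12) :* a)) refl u a ⟩
      u ⊗ ι 8 ⊗ (ι 12 ⊗ a)    ≡⟨ trans (cong (u ⊗ ι 8 ⊗_) (awaitFailure-start ε (Vertex.nbrProb G y ε))) (⊗-identityʳ _) ⟩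
      u ⊗ ι 8                 ∎
      where
      open ≡-Reasoning
      a = awaitFailure ε (Vertex.nbrProb G y ε) 0 (hits ε)

    u-level≤1 : ∀ i → u ⊗ level i ≤ 1ℚ
    u-level≤1 i = subst (u ⊗ level i ≤_) (trans (⊗-comm u (ι 96)) 96u) (⊗-monoʳ-≤ 0≤u (ℚ.≤-trans (level≤24 i) (ι-mono (ℕ.≤ᵇ⇒≤ 24 96 tt))))

    8≤level : ∀ i → u ⊗ ι 8 ≤ u ⊗ level i
    8≤level i = ⊗-monoʳ-≤ 0≤u (ℚ.≤-trans (ι-mono (ℕ.≤ᵇ⇒≤ 8 11 tt)) (11≤level i))

    in-units : ∀ {r c} → ι 96 ⊗ r ≤ c → r ≤ u ⊗ c
    in-units {r} {c} le = subst (_≤ u ⊗ c) (trans (sym (⊗-assoc u (ι 96) r)) (trans (cong (_⊗ r) (trans (⊗-comm u (ι 96)) 96u)) (⊗-identityˡ r))) (⊗-monoʳ-≤ 0≤u le)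

    extreme : ∀ {j} → ι 2147483648 ≤ x j → ι 2 ⊗ ι acceptance ≤ x j
    extreme {j} le = subst (_≤ x j) (trans (ι-* 2 1073741824) (cong (λ a → ι 2 ⊗ ι a) (sym acceptance≡))) le

    -- From `J` on: 8 units for the counting loop and 2 for `phase-risk`, within 11. One to three
    -- phases before `J`: x is still at least 2³¹/64 = 2²⁵, just enough for `phase-risk`. Further
    -- back: any acceptance is counted as a failure, and Markov's inequality makes it rare.
    F-phase : ∀ j i → J ℕ.∸ j ≡ i → E (⟦_⟧ G (searchBody (phase j))) F̂ ≤ u ⊗ level i
    F-phase j zero eq = ℚ.≤-trans
      (PB.phase-≤ j F̂ (u ⊗ ι 8) (PB.outputRisk j 1ℚ) (0≤⊗ 0≤u (0≤ι 8)) (λ y → ℚ.≤-reflexive (F-counting y)) verdict≤)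
      (ℚ.≤-trans (⊕-mono-≤ (ℚ.≤-refl {u ⊗ ι 8}) (in-units (Ph.phase-risk j (ℚ.≤-trans (ι-mono (ℕ.≤ᵇ⇒≤ 33554432 2147483648 tt)) large) (PB.outputRisk j 1ℚ)
          (PB.0≤outputRisk j 1ℚ 0≤1 ℚ.≤-refl) (PB.outputRisk≤1 j 1ℚ 0≤1 ℚ.≤-refl) (PB.Large.outputRisk₁≤penalty j (extreme {j} large)))))
        (≤-cert (u ⊗ ι 1) (0≤⊗ 0≤u (0≤ι 1)) (solve 1 (λ u → u :* con (+ 11) := u :* con (+ 8) :+ u :* con (+ 2) :+ u :* con (+ 1)) refl u)))
      where
      large : ι 2147483648 ≤ x j
      large = ℚ.≤-trans x-J-large (x-mono (J≤ {j} eq))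
      verdict≤ : ∀ X → F̂ (verdict j X) ≤ u ⊗ ι 8 ⊕ PB.outputRisk j 1ℚ X
      verdict≤ X with accepted X
      ... | true  = ≤-cert (u ⊗ ι 8) (0≤⊗ 0≤u (0≤ι 8)) (⊕-comm (u ⊗ ι 8) _)
      ... | false = ℚ.≤-trans (u-level≤1 (J ℕ.∸ suc j)) (≤-cert (u ⊗ ι 8) (0≤⊗ 0≤u (0≤ι 8)) (⊕-comm (u ⊗ ι 8) 1ℚ))
    F-phase j (suc i) eq = go i refl
      where
      next : F (phase (suc j)) ≡ u ⊗ level i
      next = cong (λ i → u ⊗ level i) (∸-next {j} eq)
      base : ∀ Hx → (∀ X → F̂ (verdict j X) ≤ u ⊗ level i ⊕ Hx X) → E (Ph.χ j) (Ph.risk j Hx) ≤ u ⊗ rise i →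
        E (⟦_⟧ G (searchBody (phase j))) F̂ ≤ u ⊗ level (suc i)
      base Hx verdict≤ risk≤ = ℚ.≤-trans
        (PB.phase-≤ j F̂ (u ⊗ level i) Hx (0≤⊗ 0≤u (0≤level i)) (λ y → ℚ.≤-trans (ℚ.≤-reflexive (F-counting y)) (8≤level i)) verdict≤)
        (ℚ.≤-trans (⊕-mono-≤ (ℚ.≤-refl {u ⊗ level i}) risk≤) (ℚ.≤-reflexive (sym (⊗-distribˡ u (level i) (rise i)))))
      near : i ℕ.≤ 2 → rise i ≡ ι 3 → E (⟦_⟧ G (searchBody (phase j))) F̂ ≤ u ⊗ level (suc i)
      near i≤2 rise≡ = base (PB.outputRisk j 0ℚ) verdict≤ (subst (λ r → E (Ph.χ j) (Ph.risk j (PB.outputRisk j 0ℚ)) ≤ u ⊗ r) (sym rise≡)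
        (ℚ.≤-trans (in-units (Ph.phase-risk j large (PB.outputRisk j 0ℚ) (PB.0≤outputRisk j 0ℚ ℚ.≤-refl 0≤1) (PB.outputRisk≤1 j 0ℚ ℚ.≤-refl 0≤1)
            (PB.outputRisk₀≤penalty j))) (⊗-monoʳ-≤ 0≤u (ι-mono (ℕ.≤ᵇ⇒≤ 2 3 tt)))))
        where
        verdict≤ : ∀ X → F̂ (verdict j X) ≤ u ⊗ level i ⊕ PB.outputRisk j 0ℚ X
        verdict≤ X with accepted X
        ... | true  = ≤-cert (u ⊗ level i) (0≤⊗ 0≤u (0≤level i)) (⊕-comm (u ⊗ level i) _)
        ... | false = ℚ.≤-reflexive (trans next (sym (⊕-identityʳ _)))
        K≤8 : K (suc i) ≤ ι 8
        K≤8 = ι-mono (ℕ.^-monoʳ-≤ 2 (ℕ.s≤s i≤2))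
        large : ι 33554432 ≤ x j
        large = ≤-by-inverse (ι 64) (0≤inv 64) (inv-inverse 63) (ℚ.≤-trans (ℚ.≤-reflexive (sym (ι-* 64 33554432)))
          (ℚ.≤-trans x-J-large (ℚ.≤-trans (ℚ.≤-reflexive (x-before {j} eq)) (⊗-monoˡ-≤ (0≤x j)
            (ℚ.≤-trans (⊗-mono-≤ (0≤K (suc i)) (0≤ι 8) K≤8 K≤8) (ℚ.≤-reflexive (sym (ι-* 8 8))))))))
      far : ∀ t → i ≡ suc (suc (suc t)) → E (⟦_⟧ G (searchBody (phase j))) F̂ ≤ u ⊗ level (suc i)
      far t refl = base (𝟙 ∘ accepted) verdict≤ risk≤
        where
        verdict≤ : ∀ X → F̂ (verdict j X) ≤ u ⊗ level i ⊕ 𝟙 (accepted X)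
        verdict≤ X with accepted X
        ... | true  = ℚ.≤-trans (PB.failure≤1 j ok (inj₂ (ratio (2 ℕ.^ j) X))) (≤-cert (u ⊗ level i) (0≤⊗ 0≤u (0≤level i)) (⊕-comm (u ⊗ level i) 1ℚ))
        ... | false = ℚ.≤-reflexive (trans next (sym (⊕-identityʳ _)))
        c = quarter t
        L = ι acceptance
        R = E (Ph.χ j) (Ph.risk j (𝟙 ∘ accepted))
        K≡ : K (suc i) ≡ ι 16 ⊗ K t
        K≡ = trans (cong ι (ℕ.^-distribˡ-+-* 2 4 t)) (ι-* 16 (2 ℕ.^ t))
        -- The phase precedes `J` by t + 4, so x j = x J / (256 · 4^t) with x J ≤ 2³³. Markov's
        -- bound x j / 2³⁰ is then at most 1/(32 · 4^t), which is (3/96) · 4^(-t), the rise at this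
        -- level.
        256x≤ : ι 256 ⊗ x j ≤ c ⊗ (ι 8 ⊗ L)
        256x≤ = subst₂ _≤_
          (trans (cong (λ z → c ⊗ z) (trans (x-before {j} eq) (cong (λ z → (z ⊗ z) ⊗ x j) K≡)))
            (trans (solve 3 (λ c k x → c :* ((con (+ 16) :* k) :* (con (+ 16) :* k) :* x) := c :* (k :* k) :* (con (+ 256) :* x)) refl c (K t) (x j))
              (trans (cong (_⊗ (ι 256 ⊗ x j)) (quarter-inverse t)) (⊗-identityˡ _))))
          (cong (c ⊗_) (trans (ι-* 8 1073741824) (cong (λ a → ι 8 ⊗ ι a) (sym acceptance≡))))
          (⊗-monoʳ-≤ (0≤quarter t) x-J-small)
        risk≤ : R ≤ u ⊗ (ι 3 ⊗ c)
        risk≤ = ≤-by-inverse (ι 8) (0≤inv 8) (inv-inverse 7) (≤-by-inverse L (0≤inv acceptance) (inv⊗ (PB.0<acceptance j))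
          (≤-cert (ι 8 ⊗ (x j ⊝ L ⊗ R) ⊕ ι 3 ⊗ u ⊗ (c ⊗ (ι 8 ⊗ L) ⊝ ι 256 ⊗ x j))
            (0≤⊕ (0≤⊗ (0≤ι 8) (gap (PB.acceptance-rare j))) (0≤⊗ (0≤⊗ (0≤ι 3) 0≤u) (gap 256x≤)))
            (trans (solve 4 (λ L u c x → L :* (con (+ 8) :* (u :* (con (+ 3) :* c))) := con (+ 8) :* (con (+ 96) :* u) :* x :+ con (+ 3) :* u :* (c :* (con (+ 8) :* L) :- con (+ 256) :* x)) refl L u c (x j))
              (trans (cong (λ z → ι 8 ⊗ z ⊗ x j ⊕ ι 3 ⊗ u ⊗ (c ⊗ (ι 8 ⊗ L) ⊝ ι 256 ⊗ x j)) 96u)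
                (solve 4 (λ L R x r → con (+ 8) :* con (+ 1) :* x :+ r := L :* (con (+ 8) :* R) :+ (con (+ 8) :* (x :- L :* R) :+ r)) refl L R (x j) _)))))
      go : ∀ i′ → i ≡ i′ → E (⟦_⟧ G (searchBody (phase j))) F̂ ≤ u ⊗ level (suc i)
      go zero                eq′ = near (ℕ.≤-trans (ℕ.≤-reflexive eq′) ℕ.z≤n) (cong rise eq′)
      go (suc zero)          eq′ = near (ℕ.≤-trans (ℕ.≤-reflexive eq′) (ℕ.≤ᵇ⇒≤ 1 2 tt)) (cong rise eq′)
      go (suc (suc zero))    eq′ = near (ℕ.≤-reflexive eq′) (cong rise eq′)
      go (suc (suc (suc t))) eq′ = far t eq′

    F-step : ∀ l → E (⟦_⟧ G (searchBody l)) F̂ ≤ F l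
    F-step (phase j)              = F-phase j (J ℕ.∸ j) refl
    F-step (counting y N zero)    = subst (λ Q → (if approxᵇ ε Q (estimate ε (ι (deg G y)) N) then 0ℚ else 1ℚ) ≤ F (counting y N zero)) (sym (fromℕ≡ι n))
      (await-done 0<ε ε<1 (0≤inv n) (inv⊗ nonempty) (trans (sym (⊗-assoc (ι n) (inv n) (ι (deg G y))))
        (trans (cong (_⊗ ι (deg G y)) (trans (⊗-comm (ι n) (inv n)) (inv⊗ nonempty))) (⊗-identityˡ _))))
    F-step (counting y N (suc r)) = await-failure-step G {trial = adjacentTrial y} (Vertex.adjacentTrial-Bernoulli G y ε) (counting y) ε F (failure G ok) (λ _ _ → refl) N r

-- Expected cost over all phases

module AdditiveCost (G : Graph) {ε : ℚ} (0<ε : 0ℚ < ε) (ε<1 : ε < 1ℚ)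
  (J : ℕ) (x-J-large : ι 2147483648 ≤ Additive.x G 0<ε ε<1 J) (x-J-small : Additive.x G 0<ε ε<1 J ≤ ι 8589934592) where
  open Graph G using (n; nonempty)
  open Search (Fin._≟_ {n}) ε using (searchBody; adjacentTrial)
  open Additive G 0<ε ε<1
  open Critical J x-J-large x-J-small

  -- Before phase `J`, x j ≤ x J / 4 ≤ 2³¹, so the cost 84qK + 9qKx of a phase is at most D · qK.
  D : ℚ
  D = ι 84 ⊕ ι 9 ⊗ ι 2147483648

  -- Before `J` the costs D · q2^j telescope to D · q(K J - k), with the probability of continuing
  -- bounded by 1. From `J` on, a phase costs at most 93qkx; doubling k multiplies the remainder by
  -- 8, but it is incurred with probability at most 2/96, and 93 + 124 · 8 · 2/96 ≤ 124.
  remaining : ℕ → ℚ → ℚ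
  remaining zero    k = ι 124 ⊗ (q ⊗ k ⊗ (k ⊗ (k ⊗ p)))
  remaining (suc i) k = D ⊗ (q ⊗ (K J ⊝ k)) ⊕ remaining zero (K J)

  Φ : Stage (Fin n) → ℚ
  Φ (phase j)        = remaining (J ℕ.∸ j) (K j)
  Φ (counting y N r) = awaitCost (ι 2) (ι 4) (Vertex.nbrProb⁻¹ G y ε) r

  0≤remaining₀ : ∀ j → 0ℚ ≤ remaining zero (K j)
  0≤remaining₀ j = 0≤⊗ (0≤ι 124) (0≤⊗ (0≤⊗ 0≤q (0≤K j)) (0≤x j))

  0≤D : 0ℚ ≤ D
  0≤D = 0≤⊕ (0≤ι 84) (0≤⊗ (0≤ι 9) (0≤ι 2147483648))

  0≤Φ : ∀ l → 0ℚ ≤ Φ l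
  0≤Φ (phase j)        = go (J ℕ.∸ j) refl
    where
    go : ∀ i → J ℕ.∸ j ≡ i → 0ℚ ≤ remaining i (K j)
    go zero    _  = 0≤remaining₀ j
    go (suc i) eq = 0≤⊕ (0≤⊗ 0≤D (0≤⊗ 0≤q (gap (ι-mono (ℕ.^-monoʳ-≤ 2 (∸-positive {j} eq)))))) (0≤remaining₀ J)
  0≤Φ (counting y N r) = 0≤awaitCost (ι 4) (Vertex.nbrProb⁻¹ G y ε) r (0≤ι 2) (0≤ι 4) (0≤⊗ (0≤ι n) (0≤inv _))

  Φ̂ : Stage (Fin n) ⊎ Output → ℚ
  Φ̂ = onLoop G Φ (λ _ → 0ℚ)

  continuation : ℕ → ℚ
  continuation j = E (Ph.χ j) (Ph.risk j (PB.notAccepted j))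

  phase-step : ∀ j → 1ℚ ⊕ (cost G (searchBody (phase j)) ⊕ E (⟦_⟧ G (searchBody (phase j))) Φ̂)
    ≤ ι 84 ⊗ (q ⊗ K j) ⊕ ι 9 ⊗ (q ⊗ K j ⊗ x j) ⊕ Φ (phase (suc j)) ⊗ continuation j
  phase-step j = PB.phase-cost j Φ (λ _ → refl)

  Φ-phase : ∀ j i → J ℕ.∸ j ≡ i →
    ι 84 ⊗ (q ⊗ K j) ⊕ ι 9 ⊗ (q ⊗ K j ⊗ x j) ⊕ Φ (phase (suc j)) ⊗ continuation j ≤ remaining i (K j)
  Φ-phase j zero eq = ≤-by-inverse (ι 96) (0≤inv 96) (inv-inverse 95) (≤-cert
    (ι 8064 ⊗ (a ⊗ (x j ⊝ 1ℚ)) ⊕ ι 992 ⊗ (a ⊗ x j) ⊕ ι 992 ⊗ (a ⊗ x j) ⊗ (ι 2 ⊝ ι 96 ⊗ R))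
    (0≤⊕ (0≤⊕ (0≤⊗ (0≤ι 8064) (0≤⊗ 0≤a (gap 1≤x))) (0≤⊗ (0≤ι 992) (0≤⊗ 0≤a (0≤x j)))) (0≤⊗ (0≤⊗ (0≤ι 992) (0≤⊗ 0≤a (0≤x j))) (gap rare)))
    (trans (solve 4 (λ q k p r → con (+ 96) :* (con (+ 124) :* (q :* k :* (k :* (k :* p)))) :=
        con (+ 96) :* (con (+ 84) :* (q :* k) :+ con (+ 9) :* (q :* k :* (k :* (k :* p))) :+ (con (+ 124) :* (q :* (con (+ 2) :* k) :* (con (+ 2) :* k :* (con (+ 2) :* k :* p)))) :* r)
        :+ (con (+ 8064) :* (q :* k :* (k :* (k :* p) :- con (+ 1))) :+ con (+ 992) :* (q :* k :* (k :* (k :* p))) :+ con (+ 992) :* (q :* k :* (k :* (k :* p))) :* (con (+ 2) :- con (+ 96) :* r))) refl q (K j) p R)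
      (cong (λ z → ι 96 ⊗ (ι 84 ⊗ a ⊕ ι 9 ⊗ (a ⊗ x j) ⊕ z ⊗ R) ⊕ (ι 8064 ⊗ (a ⊗ (x j ⊝ 1ℚ)) ⊕ ι 992 ⊗ (a ⊗ x j) ⊕ ι 992 ⊗ (a ⊗ x j) ⊗ (ι 2 ⊝ ι 96 ⊗ R)))
        (sym (trans (cong (λ i → remaining i (K (suc j))) past) (cong (remaining zero) (K-suc j)))))))
    where
    a = q ⊗ K j
    R = continuation j
    0≤a : 0ℚ ≤ a
    0≤a = 0≤⊗ 0≤q (0≤K j)
    past : J ℕ.∸ suc j ≡ 0
    past = ℕ.m≤n⇒m∸n≡0 (ℕ.m≤n⇒m≤1+n (J≤ {j} eq))
    large : ι 2147483648 ≤ x j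
    large = ℚ.≤-trans x-J-large (x-mono (J≤ {j} eq))
    1≤x : 1ℚ ≤ x j
    1≤x = ℚ.≤-trans (ι-mono (ℕ.≤ᵇ⇒≤ 1 2147483648 tt)) large
    rare : ι 96 ⊗ R ≤ ι 2
    rare = Ph.phase-risk j (ℚ.≤-trans (ι-mono (ℕ.≤ᵇ⇒≤ 33554432 2147483648 tt)) large) (PB.notAccepted j)
      (λ X → 0≤𝟙 _) (λ X → 𝟙≤1 _) (PB.Large.notAccepted≤penalty j (extreme {j} large))
  Φ-phase j (suc i) eq = begin
    ι 84 ⊗ (q ⊗ K j) ⊕ ι 9 ⊗ (q ⊗ K j ⊗ x j) ⊕ Φ (phase (suc j)) ⊗ continuation j
      ≤⟨ ⊕-mono-≤ (⊕-mono-≤ ℚ.≤-refl (⊗-monoʳ-≤ (0≤ι 9) (⊗-monoʳ-≤ (0≤⊗ 0≤q (0≤K j)) x≤)))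
           (ℚ.≤-trans (⊗-monoʳ-≤ (0≤Φ (phase (suc j))) R≤1) (ℚ.≤-trans (ℚ.≤-reflexive (⊗-identityʳ _)) next)) ⟩
    ι 84 ⊗ (q ⊗ K j) ⊕ ι 9 ⊗ (q ⊗ K j ⊗ c) ⊕ (D ⊗ (q ⊗ (K J ⊝ ι 2 ⊗ K j)) ⊕ remaining zero (K J))
      ≡⟨ solve 5 (λ q k c m r → con (+ 84) :* (q :* k) :+ con (+ 9) :* (q :* k :* c) :+ ((con (+ 84) :+ con (+ 9) :* c) :* (q :* (m :- con (+ 2) :* k)) :+ r)
           := (con (+ 84) :+ con (+ 9) :* c) :* (q :* (m :- k)) :+ r) refl q (K j) c (K J) (remaining zero (K J)) ⟩
    D ⊗ (q ⊗ (K J ⊝ K j)) ⊕ remaining zero (K J) ∎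
    where
    open ℚ.≤-Reasoning
    c = ι 2147483648
    R≤1 : continuation j ≤ 1ℚ
    R≤1 = E≤ (Ph.χ j) {Ph.risk j (PB.notAccepted j)} (λ s → each (proj₁ s) (proj₂ s))
      where
      each : ∀ y θ → Ph.risk j (PB.notAccepted j) (y , θ) ≤ 1ℚ
      each y θ = ℚ.≤-trans (⊗-mono-≤ (Vertex.0≤missProb G y ε (2 ℕ.^ j)) 0≤1 (Vertex.missProb≤1 G y ε (2 ℕ.^ j))
        (E≤ (Count.count G θ ε (2 ℕ.^ j)) {PB.notAccepted j} (λ X → 𝟙≤1 _))) (ℚ.≤-reflexive (⊗-identityˡ 1ℚ))
    x≤ : x j ≤ c
    x≤ = ≤-by-inverse (ι 4) (0≤inv 4) (inv-inverse 3) (ℚ.≤-trans (⊗-monoˡ-≤ (0≤x j) 4≤) (ℚ.≤-trans (ℚ.≤-reflexive (sym (x-before {j} eq)))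
      (ℚ.≤-trans x-J-small (ℚ.≤-reflexive (ι-* 4 2147483648)))))
      where
      2≤K : ι 2 ≤ K (suc i)
      2≤K = ι-mono (ℕ.^-monoʳ-≤ 2 (ℕ.s≤s (ℕ.z≤n {i})))
      4≤ : ι 4 ≤ K (suc i) ⊗ K (suc i)
      4≤ = ℚ.≤-trans (ℚ.≤-reflexive (ι-* 2 2)) (⊗-mono-≤ (0≤ι 2) (0≤K (suc i)) 2≤K 2≤K)
    next : Φ (phase (suc j)) ≤ D ⊗ (q ⊗ (K J ⊝ ι 2 ⊗ K j)) ⊕ remaining zero (K J)
    next = go i refl
      where
      go : ∀ i′ → i ≡ i′ → remaining (J ℕ.∸ suc j) (K (suc j)) ≤ D ⊗ (q ⊗ (K J ⊝ ι 2 ⊗ K j)) ⊕ remaining zero (K J)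
      go zero eq′ = ℚ.≤-reflexive (trans (cong₂ remaining (trans (∸-next {j} eq) eq′) K≡)
        (trans (solve 3 (λ d q r → r := d :* (q :* con (+ 0)) :+ r) refl D q (remaining zero (K J)))
          (cong (λ z → D ⊗ (q ⊗ z) ⊕ remaining zero (K J)) (trans (solve 1 (λ k → con (+ 0) := k :- k) refl (K J)) (cong (K J ⊝_) (trans (sym K≡) (K-suc j)))))))
        where
        K≡ : K (suc j) ≡ K J
        K≡ = cong K (sym (trans (∸-sum {j} eq) (trans (cong (λ i → j ℕ.+ suc i) eq′) (ℕ.+-comm j 1))))
      go (suc i′) eq′ = ℚ.≤-reflexive (trans (cong (λ i → remaining i (K (suc j))) (trans (∸-next {j} eq) eq′))
        (cong (λ z → D ⊗ (q ⊗ (K J ⊝ z)) ⊕ remaining zero (K J)) (K-suc j)))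

  Φ-step : ∀ l → 1ℚ ⊕ (cost G (searchBody l) ⊕ E (⟦_⟧ G (searchBody l)) Φ̂) ≤ Φ l
  Φ-step (phase j)              = ℚ.≤-trans (phase-step j) (Φ-phase j (J ℕ.∸ j) refl)
  Φ-step (counting y N zero)    = ℚ.≤-reflexive (solve 1 (λ z → con (+ 1) :+ (con (+ 1) :+ con (+ 0) :+ con (+ 0)) := con (+ 2) :+ con (+ 0) :* z) refl ((1ℚ ⊕ ι 4) ⊗ Vertex.nbrProb⁻¹ G y ε))
  Φ-step (counting y N (suc r)) = await-cost-step G {trial = adjacentTrial y} (Vertex.adjacentTrial-Bernoulli G y ε) (counting y) (ι 2) (ι 4) (Vertex.nbrProb⁻¹ G y ε) Φ
    (Vertex.nbrProb-inverse G y ε) (Vertex.adjacentTrial-cost G y ε) (λ _ _ → refl) N r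

  module S = Soundness G searchBody (phase 0) Φ 0≤Φ Φ-step

  F-start : ι 4 ⊗ F (phase 0) ≤ 1ℚ
  F-start = subst (ι 4 ⊗ (u ⊗ level J) ≤_) 96u (≤-cert (ι 4 ⊗ (u ⊗ (ι 24 ⊝ level J))) (0≤⊗ (0≤ι 4) (0≤⊗ 0≤u (gap (level≤24 J))))
    (solve 2 (λ u l → con (+ 96) :* u := con (+ 4) :* (u :* l) :+ con (+ 4) :* (u :* (con (+ 24) :- l))) refl u (level J)))

  succeeds : Succeeds additiveAlgorithm ε G
  succeeds = S.Success.succeeds ok F 0≤F F-step F-start

  B : ℚ
  B = ι 1084479242324

  B≡ : B ≡ D ⊕ ι 124 ⊗ ι 8589934592
  B≡ = solve 0 (con (+ 1084479242324) := con (+ 84) :+ con (+ 9) :* con (+ 2147483648) :+ con (+ 124) :* con (+ 8589934592)) refl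

  Φ-start : Φ (phase 0) ≤ B ⊗ (q ⊗ K J)
  Φ-start = go J refl
    where
    open ℚ.≤-Reasoning
    go : ∀ i → J ≡ i → remaining i 1ℚ ≤ B ⊗ (q ⊗ K J)
    go zero    eq = begin
      remaining zero (K 0)                       ≡⟨ cong (remaining zero ∘ K) eq ⟨
      remaining zero (K J)                       ≤⟨ ⊗-monoʳ-≤ (0≤ι 124) (⊗-monoʳ-≤ (0≤⊗ 0≤q (0≤K J)) x-J-small) ⟩
      ι 124 ⊗ (q ⊗ K J ⊗ ι 8589934592)           ≤⟨ ≤-cert (D ⊗ (q ⊗ K J)) (0≤⊗ 0≤D (0≤⊗ 0≤q (0≤K J))) (trans (cong (_⊗ (q ⊗ K J)) B≡)
        (solve 4 (λ d c m a → (d :+ c :* m) :* a := c :* (a :* m) :+ d :* a) refl D (ι 124) (ι 8589934592) (q ⊗ K J))) ⟩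
      B ⊗ (q ⊗ K J)                              ∎
    go (suc i) eq = begin
      D ⊗ (q ⊗ (K J ⊝ 1ℚ)) ⊕ remaining zero (K J)
        ≤⟨ ⊕-mono-≤ ℚ.≤-refl (⊗-monoʳ-≤ (0≤ι 124) (⊗-monoʳ-≤ (0≤⊗ 0≤q (0≤K J)) x-J-small)) ⟩
      D ⊗ (q ⊗ (K J ⊝ 1ℚ)) ⊕ ι 124 ⊗ (q ⊗ K J ⊗ ι 8589934592)
        ≤⟨ ≤-cert (D ⊗ q) (0≤⊗ 0≤D 0≤q) (trans (cong (_⊗ (q ⊗ K J)) B≡)
             (solve 5 (λ d c m q k → (d :+ c :* m) :* (q :* k) := d :* (q :* (k :- con (+ 1))) :+ c :* (q :* k :* m) :+ d :* q) refl D (ι 124) (ι 8589934592) q (K J))) ⟩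
      B ⊗ (q ⊗ K J) ∎

  expCost-bound : ∀ k → ExpCost additiveAlgorithm ε G k ⊗ (ε ⊗ ε) ≤ ι 2 ⊗ B ⊗ K J
  expCost-bound k = begin
    ExpCost additiveAlgorithm ε G k ⊗ (ε ⊗ ε)   ≤⟨ ⊗-monoˡ-≤ (0≤sq ε) (ℚ.≤-trans (S.expCost≤ k (ret (inj₁ (phase 0)))) (ℚ.≤-trans (ℚ.≤-reflexive (⊕-identityˡ _)) Φ-start)) ⟩
    B ⊗ (q ⊗ K J) ⊗ (ε ⊗ ε)                     ≡⟨ solve 4 (λ b q k e → b :* (q :* k) :* (e :* e) := b :* k :* (q :* (e :* e))) refl B q (K J) ε ⟩
    B ⊗ K J ⊗ (q ⊗ (ε ⊗ ε))                     ≤⟨ ⊗-monoʳ-≤ (0≤⊗ (0≤ι 1084479242324) (0≤K J)) (qε²≤2 0<ε ε<1) ⟩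
    B ⊗ K J ⊗ ι 2                               ≡⟨ solve 3 (λ b k t → b :* k :* t := t :* b :* k) refl B (K J) (ι 2) ⟩
    ι 2 ⊗ B ⊗ K J                               ∎
    where open ℚ.≤-Reasoning

  -- (K J)² = x J · ρ ≤ 2³³ρ, so squaring avoids a square root of n/d. The factor 262144 = 2¹⁸
  -- rounds up the root of 4 · 2³³ = 2³⁵.
  squared-cost : ∀ k → (ExpCost additiveAlgorithm ε G k ⊗ (ε ⊗ ε)) ⊗ (ExpCost additiveAlgorithm ε G k ⊗ (ε ⊗ ε))
    ≤ (B ⊗ ι 262144) ⊗ (B ⊗ ι 262144) ⊗ ρ G
  squared-cost k = begin
    e ⊗ e                                           ≤⟨ sq-mono 0<ε ε<1 (0≤⊗ (S.0≤expCost k (ret (inj₁ (phase 0)))) (0≤sq ε)) (expCost-bound k) ⟩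
    (ι 2 ⊗ B ⊗ K J) ⊗ (ι 2 ⊗ B ⊗ K J)               ≡⟨ trans (sym (⊗-identityʳ _)) (cong ((ι 2 ⊗ B ⊗ K J) ⊗ (ι 2 ⊗ B ⊗ K J) ⊗_) (sym (ρ⊗edgeProb G))) ⟩
    (ι 2 ⊗ B ⊗ K J) ⊗ (ι 2 ⊗ B ⊗ K J) ⊗ (ρ G ⊗ p)   ≡⟨ solve 5 (λ t b k r p → (t :* b :* k) :* (t :* b :* k) :* (r :* p) := t :* t :* (b :* b) :* r :* (k :* (k :* p))) refl (ι 2) B (K J) (ρ G) p ⟩
    ι 2 ⊗ ι 2 ⊗ (B ⊗ B) ⊗ ρ G ⊗ x J                 ≤⟨ ⊗-monoʳ-≤ (0≤⊗ (0≤⊗ (0≤sq (ι 2)) (0≤sq B)) (0≤ρ G)) x-J-small ⟩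
    ι 2 ⊗ ι 2 ⊗ (B ⊗ B) ⊗ ρ G ⊗ ι 8589934592        ≤⟨ ≤-cert (ι 34359738368 ⊗ (B ⊗ B ⊗ ρ G)) (0≤⊗ (0≤ι 34359738368) (0≤⊗ (0≤sq B) (0≤ρ G)))
      (solve 2 (λ b r → (b :* con (+ 262144)) :* (b :* con (+ 262144)) :* r := con (+ 2) :* con (+ 2) :* (b :* b) :* r :* con (+ 8589934592) :+ con (+ 34359738368) :* (b :* b :* r)) refl B (ρ G)) ⟩
    (B ⊗ ι 262144) ⊗ (B ⊗ ι 262144) ⊗ ρ G           ∎
    where
    open ℚ.≤-Reasoning
    e = ExpCost additiveAlgorithm ε G k ⊗ (ε ⊗ ε)

module _ (G : Graph) {ε : ℚ} (0<ε : 0ℚ < ε) (ε<1 : ε < 1ℚ) where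
  private
    module C = AdditiveCost G 0<ε ε<1

  additiveAlgorithm-succeeds : Succeeds additiveAlgorithm ε G
  additiveAlgorithm-succeeds = let (J , lo , hi) = Additive.critical G 0<ε ε<1 in C.succeeds J lo hi

  additiveAlgorithm-cost : ∀ k → (ExpCost additiveAlgorithm ε G k ⊗ (ε ⊗ ε)) ⊗ (ExpCost additiveAlgorithm ε G k ⊗ (ε ⊗ ε))
    ≤ (ι 1084479242324 ⊗ ι 262144) ⊗ (ι 1084479242324 ⊗ ι 262144) ⊗ ρ G
  additiveAlgorithm-cost = let (J , lo , hi) = Additive.critical G 0<ε ε<1 in C.squared-cost J lo hi

-- A common constant, and the theorem

constant : ℚ
constant = ι 1084479242324 ⊗ ι 262144

0≤constant : 0ℚ ≤ constant
0≤constant = 0≤⊗ (0≤ι 1084479242324) (0≤ι 262144)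

97≤constant : ι 97 ≤ constant
97≤constant = ℚ.≤-trans (ι-mono (ℕ.≤ᵇ⇒≤ 97 (1084479242324 ℕ.* 262144) tt)) (ℚ.≤-reflexive (ι-* 1084479242324 262144))

theorem4p5 : ∃ λ (C : ℚ) → 0ℚ ≤ C ×
    (∃ λ (A : Algorithm) → PairOnly A ×
    (∀ (ε : ℚ) → 0ℚ < ε → ε < 1ℚ → ∀ (G : Graph) →
    Succeeds A ε G ×
    (∀ k → ExpCost A ε G k * (ε * ε) ≤ C * nOverD G))) ×
    (∃ λ (B : Algorithm) → AdditiveOnly B ×
    (∀ (ε : ℚ) → 0ℚ < ε → ε < 1ℚ → ∀ (G : Graph) →
    Succeeds B ε G ×
    (∀ k → (ExpCost B ε G k * (ε * ε)) * (ExpCost B ε G k * (ε * ε))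
    ≤ (C * C) * nOverD G)))
theorem4p5 = constant , 0≤constant ,
  (pairAlgorithm , (λ V _≟_ ε → act-pairs (densityBody ε)) , λ ε 0<ε ε<1 G → pairAlgorithm-succeeds G 0<ε ε<1 , λ k →
    subst₂ _≤_ (unseal (ExpCost pairAlgorithm ε G k) ε) (trans (⊗≡* constant (ρ G)) (cong (constant *_) (sym (nOverD≡ρ G))))
      (ℚ.≤-trans (pairAlgorithm-cost G 0<ε ε<1 k) (⊗-monoˡ-≤ (0≤ρ G) 97≤constant))) ,
  (additiveAlgorithm , (λ V _≟_ ε → act-additives (Search.searchBody _≟_ ε)) , λ ε 0<ε ε<1 G → additiveAlgorithm-succeeds G 0<ε ε<1 , λ k →
    subst₂ _≤_ (trans (⊗≡* _ _) (cong₂ _*_ (unseal (ExpCost additiveAlgorithm ε G k) ε) (unseal (ExpCost additiveAlgorithm ε G k) ε)))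
      (trans (⊗≡* (constant ⊗ constant) (ρ G)) (cong₂ _*_ (⊗≡* constant constant) (sym (nOverD≡ρ G))))
      (additiveAlgorithm-cost G 0<ε ε<1 k))
  where
  unseal : ∀ e ε → e ⊗ (ε ⊗ ε) ≡ e * (ε * ε)
  unseal e ε = trans (⊗≡* e (ε ⊗ ε)) (cong (e *_) (⊗≡* ε ε))
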